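{- Let $\mathbb A$ be a first-order reduct of the universal homogeneous tournament $\mathbb T$ that is a model-complete core. Then precisely one of the following holds: (1) $\mathrm{Pol}(\mathbb A)$ has a uniformly continuous clone homomorphism to $\mathscr P$; (2) $\mathrm{Pol}(\mathbb A)$ contains a ternary operation that is canonical with respect to $\mathbb T$ and pseudo-cyclic modulo $\overline{\mathrm{Aut}(\mathbb T)}$.
   Context: $\mathbb T=(T;\to)$ is the unique countable homogeneous tournament containing every finite tournament as induced substructure. A first-order reduct of $\mathbb T$ is a structure on $T$ whose relations are first-order definable in $\mathbb T$ without parameters. $\mathbb A$ is a model-complete core if for every endomorphism $e$ and finite $F\subseteq T$ some automorphism of $\mathbb A$ agrees with $e$ on $F$. $\mathrm{Pol}(\mathbb A)$ is the clone of polymorphisms (homomorphisms $\mathbb A^k\to\mathbb A$). $\mathscr P$ is the clone of projections on $\{0,1\}$; a clone homomorphism preserves arities, projections and composition, and $\xi:\mathrm{Pol}(\mathbb A)\to\mathscr P$ is uniformly continuous if for each $n$ there is finite $F\subseteq T^n$ with $\xi(f)=\xi(g)$ whenever $n$-ary $f,g$ agree on $F$. A $k$-ary $f$ is canonical w.r.t. $\mathbb T$ if for every $m$, whenever $a_i,b_i\in T^m$ are in the same $\mathrm{Aut}(\mathbb T)$-orbit for all $i$, $f(a_1,\dots,a_k)$ and $f(b_1,\dots,b_k)$ are in the same orbit. $\overline{\mathrm{Aut}(\mathbb T)}$ is the closure of $\mathrm{Aut}(\mathbb T)$ in the topology of pointwise convergence. A ternary $s$ is pseudo-cyclic modulo $\mathscr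 F$ if there are $e,f\in\mathscr F$ with $e\circ s(x,y,z)=f\circ s(y,z,x)$ for all $x,y,z$. -}

module Defs where

open import Level using (0ℓ)
open import Data.Nat using (ℕ; suc)
open import Data.Bool using (Bool; true; false)
open import Data.Fin using (Fin; zero; suc)
open import Data.List using (List)
open import Data.List.Membership.Propositional using (_∈_)
open import Data.Product using (Σ; ∃; _×_; _,_)
open import Data.Sum using (_⊎_)
open import Data.Empty using (⊥)
open import Relation.Nullary using (¬_)
open import Relation.Binary.PropositionalEquality using (_≡_; _≢_)
open import Function.Definitions using (Injective)

record IsTournament {A : Set} (E : A → A → Bool) : Set where
  field
    irrefl : ∀ x → E x x ≡ false
    total  : ∀ x y → x ≢ y → (E x y ≡ true) ⊎ (E y x ≡ true)
    asym   : ∀ x y → E x y ≡ true → E y x ≡ false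

record AutT (E : ℕ → ℕ → Bool) : Set where
  field
    to       : ℕ → ℕ
    from     : ℕ → ℕ
    to-from  : ∀ x → to (from x) ≡ x
    from-to  : ∀ x → from (to x) ≡ x
    preserve : ∀ x y → E (to x) (to y) ≡ E x y
open AutT public

-- Homogeneity: every isomorphism between finite induced substructures
-- (given by two injective enumerations a, b with a i ↦ b i) extends
-- to an automorphism.
Homogeneous : (ℕ → ℕ → Bool) → Set
Homogeneous E =
  ∀ (n : ℕ) (a b : Fin n → ℕ) →
  Injective _≡_ _≡_ a → Injective _≡_ _≡_ b →
  (∀ i j → E (a i) (a j) ≡ E (b i) (b j)) →
  Σ (AutT E) λ α → ∀ i → to α (a i) ≡ b i

Universal : (ℕ → ℕ → Bool) → Set
Universal E =
  ∀ (n : ℕ) (e : Fin n → Fin n → Bool) → IsTournament e →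
  Σ (Fin n → ℕ) λ f → Injective _≡_ _≡_ f × (∀ i j → E (f i) (f j) ≡ e i j)

record IsUniversalHomogeneousTournament (E : ℕ → ℕ → Bool) : Set where
  field
    tournament  : IsTournament E
    homogeneous : Homogeneous E
    universal   : Universal E

data Formula : ℕ → Set where
  edge : ∀ {n} → Fin n → Fin n → Formula n
  eq   : ∀ {n} → Fin n → Fin n → Formula n
  neg  : ∀ {n} → Formula n → Formula n
  conj : ∀ {n} → Formula n → Formula n → Formula n
  ex   : ∀ {n} → Formula (suc n) → Formula n

extend : ∀ {n} → ℕ → (Fin n → ℕ) → Fin (suc n) → ℕ
extend x v zero    = x
extend x v (suc i) = v i

Sat : (E : ℕ → ℕ → Bool) → ∀ {n} → Formula n → (Fin n → ℕ) → Set
Sat E (edge i j) v = E (v i) (v j) ≡ true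
Sat E (eq i j)   v = v i ≡ v j
Sat E (neg φ)    v = ¬ Sat E φ v
Sat E (conj φ ψ) v = Sat E φ v × Sat E ψ v
Sat E (ex φ)     v = Σ ℕ λ x → Sat E φ (extend x v)

module Structure {I : Set} (ar : I → ℕ) (R : (i : I) → (Fin (ar i) → ℕ) → Set) where

  IsReduct : (ℕ → ℕ → Bool) → Set
  IsReduct E = ∀ i → Σ (Formula (ar i)) λ φ →
    ∀ v → (R i v → Sat E φ v) × (Sat E φ v → R i v)

  IsEndo : (ℕ → ℕ) → Set
  IsEndo e = ∀ i v → R i v → R i (λ l → e (v l))

  record AutA : Set where
    field
      to       : ℕ → ℕ
      from     : ℕ → ℕ
      to-from  : ∀ x → to (from x) ≡ x
      from-to  : ∀ x → from (to x) ≡ x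
      pres     : ∀ i v → R i v → R i (λ l → to (v l))
      refl'    : ∀ i v → R i (λ l → to (v l)) → R i v

  ModelCompleteCore : Set
  ModelCompleteCore = ∀ (e : ℕ → ℕ) → IsEndo e → ∀ (F : List ℕ) →
    Σ AutA λ α → ∀ x → x ∈ F → AutA.to α x ≡ e x

  IsPol : ∀ {k} → ((Fin k → ℕ) → ℕ) → Set
  IsPol {k} f = ∀ i (m : Fin k → Fin (ar i) → ℕ) →
    (∀ j → R i (m j)) → R i (λ l → f (λ j → m j l))

  proj : ∀ {k} → Fin k → (Fin k → ℕ) → ℕ
  proj j x = x j

  compose : ∀ {n k} → ((Fin n → ℕ) → ℕ) → (Fin n → (Fin k → ℕ) → ℕ) → (Fin k → ℕ) → ℕ
  compose f g x = f (λ j → g j x)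

  -- A clone homomorphism Pol(A) → 𝒫.  The k-ary part of 𝒫 consists of
  -- the k projections π^k_j on {0,1}, which we identify with j : Fin k.
  -- Composition in 𝒫:  π^n_j(π^k_{i_1},…,π^k_{i_n}) = π^k_{i_j}.
  Hom : Set
  Hom = ∀ (k : ℕ) (f : (Fin k → ℕ) → ℕ) → IsPol f → Fin k

  IsCloneHom : Hom → Set
  IsCloneHom ξ =
    (∀ k (j : Fin k) (p : IsPol (proj j)) → ξ k (proj j) p ≡ j) ×
    (∀ n k (f : (Fin n → ℕ) → ℕ) (pf : IsPol f)
       (g : Fin n → (Fin k → ℕ) → ℕ) (pg : ∀ j → IsPol (g j))
       (pc : IsPol (compose f g)) →
       ξ k (compose f g) pc ≡ ξ k (g (ξ n f pf)) (pg (ξ n f pf)))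

  UniformlyContinuous : Hom → Set
  UniformlyContinuous ξ = ∀ n → Σ (List (Fin n → ℕ)) λ F →
    ∀ f pf g pg → (∀ a → a ∈ F → f a ≡ g a) → ξ n f pf ≡ ξ n g pg

  Condition1 : Set
  Condition1 = Σ Hom λ ξ → IsCloneHom ξ × UniformlyContinuous ξ

SameOrbit : (E : ℕ → ℕ → Bool) → ∀ {m} → (Fin m → ℕ) → (Fin m → ℕ) → Set
SameOrbit E u v = Σ (AutT E) λ α → ∀ l → to α (u l) ≡ v l

Canonical : (E : ℕ → ℕ → Bool) → ∀ {k} → ((Fin k → ℕ) → ℕ) → Set
Canonical E {k} f = ∀ (m : ℕ) (a b : Fin k → Fin m → ℕ) →
  (∀ i → SameOrbit E (a i) (b i)) →
  SameOrbit E (λ l → f (λ i → a i l)) (λ l → f (λ i → b i l))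

InClosureAut : (E : ℕ → ℕ → Bool) → (ℕ → ℕ) → Set
InClosureAut E e = ∀ (F : List ℕ) → Σ (AutT E) λ α → ∀ x → x ∈ F → to α x ≡ e x

triple : ℕ → ℕ → ℕ → Fin 3 → ℕ
triple x y z zero             = x
triple x y z (suc zero)       = y
triple x y z (suc (suc zero)) = z

PseudoCyclicModClosureAut : (E : ℕ → ℕ → Bool) → ((Fin 3 → ℕ) → ℕ) → Set
PseudoCyclicModClosureAut E s =
  Σ (ℕ → ℕ) λ e → Σ (ℕ → ℕ) λ f → InClosureAut E e × InClosureAut E f ×
    (∀ x y z → e (s (triple x y z)) ≡ f (s (triple y z x)))

module _ {I : Set} (ar : I → ℕ) (R : (i : I) → (Fin (ar i) → ℕ) → Set) where
  open Structure ar R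
  Condition2 : (ℕ → ℕ → Bool) → Set
  Condition2 E = Σ ((Fin 3 → ℕ) → ℕ) λ s →
    IsPol s × Canonical E s × PseudoCyclicModClosureAut E s

ExactlyOne : Set → Set → Set
ExactlyOne P Q = (P ⊎ Q) × ¬ (P × Q)

{-# OPTIONS --safe #-}
module Submission where

-- Idea.  Let C be the clone of polymorphisms and G the automorphism group of 𝔸.  In a
-- core an operation maps pairs of tuples that differ in every coordinate to distinct
-- points.  If no binary operation depends on both arguments, then every operation is
-- essentially unary, and the argument it depends on gives condition (1).  Otherwise C
-- has operations that are injective on any prescribed finite set, and there are three
-- cases, according to G.
--
-- * Every element of G preserves or reverses all arcs.  Consider the arc-preserving
--   operations.  Either each of them copies the arcs of one coordinate, which gives (1),
--   or on any finite set some ternary operation acts on arcs as majority or minority;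
--   resolving ties lexicographically by a binary operation p that is dominated by its
--   first argument, and plugging p(x,p(y,z)) and its rotations into it, one gets
--   operations with a behaviour on types of pairs that is invariant under rotation.
--
-- * Otherwise reversing all arcs at one point does not change the G-orbit of a finite
--   tuple.  Then (a, b) ↦ E a b + E 0 a + E 0 b (mod 2) is a tournament on the points other than 0,
--   with the 0-stabilisers of C and G acting on it, and the previous case applies to it;
--   the coordinate is now read off the signs of triples.
--
-- * If arcs can be reversed at points in that tournament as well, all injective tuples
--   are G-equivalent and any behaviour can be imposed on an injective operation.
--
-- In the cyclic cases the behaviour is realised on all of T by an operation s; it is
-- canonical because its values are determined up to isomorphism by the types of the
-- arguments, and s(x,y,z), s(y,z,x) are identified in an amalgam of two copies of 𝕋.
--
-- The conditions exclude each other because the rotation has no fixed coordinate.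

open import Defs hiding (to; from; to-from; from-to; preserve)
open import Level using (0ℓ)
open import Data.Nat using (ℕ; zero; suc; _≟_; _<_; _≤_; s≤s; z≤n; _+_; _<?_; _⊔_; pred)
open import Data.Nat.Properties using (≤-refl; ≤-trans; <-irrefl; m<1+n⇒m≤n; m≤n⇒m<n∨m≡n; n<1+n; m<n⇒m<1+n; +-suc; +-identityʳ; m≤m⊔n; m≤n⊔m; <-cmp; <⇒≱; <⇒≤)
open import Data.Bool using (Bool; true; false; not; _xor_; if_then_else_)
open import Data.Bool.Properties using (not-involutive; xor-comm; xor-same; xor-identityʳ; xor-assoc) renaming (_≟_ to _≟B_)
open import Data.Fin using (Fin; zero; suc; toℕ; fromℕ<)
open import Data.Fin.Properties using (any?; toℕ<n; toℕ-injective; toℕ-fromℕ<) renaming (_≟_ to _≟F_)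
open import Axiom.ExcludedMiddle using (ExcludedMiddle)
open import Data.Bool.Solver using (module xor-∧-Solver)
open import Data.Empty using (⊥; ⊥-elim)
open import Data.List using (List; []; _∷_; _++_; map; length; lookup; tabulate; upTo; filter; cartesianProduct; allFin; deduplicate; concatMap)
open import Data.List.Membership.Propositional using (_∈_)
open import Data.List.Membership.Propositional.Properties using (∈-++⁺ˡ; ∈-++⁺ʳ; ∈-map⁺; ∈-lookup; ∈-tabulate⁺; ∈-map⁻; ∈-upTo⁺; ∈-filter⁺; ∈-filter⁻; ∈-cartesianProduct⁺; ∈-cartesianProduct⁻; ∈-allFin; ∈-deduplicate⁺; ∈-deduplicate⁻; ∈-concatMap⁺)
open import Data.List.Relation.Unary.All as All using (All; []; _∷_)
open import Data.List.Relation.Unary.All.Properties using () renaming (++⁺ to All-++; map⁺ to All-map; ++⁻ to All-++⁻; map⁻ to All-map⁻; tabulate⁺ to All-tab; tabulate⁻ to All-tab⁻)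
open import Data.List.Relation.Unary.AllPairs as AllPairs using (AllPairs; []; _∷_)
open import Data.List.Relation.Unary.AllPairs.Properties using () renaming (map⁺ to AP-map; ++⁺ to AP-++; tabulate⁺ to AP-tab)
open import Data.List.Relation.Unary.Any as Any using (here; there; index)
open import Data.List.Relation.Unary.Any.Properties using (lookup-index)
open import Data.List.Relation.Unary.Unique.DecPropositional.Properties using (deduplicate-!)
open import Data.Product using (Σ; _×_; _,_; proj₁; proj₂; swap)
open import Data.Sum using (_⊎_; inj₁; inj₂)
open import Data.Unit using (⊤; tt)
open import Data.Vec as Vec using ()
open import Data.Vec.Properties using (lookup∘tabulate; tabulate-cong)
open import Function.Definitions using (Injective)
open import Relation.Binary.Definitions using (tri<; tri≈; tri>)
open import Relation.Binary.PropositionalEquality using (_≡_; _≢_; refl; sym; trans; cong; cong₂; subst; subst₂)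
open import Relation.Nullary using (¬_; Dec; yes; no; ⌊_⌋)

-- Two obstacles shape the proof. An operation dominated by its first argument says nothing about
-- ties, the pairs with equal first arguments, while a canonical operation must treat all ties
-- alike. With majority, either some finite configuration forces its tie to be reversed, and copies
-- of it reverse every tie, or ties can be kept one at a time and majority merges the solutions.
-- With minority, sums of operations change a single tie if the orientation of ties is not additive;
-- if it is additive, density makes it constant: a finite colouring of the points has a colour that
-- is dense below some finite set of prescribed arcs. The same density fixes the effect of an
-- automorphism on generic points, which yields switching from one automorphism that keeps some arc
-- and reverses another.
--
-- The second obstacle is that arguments are functions on a finite index set and operations may tell
-- pointwise equal ones apart. The clones inside the proof consist of operations that respect
-- pointwise equality, but condition (1) speaks of all polymorphisms, so its composition law is
-- recovered through representatives.

Op : ℕ → Set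
Op k = (Fin k → ℕ) → ℕ

_≗'_ : ∀ {k} → (Fin k → ℕ) → (Fin k → ℕ) → Set
x ≗' y = ∀ j → x j ≡ y j

_#_ : ∀ {k} → (Fin k → ℕ) → (Fin k → ℕ) → Set
x # y = ∀ j → x j ≢ y j

Inj : ∀ {n} → (Fin n → ℕ) → Set
Inj a = Injective _≡_ _≡_ a

two : ∀ {A : Set} → A → A → Fin 2 → A
two f g zero = f
two f g (suc zero) = g

three : ∀ {A : Set} → A → A → A → Fin 3 → A
three f g h zero = f
three f g h (suc zero) = g
three f g h (suc (suc zero)) = h

bool-em : ∀ b → (b ≡ true) ⊎ (b ≡ false)
bool-em true = inj₁ refl
bool-em false = inj₂ refl

t≢f : ∀ {b} → b ≡ true → b ≡ false → ⊥
t≢f refl ()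

¬t→f : ∀ {b} → b ≢ true → b ≡ false
¬t→f {true} n = ⊥-elim (n refl)
¬t→f {false} n = refl

¬f→t : ∀ {b} → b ≢ false → b ≡ true
¬f→t {true} n = refl
¬f→t {false} n = ⊥-elim (n refl)

≢→not : ∀ {a b : Bool} → a ≢ b → a ≡ not b
≢→not {true} {true} n = ⊥-elim (n refl)
≢→not {true} {false} n = refl
≢→not {false} {true} n = refl
≢→not {false} {false} n = ⊥-elim (n refl)

b≢not : ∀ {b} → b ≢ not b
b≢not {true} ()
b≢not {false} ()

allpairs-lookup : ∀ {A : Set} {R : A → A → Set} (xs : List A) → AllPairs R xs → ∀ i j → i ≢ j →
  R (lookup xs i) (lookup xs j) ⊎ R (lookup xs j) (lookup xs i)
allpairs-lookup (x ∷ xs) (a ∷ ap) zero zero n = ⊥-elim (n refl)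
allpairs-lookup (x ∷ xs) (a ∷ ap) zero (suc j) n = inj₁ (All.lookup a (∈-lookup j))
allpairs-lookup (x ∷ xs) (a ∷ ap) (suc i) zero n = inj₂ (All.lookup a (∈-lookup i))
allpairs-lookup (x ∷ xs) (a ∷ ap) (suc i) (suc j) n = allpairs-lookup xs ap i j (λ e → n (cong suc e))


-- Types of pairs, finite partial isomorphisms, the extension property.

module TournamentProps {E : ℕ → ℕ → Bool} (tour : IsTournament E) where
  open IsTournament tour public

  arc≢ : ∀ {x y} → E x y ≡ true → x ≢ y
  arc≢ {x} e refl = t≢f e (irrefl x)

  flip : ∀ {x y} → x ≢ y → E y x ≡ not (E x y)
  flip {x} {y} n with total x y n
  ... | inj₁ e = trans (asym x y e) (sym (cong not e))
  ... | inj₂ e = trans e (sym (cong not (asym y x e)))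

  flip' : ∀ {x y b} → x ≢ y → E x y ≡ b → E y x ≡ not b
  flip' n e = trans (flip n) (cong not e)

  farc : ∀ {x y} → x ≢ y → E x y ≡ false → E y x ≡ true
  farc n e = flip' n e

  eqT : ∀ {x y} → E x y ≡ false → E y x ≡ false → x ≡ y
  eqT {x} {y} p q with x ≟ y
  ... | yes e = e
  ... | no n = ⊥-elim (t≢f (farc n p) q)

  -- Two Booleans record the type of a pair: distinct points of a tournament carry an arc, so the
  -- absence of both arcs means equality. Hence `SE` also transfers equality and inequality.
  SE : ℕ → ℕ → ℕ → ℕ → Set
  SE a b a' b' = (E a b ≡ E a' b') × (E b a ≡ E b' a')

  se : ∀ {a b a' b'} → a ≢ b → a' ≢ b' → E a b ≡ E a' b' → SE a b a' b'
  se n n' e = e , trans (flip' n e) (sym (flip n'))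

  sw-se : ∀ {a b a' b'} → SE a b a' b' → SE b a b' a'
  sw-se (p , q) = q , p

  sym-se : ∀ {a b a' b'} → SE a b a' b' → SE a' b' a b
  sym-se (p , q) = sym p , sym q

  rf-se : ∀ {a b} → SE a a b b
  rf-se {a} {b} = trans (irrefl a) (sym (irrefl b)) , trans (irrefl a) (sym (irrefl b))

  se-≡ : ∀ {a b a' b'} → SE a b a' b' → a ≡ b → a' ≡ b'
  se-≡ {a} (p , q) refl = eqT (trans (sym p) (irrefl a)) (trans (sym q) (irrefl a))

  se-≢ : ∀ {a b a' b'} → SE a b a' b' → a ≢ b → a' ≢ b'
  se-≢ s n e = n (se-≡ (sym-se s) e)

  SEp : ℕ × ℕ → ℕ × ℕ → Set
  SEp (a , a') (b , b') = SE a b a' b'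

  -- Homogeneity is stated for injective enumerations, whereas constructions produce lists of pairs
  -- with repetitions. This is the finite partial isomorphism listed by `ps`, freed of repetitions.
  record Tuple (ps : List (ℕ × ℕ)) : Set where
    field
      n : ℕ
      a b : Fin n → ℕ
      ia : Inj a
      ib : Inj b
      same : ∀ i j → E (a i) (a j) ≡ E (b i) (b j)
      cover : ∀ p → p ∈ ps → Σ (Fin n) λ i → (a i ≡ proj₁ p) × (b i ≡ proj₂ p)

  private
    dedupe : ∀ ps → AllPairs SEp ps → Σ (List (ℕ × ℕ)) λ qs →
      AllPairs (λ p q → proj₁ p ≢ proj₁ q) qs × AllPairs SEp qs × (∀ p → p ∈ ps → p ∈ qs) × (∀ p → p ∈ qs → p ∈ ps)
    dedupe [] _ = [] , [] , [] , (λ p m → m) , (λ p m → m)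
    dedupe ((x , y) ∷ ps) (a ∷ ap) with dedupe ps ap
    ... | qs , u , s , f , g = go
      where
      search : ∀ rs → (Σ ℕ λ z → (x , z) ∈ rs) ⊎ All (λ q → x ≢ proj₁ q) rs
      search [] = inj₂ []
      search ((c , d) ∷ rs) with x ≟ c
      ... | yes refl = inj₁ (d , here refl)
      ... | no ne with search rs
      ... | inj₁ (z , m) = inj₁ (z , there m)
      ... | inj₂ al = inj₂ (ne ∷ al)
      go : _
      go with search qs
      ... | inj₁ (z , m) = qs , u , s , f' , λ p h → there (g p h)
        where
        yz : y ≡ z
        yz = se-≡ (All.lookup a (g _ m)) refl
        f' : ∀ p → p ∈ (x , y) ∷ ps → p ∈ qs
        f' p (here refl) = subst (λ w → (x , w) ∈ qs) (sym yz) m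
        f' p (there h) = f p h
      ... | inj₂ al = (x , y) ∷ qs , al ∷ u , All.tabulate (λ {q} m → All.lookup a (g q m)) ∷ s , f' , g'
        where
        f' : ∀ p → p ∈ (x , y) ∷ ps → p ∈ (x , y) ∷ qs
        f' p (here e) = here e
        f' p (there h) = there (f p h)
        g' : ∀ p → p ∈ (x , y) ∷ qs → p ∈ (x , y) ∷ ps
        g' p (here e) = here e
        g' p (there h) = there (g p h)

  opaque
    tuple : ∀ ps → AllPairs SEp ps → Tuple ps
    tuple ps ap with dedupe ps ap
    ... | qs , u , s , f , g = record
      { n = length qs ; a = a ; b = b ; ia = ia ; ib = ib ; same = λ i j → proj₁ (ss i j)
      ; cover = λ p m → index (f p m) , cong proj₁ (sym (lookup-index (f p m))) , cong proj₂ (sym (lookup-index (f p m))) }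
      where
      a b : Fin (length qs) → ℕ
      a i = proj₁ (lookup qs i)
      b i = proj₂ (lookup qs i)
      ia : Inj a
      ia {i} {j} e with i ≟F j
      ... | yes q = q
      ... | no n with allpairs-lookup qs u i j n
      ... | inj₁ r = ⊥-elim (r e)
      ... | inj₂ r = ⊥-elim (r (sym e))
      ss : ∀ i j → SE (a i) (a j) (b i) (b j)
      ss i j with i ≟F j
      ... | yes refl = rf-se
      ... | no n with allpairs-lookup qs s i j n
      ... | inj₁ r = r
      ... | inj₂ r = sw-se r
      ib : Inj b
      ib {i} {j} e = ia (se-≡ (sym-se (ss i j)) e)

Extension : (ℕ → ℕ → Bool) → Set
Extension E = (L : List ℕ) (p : ℕ → Bool) → Σ ℕ λ z → ∀ x → x ∈ L → (z ≢ x) × (E z x ≡ p x)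

-- A finite condition on a new point: to keep off the listed points and to have the prescribed arcs
-- to them. Values of the function off the list are never compared.
Cond : Set
Cond = List ℕ × (ℕ → Bool)

module Extending {E : ℕ → ℕ → Bool} (tour : IsTournament E)
  (ext : Extension E) where
  open TournamentProps tour

  look : List (ℕ × Bool) → ℕ → Bool
  -- Points that are only to be avoided get an arbitrary direction.
  look [] x = true
  look ((y , b) ∷ cs) x with x ≟ y
  ... | yes _ = b
  ... | no _ = look cs x

  Agree : ℕ × Bool → ℕ × Bool → Set
  Agree c d = proj₁ c ≡ proj₁ d → proj₂ c ≡ proj₂ d

  look-spec : ∀ cs → AllPairs Agree cs → ∀ c → c ∈ cs → look cs (proj₁ c) ≡ proj₂ c
  look-spec ((y , b) ∷ cs) (a ∷ ap) c m with proj₁ c ≟ y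
  look-spec ((y , b) ∷ cs) (a ∷ ap) c (here refl) | yes e = refl
  look-spec ((y , b) ∷ cs) (a ∷ ap) c (there m) | yes e = All.lookup a m (sym e)
  look-spec ((y , b) ∷ cs) (a ∷ ap) c (here refl) | no n = ⊥-elim (n refl)
  look-spec ((y , b) ∷ cs) (a ∷ ap) c (there m) | no n = look-spec cs ap c m

  Hits : ℕ → ℕ × Bool → Set
  Hits z c = (z ≢ proj₁ c) × (E z (proj₁ c) ≡ proj₂ c)

  opaque
    extL : (cs : List (ℕ × Bool)) → AllPairs Agree cs → (av : List ℕ) →
      Σ ℕ λ z → All (Hits z) cs × (∀ x → x ∈ av → z ≢ x)
    extL cs ap av with ext (map proj₁ cs ++ av) (look cs)
    ... | z , h = z , All.tabulate (λ {c} m → let q = h (proj₁ c) (∈-++⁺ˡ (∈-map⁺ proj₁ m)) in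
          proj₁ q , trans (proj₂ q) (look-spec cs ap c m)) ,
          λ x m → proj₁ (h x (∈-++⁺ʳ (map proj₁ cs) m))

  ag : ∀ {x y : ℕ} {b c : Bool} → x ≢ y → x ≡ y → b ≡ c
  ag n e = ⊥-elim (n e)


-- Clones of operations over a tournament with the extension property.

record OpClone : Set₁ where
  field
    em : ExcludedMiddle 0ℓ
    E : ℕ → ℕ → Bool
    tour : IsTournament E
    ext : Extension E
    C : ∀ {k} → Op k → Set
    Cext : ∀ {k} {f : Op k} → C f → ∀ {x y} → x ≗' y → f x ≡ f y
    Cproj : ∀ {k} (j : Fin k) → C (λ v → v j)
    Ccomp : ∀ {n k} {f : Op n} {g : Fin n → Op k} → C f → (∀ j → C (g j)) → C (λ v → f (λ j → g j v))
    hom : ∀ {n} (a b : Fin n → ℕ) → Inj a → Inj b → (∀ i j → E (a i) (a j) ≡ E (b i) (b j)) →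
      Σ (ℕ → ℕ) λ u → C {1} (λ v → u (v zero)) × (∀ i → u (a i) ≡ b i)
    strict : ∀ {k} {f : Op k} → C f → ∀ {x y} → x # y → f x ≢ f y

PreservesArcs : OpClone → Set
PreservesArcs cl = ∀ {k} {f : Op k} → OpClone.C cl f → ∀ {x y} → (∀ j → OpClone.E cl (x j) (y j) ≡ true) → OpClone.E cl (f x) (f y) ≡ true

module OpCloneProps (cl : OpClone) where
  open OpClone cl public
  open TournamentProps tour public
  open Extending tour ext public

  -- Curried forms of membership. They are records so that the operation can be recovered from the
  -- type of a membership proof.
  record C1 (u : ℕ → ℕ) : Set where
    constructor mk1
    field un1 : C {1} (λ v → u (v zero))
  open C1 public

  record C2 (h : ℕ → ℕ → ℕ) : Set where
    constructor mk2
    field un2 : C {2} (λ v → h (v zero) (v (suc zero)))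
  open C2 public

  record C3 (h : ℕ → ℕ → ℕ → ℕ) : Set where
    constructor mk3
    field un3 : C {3} (λ v → h (v zero) (v (suc zero)) (v (suc (suc zero))))
  open C3 public

  c1 : ∀ {k u} {f : Op k} → C1 u → C f → C (λ v → u (f v))
  c1 {f = f} (mk1 cu) cf = Ccomp {g = λ _ → f} cu (λ _ → cf)

  c2 : ∀ {k h} {f g : Op k} → C2 h → C f → C g → C (λ v → h (f v) (g v))
  c2 {f = f} {g} (mk2 ch) cf cg = Ccomp {g = two f g} ch (λ { zero → cf ; (suc zero) → cg })

  c3 : ∀ {k h} {f g e : Op k} → C3 h → C f → C g → C e → C (λ v → h (f v) (g v) (e v))
  c3 {f = f} {g} {e} (mk3 ch) cf cg ce = Ccomp {g = three f g e} ch (λ { zero → cf ; (suc zero) → cg ; (suc (suc zero)) → ce })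

  π1 : C2 (λ x y → x)
  π1 = mk2 (Cproj zero)

  π2 : C2 (λ x y → y)
  π2 = mk2 (Cproj (suc zero))

  c12 : ∀ {u h} → C1 u → C2 h → C2 (λ x y → u (h x y))
  c12 cu (mk2 ch) = mk2 (c1 cu ch)

  c22 : ∀ {h f g} → C2 h → C2 f → C2 g → C2 (λ x y → h (f x y) (g x y))
  c22 ch (mk2 cf) (mk2 cg) = mk2 (c2 ch cf cg)

  c32 : ∀ {h f g e} → C3 h → C2 f → C2 g → C2 e → C2 (λ x y → h (f x y) (g x y) (e x y))
  c32 ch (mk2 cf) (mk2 cg) (mk2 ce) = mk2 (c3 ch cf cg ce)

  c23 : ∀ {h f g} → C2 h → C3 f → C3 g → C3 (λ x y z → h (f x y z) (g x y z))
  c23 ch (mk3 cf) (mk3 cg) = mk3 (c2 ch cf cg)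

  c33 : ∀ {h f g e} → C3 h → C3 f → C3 g → C3 e → C3 (λ x y z → h (f x y z) (g x y z) (e x y z))
  c33 ch (mk3 cf) (mk3 cg) (mk3 ce) = mk3 (c3 ch cf cg ce)

  p1 : C3 (λ x y z → x)
  p1 = mk3 (Cproj zero)

  p2 : C3 (λ x y z → y)
  p2 = mk3 (Cproj (suc zero))

  p3 : C3 (λ x y z → z)
  p3 = mk3 (Cproj (suc (suc zero)))

  swap2 : ∀ {h} → C2 h → C2 (λ x y → h y x)
  swap2 ch = c22 ch π2 π1

  pre2 : ∀ {h u v} → C2 h → C1 u → C1 v → C2 (λ x y → h (u x) (v y))
  pre2 ch cu cv = c22 ch (c12 cu π1) (c12 cv π2)

  strict2 : ∀ {h} → C2 h → ∀ {x y x' y'} → x ≢ y → x' ≢ y' → h x x' ≢ h y y'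
  strict2 {h} (mk2 ch) {x} {y} {x'} {y'} n n' = strict ch {two x x'} {two y y'} (λ { zero → n ; (suc zero) → n' })

  inj1 : ∀ {u} → C1 u → ∀ {x y} → x ≢ y → u x ≢ u y
  inj1 (mk1 cu) {x} {y} n = strict cu {λ _ → x} {λ _ → y} (λ _ → n)

  opaque
    homL : (ps : List (ℕ × ℕ)) → AllPairs SEp ps →
      Σ (ℕ → ℕ) λ u → C1 u × All (λ p → u (proj₁ p) ≡ proj₂ p) ps
    homL ps ap with tuple ps ap
    ... | t with hom (Tuple.a t) (Tuple.b t) (Tuple.ia t) (Tuple.ib t) (Tuple.same t)
    ... | u , cu , h = u , mk1 cu , All.tabulate (λ {p} m → let (i , q , r) = Tuple.cover t p m in
          trans (cong u (sym q)) (trans (h i) r))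

-- Countable tournaments in the universal one

advance : ℕ × ℕ → ℕ × ℕ
advance (zero , y) = suc y , zero
advance (suc x , y) = x , suc y

pairs : ℕ → ℕ × ℕ
pairs zero = zero , zero
pairs (suc n) = advance (pairs n)

private
  -- The enumeration walks along antidiagonals: `(x , suc y)` comes after `(suc x , y)`, and
  -- `(suc x , 0)` after the end `(0 , x)` of the previous antidiagonal. Hence the recursion on the
  -- sum and then on `y`.
  pairs-onto : ∀ s y x → x + y ≡ s → Σ ℕ λ n → pairs n ≡ (x , y)
  pairs-onto zero zero zero e = 0 , refl
  pairs-onto (suc s) zero (suc x) e with pairs-onto s x zero (trans (sym (+-identityʳ x)) (cong Data.Nat.pred e))
  ... | n , q = suc n , cong advance q
  pairs-onto s (suc y) x e with pairs-onto s y (suc x) (trans (sym (+-suc x y)) e)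
  ... | n , q = suc n , cong advance q

code : ℕ × ℕ → ℕ
code (x , y) = proj₁ (pairs-onto (x + y) y x refl)

pairs-code : ∀ p → pairs (code p) ≡ p
pairs-code (x , y) = proj₂ (pairs-onto (x + y) y x refl)

upd : ∀ {A : Set} → (ℕ → A) → ℕ → A → ℕ → A
upd f n a i with i ≟ n
... | yes _ = a
... | no _ = f i

upd-at : ∀ {A : Set} (f : ℕ → A) n a → upd f n a n ≡ a
upd-at f n a with n ≟ n
... | yes _ = refl
... | no k = ⊥-elim (k refl)

upd-below : ∀ {A : Set} (f : ℕ → A) n a {i} → i < n → upd f n a i ≡ f i
upd-below f n a {i} l with i ≟ n
... | yes refl = ⊥-elim (<-irrefl refl l)
... | no k = refl

-- Dependent choice of a sequence. `Inv n f` is meant to constrain `f` below `n`; nothing is claimed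
-- of the limit itself except that below every `n` it coincides with a function satisfying the
-- invariant.
module Choose {A : Set} (Inv : ℕ → (ℕ → A) → Set) (f₀ : ℕ → A) (i₀ : Inv 0 f₀)
  (step : ∀ n f → Inv n f → Σ A λ a → Inv (suc n) (upd f n a)) where

  private
    build : ∀ n → Σ (ℕ → A) (Inv n)
    build zero = f₀ , i₀
    build (suc n) = upd (proj₁ (build n)) n (proj₁ s) , proj₂ s
      where s = step n (proj₁ (build n)) (proj₂ (build n))

  limit : ℕ → A
  limit n = proj₁ (build (suc n)) n

  private
    agree : ∀ n i → i < n → proj₁ (build n) i ≡ limit i
    agree (suc n) i l with m≤n⇒m<n∨m≡n (m<1+n⇒m≤n l)
    ... | inj₁ k = trans (upd-below (proj₁ (build n)) n _ k) (agree n i k)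
    ... | inj₂ refl = refl

  limit-inv : ∀ n → Σ (ℕ → A) λ f → Inv n f × (∀ i → i < n → f i ≡ limit i)
  limit-inv n = proj₁ (build n) , proj₂ (build n) , agree n

-- A tournament whose points may be listed several times: having no arc either way is the equality
-- of points, and `pcong` makes it a congruence.
record PreTournament {J : Set} (M : J → J → Bool) : Set where
  field
    pirr : ∀ i → M i i ≡ false
    pasym : ∀ i j → M i j ≡ true → M j i ≡ false
    pcong : ∀ i j k → M i j ≡ false → M j i ≡ false → (M i k ≡ M j k) × (M k i ≡ M k j)

module Dense (em : ExcludedMiddle 0ℓ) {E : ℕ → ℕ → Bool} (tour : IsTournament E)
  (ext : Extension E) where
  open TournamentProps tour
  open Extending tour ext

  decide : Set → Bool
  decide A with em {A}
  ... | yes _ = true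
  ... | no _ = false

  decide-yes : ∀ {A : Set} → A → decide A ≡ true
  decide-yes {A} a with em {A}
  ... | yes _ = refl
  ... | no n = ⊥-elim (n a)

  decide-no : ∀ {A : Set} → ¬ A → decide A ≡ false
  decide-no {A} n with em {A}
  ... | yes a = ⊥-elim (n a)
  ... | no _ = refl

  Meets : Cond → ℕ → Set
  Meets K z = ∀ x → x ∈ proj₁ K → (z ≢ x) × (E z x ≡ proj₂ K x)

  _⊒_ : Cond → Cond → Set
  K' ⊒ K = ∀ x → x ∈ proj₁ K → (x ∈ proj₁ K') × (proj₂ K' x ≡ proj₂ K x)

  ⊒-refl : ∀ {K} → K ⊒ K
  ⊒-refl x m = m , refl

  ⊒-trans : ∀ {K K' K''} → K'' ⊒ K' → K' ⊒ K → K'' ⊒ K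
  ⊒-trans a b x m = let (m' , e) = b x m ; (m'' , e') = a x m' in m'' , trans e' e

  sat-⊒ : ∀ {K K' z} → K' ⊒ K → Meets K' z → Meets K z
  sat-⊒ a s x m = let (m' , e) = a x m ; (n , q) = s x m' in n , trans q e

  Dense : (ℕ → Set) → Cond → Set
  Dense X K = ∀ K' → K' ⊒ K → Σ ℕ λ z → X z × Meets K' z

  dense-all : ∀ K → Dense (λ _ → ⊤) K
  dense-all K K' _ = let (z , h) = ext (proj₁ K') (proj₂ K') in z , tt , h

  dense-⊒ : ∀ {X K K'} → K' ⊒ K → Dense X K → Dense X K'
  dense-⊒ a d K'' b = d K'' (⊒-trans {K'' = K''} b a)

  opaque
    -- If below some extension of `K` no point of `X` has colour true, then colour false is dense
    -- there; otherwise colour true is dense below `K` itself. Iteration makes finitely many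
    -- properties of a generic point constant.
    dense-split : ∀ {X K} → Dense X K → (χ : ℕ → Bool) → Σ Cond λ K' → (K' ⊒ K) × Σ Bool λ b → Dense (λ z → X z × (χ z ≡ b)) K'
    dense-split {X} {K} d χ with em {Σ Cond λ K' → (K' ⊒ K) × (∀ z → X z → Meets K' z → χ z ≢ true)}
    ... | yes (K' , le , h) = K' , le , false , λ K'' le' → let (z , xz , s) = d K'' (⊒-trans {K'' = K''} le' le) in
            z , (xz , ¬t→f (h z xz (sat-⊒ {z = z} le' s))) , s
    ... | no n = K , ⊒-refl {K} , true , λ K' le → go K' le
      where
      go : ∀ K' → K' ⊒ K → Σ ℕ λ z → (X z × (χ z ≡ true)) × Meets K' z
      go K' le with em {Σ ℕ λ z → (X z × (χ z ≡ true)) × Meets K' z}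
      ... | yes r = r
      ... | no nr = ⊥-elim (n (K' , le , λ z xz s e → nr (z , (xz , e) , s)))

    addC : (K : Cond) (cs : List (ℕ × Bool)) → All (λ c → ¬ (proj₁ c ∈ proj₁ K)) cs → AllPairs Agree cs →
      Σ Cond λ K' → (K' ⊒ K) × (∀ z → Meets K' z → All (Hits z) cs)
    addC K cs al ap = (map proj₁ cs ++ proj₁ K , f) , (λ y m → ∈-++⁺ʳ (map proj₁ cs) m , old y m) ,
        λ z s → All.tabulate (λ {c} m → let (k , e) = s (proj₁ c) (∈-++⁺ˡ (∈-map⁺ proj₁ m)) in
          k , trans e (trans (new _ (All.lookup al m)) (look-spec cs ap c m)))
      where
      f : ℕ → Bool
      f y with em {y ∈ proj₁ K}
      ... | yes _ = proj₂ K y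
      ... | no _ = look cs y
      old : ∀ y → y ∈ proj₁ K → f y ≡ proj₂ K y
      old y m with em {y ∈ proj₁ K}
      ... | yes _ = refl
      ... | no n = ⊥-elim (n m)
      new : ∀ y → ¬ (y ∈ proj₁ K) → f y ≡ look cs y
      new y n with em {y ∈ proj₁ K}
      ... | yes m = ⊥-elim (n m)
      ... | no _ = refl

    dense-hit : ∀ {X K} → Dense X K → (cs : List (ℕ × Bool)) → All (λ c → ¬ (proj₁ c ∈ proj₁ K)) cs → AllPairs Agree cs →
      Σ ℕ λ z → X z × Meets K z × All (Hits z) cs
    dense-hit {X} {K} d cs al ap with addC K cs al ap
    ... | K' , le , h with d K' le
    ... | z , xz , s = z , xz , sat-⊒ {z = z} le s , h z s

    -- Points of the pre-tournament without an arc either way are identified by φ.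
    realize : (M : ℕ → ℕ → Bool) → PreTournament M → (p₀ : ℕ) → Σ (ℕ → ℕ) λ φ → (φ 0 ≡ p₀) × (∀ i j → E (φ i) (φ j) ≡ M i j)
    realize M pt p₀ = limit , first , λ i j → fin i j
      where
      open PreTournament pt
      Inv : ℕ → (ℕ → ℕ) → Set
      Inv n f = (∀ i j → i < n → j < n → E (f i) (f j) ≡ M i j) × (0 < n → f 0 ≡ p₀)
      extend-inv : ∀ n f a → (∀ i j → i < n → j < n → E (f i) (f j) ≡ M i j) → (∀ i → i < n → (E a (f i) ≡ M n i) × (E (f i) a ≡ M i n)) →
        ∀ i j → i < suc n → j < suc n → E (upd f n a i) (upd f n a j) ≡ M i j
      extend-inv n f a inv h i j li lj with m≤n⇒m<n∨m≡n (m<1+n⇒m≤n li) | m≤n⇒m<n∨m≡n (m<1+n⇒m≤n lj)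
      ... | inj₁ ki | inj₁ kj = trans (cong₂ E (upd-below f n a ki) (upd-below f n a kj)) (inv i j ki kj)
      ... | inj₁ ki | inj₂ refl = trans (cong₂ E (upd-below f n a ki) (upd-at f n a)) (proj₂ (h i ki))
      ... | inj₂ refl | inj₁ kj = trans (cong₂ E (upd-at f n a) (upd-below f n a kj)) (proj₁ (h j kj))
      ... | inj₂ refl | inj₂ refl = trans (cong₂ E (upd-at f n a) (upd-at f n a)) (trans (irrefl a) (sym (pirr i)))
      step : ∀ n f → Inv n f → Σ ℕ λ a → Inv (suc n) (upd f n a)
      step zero f _ = p₀ , (extend-inv zero f p₀ (λ _ _ ()) (λ _ ())) , λ _ → upd-at f 0 p₀
      step (suc n) f (inv , i0) with em {Σ ℕ λ i → (i < suc n) × (M (suc n) i ≡ false) × (M i (suc n) ≡ false)}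
      ... | yes (i , l , e , e') = f i , extend-inv (suc n) f (f i) inv (λ j lj → trans (inv i j l lj) (proj₁ (pcong i (suc n) j e' e)) ,
              trans (inv j i lj l) (proj₂ (pcong i (suc n) j e' e))) , λ _ → trans (upd-below f (suc n) (f i) (s≤s z≤n)) (i0 (s≤s z≤n))
      ... | no none with ext (map f (upTo (suc n))) p
        where
        p : ℕ → Bool
        p x = decide (Σ ℕ λ i → (i < suc n) × (f i ≡ x) × (M (suc n) i ≡ true))
      ... | z , h = z , extend-inv (suc n) f z inv hh , λ _ → trans (upd-below f (suc n) z (s≤s z≤n)) (i0 (s≤s z≤n))
        where
        -- Earlier indices with the same image have no arc between them, so by congruence they
        -- prescribe the same arc to the new point and `p` is well defined.
        same : ∀ i j → i < suc n → j < suc n → f i ≡ f j → M (suc n) i ≡ M (suc n) j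
        same i j li lj e = proj₂ (pcong i j (suc n) (trans (sym (inv i j li lj)) (trans (cong (E (f i)) (sym e)) (irrefl _))) (trans (sym (inv j i lj li)) (trans (cong (E (f j)) e) (irrefl _))))
        opp : ∀ a b → (a ≡ false → b ≡ false → ⊥) → (a ≡ true → b ≡ false) → (b ≡ true → a ≡ false) → b ≡ not a
        opp true true h k l = ⊥-elim (t≢f refl (k refl))
        opp true false h k l = refl
        opp false true h k l = refl
        opp false false h k l = ⊥-elim (h refl refl)
        hh : ∀ i → i < suc n → (E z (f i) ≡ M (suc n) i) × (E (f i) z ≡ M i (suc n))
        hh i l with h (f i) (∈-map⁺ f (∈-upTo⁺ l))
        ... | ne , e = e' , trans (flip' ne e') (sym (opp (M (suc n) i) (M i (suc n)) (λ a b → none (i , l , a , b)) (pasym (suc n) i) (pasym i (suc n))))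
          where
          e' : E z (f i) ≡ M (suc n) i
          e' with bool-em (M (suc n) i)
          ... | inj₁ t = trans e (trans (decide-yes (i , l , refl , t)) (sym t))
          ... | inj₂ q = trans e (trans (decide-no (λ (j , lj , fe , t) → t≢f t (trans (same j i lj l fe) q))) (sym q))
      open Choose Inv (λ _ → p₀) ((λ _ _ ()) , (λ ())) step
      first : limit 0 ≡ p₀
      first with limit-inv 1
      ... | f , (_ , i0) , ag' = trans (sym (ag' 0 (s≤s z≤n))) (i0 (s≤s z≤n))
      fin : ∀ i j → E (limit i) (limit j) ≡ M i j
      fin i j with limit-inv (suc (i ⊔ j))
      ... | f , (inv , _) , ag' = trans (cong₂ E (sym (ag' i (s≤s (m≤m⊔n i j)))) (sym (ag' j (s≤s (m≤n⊔m i j))))) (inv i j (s≤s (m≤m⊔n i j)) (s≤s (m≤n⊔m i j)))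

-- Operations that depend on two arguments

module Separation (cl : OpClone) where
  open OpCloneProps cl

  record Essential : Set where
    field
      h : ℕ → ℕ → ℕ
      ch : C2 h
      a b c : ℕ
      d1 : h a c ≢ h b c
      a' c' d' : ℕ
      d2 : h a' c' ≢ h a' d'

  -- A dependence of h on its first argument spreads, through the collapses it
  -- forces, until every row h z is constant.
  private
   module Spread {h : ℕ → ℕ → ℕ} (ch : C2 h) {x y z x' p' q' : ℕ} (ne : x ≢ y) (pn : p' ≢ x') (pq : p' ≢ q')
    (coll : ∀ {a b z1 c s r} → SE a b x y → SE a z1 x z → SE b z1 y z →
       SE c s x' p' → SE c r x' q' → SE s r p' q' → h a c ≢ h b c → h z1 s ≡ h z1 r) where

    τ : Bool
    τ = E p' x'

    Cell : ℕ → ℕ → Set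
    Cell c s = (s ≢ c) × (E s c ≡ τ)

    cellSE : ∀ {c s} → Cell c s → SE c s x' p'
    cellSE (n , e) = sw-se (se n pn e)

    Row : ℕ → ℕ → Set
    Row z1 c = ∀ {s1 s2} → Cell c s1 → Cell c s2 → h z1 s1 ≡ h z1 s2

    -- Two points of the cell are compared with a common `r` that lies to `c` and to both of them as
    -- `q'` lies to `x'` and `p'`. If `q'` is `x'`, then `c` itself plays this role.
    row : ∀ {a b z1 c} → SE a b x y → SE a z1 x z → SE b z1 y z → h a c ≢ h b c → Row z1 c
    row {a} {b} {z1} {c} s1 s2 s3 d {u} {v} cu cv with q' ≟ x'
    ... | yes refl = trans (k u cu) (sym (k v cv))
      where
      k : ∀ w → Cell c w → h z1 w ≡ h z1 c
      k w cw = coll s1 s2 s3 (cellSE cw) rf-se (sw-se (cellSE cw)) d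
    ... | no qn with extL ((c , E q' x') ∷ (u , E q' p') ∷ (v , E q' p') ∷ [])
                   ((ag (λ e → proj₁ cu (sym e)) ∷ ag (λ e → proj₁ cv (sym e)) ∷ []) ∷ ((λ _ → refl) ∷ []) ∷ [] ∷ []) []
    ... | r , (rc , ec) ∷ (ru , eu) ∷ (rv , ev) ∷ [] , _ =
      trans (k u cu ru eu) (sym (k v cv rv ev))
      where
      k : ∀ w → Cell c w → r ≢ w → E r w ≡ E q' p' → h z1 w ≡ h z1 r
      k w cw rw ew = coll s1 s2 s3 (cellSE cw) (sw-se (se rc qn ec)) (sw-se (se rw (λ e → pq (sym e)) ew)) d

    other : ∀ c q → Σ ℕ λ q2 → Cell c q2 × (q2 ≢ q)
    other c q with extL ((c , τ) ∷ []) ([] ∷ []) (q ∷ [])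
    ... | q2 , hit ∷ [] , av = q2 , hit , av q (here refl)

    -- Constancy produces a new dependence on the first argument: `h z1 q` can be evaluated at
    -- another point of the cell, and there strictness separates it from `h b1 q`.
    event : ∀ {z1 c q b1} → Row z1 c → Cell c q → z1 ≢ b1 → h z1 q ≢ h b1 q
    event {z1} {c} {q} rw cq n e with other c q
    ... | q2 , cq2 , n2 = strict2 ch n n2 (trans (rw cq2 cq) e)

    Leads : ℕ → ℕ → Set
    Leads z1 z2 = Σ ℕ λ b1 → (z1 ≢ b1) ×
      ((SE z1 b1 x y × SE z1 z2 x z × SE b1 z2 y z) ⊎ (SE b1 z1 x y × SE b1 z2 x z × SE z1 z2 y z))

    next : ∀ {z1 z2 c q} → Row z1 c → Cell c q → Leads z1 z2 → Row z2 q
    next rw cq (b1 , n , inj₁ (s1 , s2 , s3)) = row s1 s2 s3 (event rw cq n)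
    next rw cq (b1 , n , inj₂ (s1 , s2 , s3)) = row s1 s2 s3 (λ e → event rw cq n (sym e))

    -- In the general case `w` lies to `z1`, and `z2` to `w`, as `z` lies to `x`. When `z` is `x` or
    -- `y`, the third point of a copy coincides with one of the first two, which needs a separate
    -- choice of `w`.
    connect : ∀ z1 z2 → z1 ≢ z2 → Σ ℕ λ w → Leads z1 w × Leads w z2
    connect z1 z2 n with z ≟ x
    ... | yes refl with extL ((z1 , E x y) ∷ (z2 , E y x) ∷ []) ((ag n ∷ []) ∷ [] ∷ []) []
    ... | w , (n1 , e1) ∷ (n2 , e2) ∷ [] , _ =
      w , (w , (λ e → n1 (sym e)) , inj₂ (se n1 ne e1 , rf-se , sw-se (se n1 ne e1)))
        , (z2 , n2 , inj₂ (sw-se k , rf-se , k))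
      where k : SE w z2 y x
            k = se n2 (λ e → ne (sym e)) e2
    connect z1 z2 n | no _ with z ≟ y
    ... | yes refl with extL ((z1 , E y x) ∷ (z2 , E x y) ∷ []) ((ag n ∷ []) ∷ [] ∷ []) []
    ... | w , (n1 , e1) ∷ (n2 , e2) ∷ [] , _ =
      w , (w , (λ e → n1 (sym e)) , inj₁ (sw-se k , sw-se k , rf-se))
        , (z2 , n2 , inj₁ (se n2 ne e2 , se n2 ne e2 , rf-se))
      where k : SE w z1 y x
            k = se n1 (λ e → ne (sym e)) e1
    connect z1 z2 n | no zx | no zy with extL ((z1 , E z x) ∷ (z2 , E x z) ∷ []) ((ag n ∷ []) ∷ [] ∷ []) []
    ... | w , (n1 , e1) ∷ (n2 , e2) ∷ [] , _ = w , half (λ e → n1 (sym e)) (sw-se (se n1 zx e1)) , half n2 (se n2 (λ e → zx (sym e)) e2)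
      where
      half : ∀ {u v} → u ≢ v → SE u v x z → Leads u v
      half {u} {v} n s with extL ((u , E y x) ∷ (v , E y z) ∷ []) ((ag n ∷ []) ∷ [] ∷ []) []
      ... | b , (nu , eu) ∷ (nv , ev) ∷ [] , _ =
        b , (λ e → nu (sym e)) , inj₁ (sw-se (se nu (λ e → ne (sym e)) eu) , s , se nv (λ e → zy (sym e)) ev)

    constant' : ∀ {z1 c} → Row z1 c → ∀ z2 → z1 ≢ z2 → ∀ s1 s2 → h z2 s1 ≡ h z2 s2
    constant' {z1} {c} rw z2 n s1 s2 with connect z1 z2 n
    -- Each lead also moves the column into the cell of the previous one: from `c` to `q` to `q2`.
    -- The last column is chosen so that `s1` and `s2` both lie in its cell.
    ... | w , l1 , l2 with extL ((s1 , not τ) ∷ (s2 , not τ) ∷ []) (((λ _ → refl) ∷ []) ∷ [] ∷ []) (c ∷ [])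
    ... | q2 , (m1 , f1) ∷ (m2 , f2) ∷ [] , av with extL ((c , τ) ∷ (q2 , not τ) ∷ [])
            ((ag (λ e → av c (here refl) (sym e)) ∷ []) ∷ [] ∷ []) []
    ... | q , cq ∷ (nq , q≡) ∷ [] , _ = next (next rw cq l1) (back nq q≡) l2 (back m1 f1) (back m2 f2)
      where
      back : ∀ {a b} → a ≢ b → E a b ≡ not τ → Cell a b
      back m f = (λ e → m (sym e)) , trans (flip' m f) (not-involutive τ)

    constant : ∀ {z1 c} → Row z1 c → ∀ z2 s1 s2 → h z2 s1 ≡ h z2 s2
    constant {z1} {c} rw z2 s1 s2 with z1 ≟ z2
    ... | no n = constant' rw z2 n s1 s2
    ... | yes refl with extL ((z1 , true) ∷ []) ([] ∷ []) []
    ... | w , (n , _) ∷ [] , _ = constant' {w} {c} (λ {u} {v} _ _ → constant' rw w (λ e → n (sym e)) u v) z1 n s1 s2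

    third : ∀ {a b} → SE a b x y → Σ ℕ λ z1 → SE a z1 x z × SE b z1 y z
    third {a} {b} s with z ≟ x
    ... | yes refl = a , rf-se , sw-se s
    ... | no zx with z ≟ y
    ... | yes refl = b , s , rf-se
    ... | no zy with extL ((a , E z x) ∷ (b , E z y) ∷ []) ((ag (se-≢ (sym-se s) ne) ∷ []) ∷ [] ∷ []) []
    ... | w , (n1 , e1) ∷ (n2 , e2) ∷ [] , _ = w , sw-se (se n1 zx e1) , sw-se (se n2 zy e2)

    start : ∀ {a b c} → h a c ≢ h b c → Σ ℕ λ z1 → Row z1 c
    start {a} {b} {c} d with a ≟ b
    ... | yes refl = ⊥-elim (d refl)
    ... | no n with bool-em (E a b xor E x y)
    ... | inj₂ e = let s = se n ne (xf e) ; (z1 , t1 , t2) = third s in z1 , row s t1 t2 d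
      where xf : ∀ {a b} → (a xor b) ≡ false → a ≡ b
            xf {true} {true} _ = refl
            xf {false} {false} _ = refl
    ... | inj₁ e = let s = se (λ q → n (sym q)) ne (trans (flip n) (xt e)) ; (z1 , t1 , t2) = third s in
        z1 , row s t1 t2 (λ q → d (sym q))
      where xt : ∀ {a b} → (a xor b) ≡ true → not a ≡ b
            xt {true} {false} _ = refl
            xt {false} {true} _ = refl

  private
    sep' : Essential → ∀ {x y z x' p' q'} → x ≢ y → p' ≢ x' → p' ≢ q' →
      Σ (ℕ → ℕ → ℕ) λ h → C2 h × (h x x' ≢ h y x') × (h z p' ≢ h z q')
    sep' ess {x} {y} {z} {x'} {p'} {q'} ne pn pq with em {Σ (ℕ → ℕ → ℕ) λ h → C2 h × (h x x' ≢ h y x') × (h z p' ≢ h z q')}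
    ... | yes r = r
    ... | no nr = ⊥-elim (d2 (constant (proj₂ (start d1)) a' c' d'))
      where
      open Essential ess
      coll : ∀ {a b z1 c s r} → SE a b x y → SE a z1 x z → SE b z1 y z →
       SE c s x' p' → SE c r x' q' → SE s r p' q' → h a c ≢ h b c → h z1 s ≡ h z1 r
      coll {a} {b} {z1} {c} {s} {r} s1 s2 s3 s4 s5 s6 d with h z1 s ≟ h z1 r
      ... | yes e = e
      ... | no n with homL ((x , a) ∷ (y , b) ∷ (z , z1) ∷ []) ((sym-se s1 ∷ sym-se s2 ∷ []) ∷ (sym-se s3 ∷ []) ∷ [] ∷ [])
                    | homL ((x' , c) ∷ (p' , s) ∷ (q' , r) ∷ []) ((sym-se s4 ∷ sym-se s5 ∷ []) ∷ (sym-se s6 ∷ []) ∷ [] ∷ [])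
      ... | u , cu , ux ∷ uy ∷ uz ∷ [] | v , cv , vx ∷ vp ∷ vq ∷ [] = ⊥-elim (nr (_ , pre2 ch cu cv ,
          (λ e → d (subst₂ _≡_ (cong₂ h ux vx) (cong₂ h uy vx) e)) ,
          (λ e → n (subst₂ _≡_ (cong₂ h uz vp) (cong₂ h uz vq) e))))
      open Spread ch ne pn pq coll

  opaque
    -- If no operation did both, then in every copy of the configuration a separation of the first
    -- pair would collapse the second, and by `Spread` all rows of the essential operation would be
    -- constant. The case where `p'` is `x'` is reduced to the other by exchanging `p'` and `q'`.
    sep : Essential → ∀ {x y z x' p' q'} → x ≢ y → p' ≢ q' →
        Σ (ℕ → ℕ → ℕ) λ h → C2 h × (h x x' ≢ h y x') × (h z p' ≢ h z q')
    sep ess {x} {y} {z} {x'} {p'} {q'} ne pq with p' ≟ x'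
    ... | no pn = sep' ess ne pn pq
    ... | yes refl with sep' ess {x} {y} {z} {p'} {q'} {p'} ne (λ e → pq (sym e)) (λ e → pq (sym e))
    ... | h , ch , d1 , d2 = h , ch , d1 , (λ e → d2 (sym e))

  Splits : ∀ {J : Set} → (J → ℕ) → J × J → Set
  Splits u (i , j) = u i ≢ u j

  module _ (ess : Essential) {J : Set} (u v : J → ℕ) where

    private
      Spl : (ℕ → ℕ → ℕ) → J × J → Set
      Spl h = Splits (λ i → h (u i) (v i))

      -- The new operation is some `g` applied to `h` and `k`. At `Q` only `h` separates and at `P`
      -- only `k`, which are the two demands met by `sep`; on the other pairs both separate and
      -- strictness suffices.
      join : ∀ {h} → C2 h → ∀ P (k₀ : ℕ → ℕ → ℕ) → C2 k₀ → Spl k₀ P → ¬ Spl h P → ∀ ps → All (Spl h) ps →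
        Σ (ℕ → ℕ → ℕ) λ k → C2 k × Spl k P × All (Spl k) ps
      join ch P k₀ ck s ns [] [] = k₀ , ck , s , []
      join {h} ch (p , p') k₀ ck s ns (Q@(q , q') ∷ ps) (a ∷ al) with join ch (p , p') k₀ ck s ns ps al
      ... | k , ck' , sk , ak with k (u q) (v q) ≟ k (u q') (v q')
      ... | no n = k , ck' , sk , n ∷ ak
      ... | yes e with h (u p) (v p) ≟ h (u p') (v p')
      ... | no n = ⊥-elim (ns n)
      ... | yes e' with sep ess {h (u q) (v q)} {h (u q') (v q')} {h (u p) (v p)} {k (u q) (v q)} {k (u p) (v p)} {k (u p') (v p')} a sk
      ... | g , cg , g1 , g2 = _ , c22 cg ch ck' ,
          (λ r → g2 (trans r (cong (λ w → g w (k (u p') (v p'))) (sym e')))) ,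
          (λ r → g1 (trans r (cong (g (h (u q') (v q'))) (sym e)))) ∷
          All.tabulate (λ {i} m → strict2 cg (All.lookup al m) (All.lookup ak m))

    opaque
      separate : ∀ ps → All (λ p → Splits u p ⊎ Splits v p) ps → Σ (ℕ → ℕ → ℕ) λ h → C2 h × All (Spl h) ps
      separate [] [] = _ , π1 , []
      separate (P@(p , p') ∷ ps) (a ∷ al) with separate ps al
      ... | h , ch , ah with h (u p) (v p) ≟ h (u p') (v p')
      ... | no n = h , ch , n ∷ ah
      ... | yes e with a
      ... | inj₁ s = let (k , ck , x , y) = join ch P _ π1 s (λ n → n e) ps ah in k , ck , x ∷ y
      ... | inj₂ s = let (k , ck , x , y) = join ch P _ π2 s (λ n → n e) ps ah in k , ck , x ∷ y

module Injections (cl : OpClone) where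
  open OpCloneProps cl
  open Separation cl

  InjOn : ∀ {J : Set} → List J → (J → ℕ) → Set
  InjOn W u = ∀ {i j} → i ∈ W → j ∈ W → i ≢ j → u i ≢ u j

  JInj : ∀ {J : Set} → List J → (J → ℕ) → (J → ℕ) → Set
  JInj W u v = ∀ {i j} → i ∈ W → j ∈ W → i ≢ j → (u i ≢ u j) ⊎ (v i ≢ v j)

  dpairs : ∀ {J : Set} → List J → List (J × J)
  dpairs W = filter (λ p → em {proj₁ p ≢ proj₂ p}) (cartesianProduct W W)

  dp∈ : ∀ {J : Set} {W : List J} {i j} → i ∈ W → j ∈ W → i ≢ j → (i , j) ∈ dpairs W
  dp∈ i∈ j∈ n = ∈-filter⁺ (λ p → em {proj₁ p ≢ proj₂ p}) (∈-cartesianProduct⁺ i∈ j∈) n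

  ∈dp : ∀ {J : Set} (W : List J) {p} → p ∈ dpairs W → (proj₁ p ∈ W) × (proj₂ p ∈ W) × (proj₁ p ≢ proj₂ p)
  ∈dp W m with ∈-filter⁻ (λ p → em {proj₁ p ≢ proj₂ p}) {xs = cartesianProduct W W} m
  ... | m' , n with ∈-cartesianProduct⁻ W W m'
  ... | a , b = a , b , n

  dpAll : ∀ {J : Set} {P : J × J → Set} (W : List J) → (∀ {i j} → i ∈ W → j ∈ W → i ≢ j → P (i , j)) → All P (dpairs W)
  dpAll W f = All.tabulate (λ m → let (a , b , n) = ∈dp W m in f a b n)

  opaque
    inject : Essential → ∀ {J : Set} (W : List J) u v → JInj W u v →
      Σ (ℕ → ℕ → ℕ) λ h → C2 h × InjOn W (λ i → h (u i) (v i))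
    inject ess W u v jn with separate ess u v (dpairs W) (dpAll W jn)
    ... | h , ch , al = h , ch , λ a b n → All.lookup al (dp∈ a b n)

  opaque
    -- Tagging the indices by a Boolean merges the two demands into one list of pairs.
    inject² : Essential → ∀ {J : Set} (W : List J) u v u' v' → JInj W u v → JInj W u' v' →
      Σ (ℕ → ℕ → ℕ) λ h → C2 h × InjOn W (λ i → h (u i) (v i)) × InjOn W (λ i → h (u' i) (v' i))
    inject² ess {J} W u v u' v' jn jn' with separate ess {J × Bool} U V (map (tag true) (dpairs W) ++ map (tag false) (dpairs W))
          (All-++ (All-map (dpAll W jn)) (All-map (dpAll W jn')))
      where
      U V : J × Bool → ℕ
      U (i , true) = u i
      U (i , false) = u' i
      V (i , true) = v i
      V (i , false) = v' i
      tag : Bool → J × J → (J × Bool) × (J × Bool)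
      tag b (i , j) = (i , b) , (j , b)
    ... | h , ch , al with All-++⁻ (map _ (dpairs W)) al
    ... | a1 , a2 = h , ch , (λ a b n → All.lookup (All-map⁻ a1) (dp∈ a b n)) , (λ a b n → All.lookup (All-map⁻ a2) (dp∈ a b n))

-- Clones of arc-preserving operations

module ArcPreserving (cl : OpClone)
  (pres : PreservesArcs cl) where
  open OpCloneProps cl public
  open Separation cl public
  open Injections cl public

  pres2 : ∀ {h} → C2 h → ∀ {x y x' y'} → E x y ≡ true → E x' y' ≡ true → E (h x x') (h y y') ≡ true
  pres2 (mk2 ch) {x} {y} {x'} {y'} e e' = pres ch {two x x'} {two y y'} (λ { zero → e ; (suc zero) → e' })

  unan2 : ∀ {h} → C2 h → ∀ {x y x' y'} → x ≢ y → x' ≢ y' → E x' y' ≡ E x y → E (h x x') (h y y') ≡ E x y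
  unan2 ch {x} {y} n n' e with bool-em (E x y)
  ... | inj₁ t = trans (pres2 ch t (trans e t)) (sym t)
  ... | inj₂ f = trans (asym _ _ (pres2 ch (farc n f) (farc n' (trans e f)))) (sym f)

  emb : ∀ {u} → C1 u → ∀ x y → E (u x) (u y) ≡ E x y
  emb {u} (mk1 cu) x y with x ≟ y
  ... | yes refl = trans (irrefl _) (sym (irrefl _))
  ... | no n with total x y n
  ... | inj₁ t = trans (pres cu {λ _ → x} {λ _ → y} (λ _ → t)) (sym t)
  ... | inj₂ t = trans (asym _ _ (pres cu {λ _ → y} {λ _ → x} (λ _ → t))) (sym (asym _ _ t))

  -- The function h̃(x,y) = h(g₂ y, g₁ x) takes at the pair k, l the values of h in
  -- exchanged order, so one of h, h̃ orients this pair as u does.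
  opaque
    orient' : Essential → ∀ {J : Set} (W : List J) u v → JInj W u v → ∀ {k l} → k ∈ W → l ∈ W → u k ≢ u l → v k ≢ v l →
      Σ (ℕ → ℕ → ℕ) λ g → C2 g × InjOn W (λ i → g (u i) (v i)) × (E (g (u k) (v k)) (g (u l) (v l)) ≡ E (u k) (u l))
    orient' ess {J} W u v jn {k} {l} k∈ l∈ n nv with E (v k) (v l) ≟B E (u k) (u l)
    ... | yes e = let (h , ch , ih) = inject ess W u v jn in h , ch , ih , unan2 ch n nv e
    ... | no d with homL ((u k , v l) ∷ (u l , v k) ∷ []) ((s ∷ []) ∷ [] ∷ [])
              | homL ((v k , u l) ∷ (v l , u k) ∷ []) ((sw-se (sym-se s) ∷ []) ∷ [] ∷ [])
      where
      s : SE (u k) (u l) (v l) (v k)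
      s = se n (λ e → nv (sym e)) (sym (trans (flip nv) (trans (cong not (≢→not d)) (not-involutive _))))
    ... | g1 , c1' , a1 ∷ b1 ∷ [] | g2 , c2' , a2 ∷ b2 ∷ []
      with inject² ess W u v (λ i → g2 (v i)) (λ i → g1 (u i)) jn (λ a b m → jn' (jn a b m))
      where
      jn' : ∀ {i j} → (u i ≢ u j) ⊎ (v i ≢ v j) → (g2 (v i) ≢ g2 (v j)) ⊎ (g1 (u i) ≢ g1 (u j))
      jn' (inj₁ p) = inj₂ (inj1 c1' p)
      jn' (inj₂ p) = inj₁ (inj1 c2' p)
    ... | h , ch , i1 , i2 with E (h (u k) (v k)) (h (u l) (v l)) ≟B E (u k) (u l)
    ... | yes e = h , ch , i1 , e
    ... | no ne = _ , c22 ch (c12 c2' π2) (c12 c1' π1) , i2 ,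
        trans (cong₂ E (cong₂ h a2 a1) (cong₂ h b2 b1)) (trans (flip (i1 k∈ l∈ (λ e → n (cong u e)))) (trans (cong not (≢→not ne)) (not-involutive _)))

  opaque
    -- Replacing the second argument by an injective combination removes the case of equal second
    -- coordinates.
    orient : Essential → ∀ {J : Set} (W : List J) u v → JInj W u v → ∀ {k l} → k ∈ W → l ∈ W → u k ≢ u l →
      Σ (ℕ → ℕ → ℕ) λ g → C2 g × InjOn W (λ i → g (u i) (v i)) × (E (g (u k) (v k)) (g (u l) (v l)) ≡ E (u k) (u l))
    orient ess W u v jn k∈ l∈ n with inject ess W u v jn
    ... | h , ch , ih with orient' ess W u (λ i → h (u i) (v i)) (λ a b m → inj₂ (ih a b m)) k∈ l∈ n (ih k∈ l∈ (λ e → n (cong u e)))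
    ... | g , cg , ig , e = _ , c22 cg π1 ch , ig , e

  -- Lexicographic up to ties: nothing is said about the arcs between points with equal first
  -- coordinates.
  FD : ∀ {J : Set} → List J → (J → ℕ) → (J → ℕ) → (ℕ → ℕ → ℕ) → Set
  FD W u v q = InjOn W (λ i → q (u i) (v i)) ×
    (∀ {i j} → i ∈ W → j ∈ W → u i ≢ u j → E (q (u i) (v i)) (q (u j) (v j)) ≡ E (u i) (u j))

  FirstDominant : Set₁
  FirstDominant = ∀ {J : Set} (W : List J) u v → JInj W u v → Σ (ℕ → ℕ → ℕ) λ q → C2 q × FD W u v q

  -- These concern pairs on which the arguments disagree, decided always for the first or always for
  -- the second argument. Where the arguments agree, preservation of arcs decides (`unan2`).
  U1 U2 : (ℕ → ℕ → ℕ) → Set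
  U1 h = ∀ {x y x' y'} → E x y ≡ true → E y' x' ≡ true → E (h x x') (h y y') ≡ true
  U2 h = ∀ {x y x' y'} → E x y ≡ true → E y' x' ≡ true → E (h y y') (h x x') ≡ true

  Uniform : Set
  Uniform = ∀ {h} → C2 h → U1 h ⊎ U2 h

  u1-dom : ∀ {h} → C2 h → U1 h → ∀ {x y x' y'} → x ≢ y → x' ≢ y' → E (h x x') (h y y') ≡ E x y
  u1-dom ch un {x} {y} {x'} {y'} n n' with E x' y' ≟B E x y
  ... | yes e = unan2 ch n n' e
  ... | no d with bool-em (E x y)
  ... | inj₁ t = trans (un t (farc n' (trans (≢→not d) (cong not t)))) (sym t)
  ... | inj₂ f = trans (asym _ _ (un (farc n f) (trans (≢→not d) (cong not f)))) (sym f)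

  opaque
    -- One operation is made injective on the pairs in both orders, so that its arguments can still
    -- be swapped if it favours the second.
    injectU1 : Essential → Uniform → ∀ {J : Set} (W : List J) u v → JInj W u v →
      Σ (ℕ → ℕ → ℕ) λ h → C2 h × U1 h × InjOn W (λ i → h (u i) (v i))
    injectU1 ess unif W u v jn with inject² ess W u v v u jn (λ a b n → sw (jn a b n))
      where sw : ∀ {A B : Set} → A ⊎ B → B ⊎ A
            sw (inj₁ a) = inj₂ a
            sw (inj₂ a) = inj₁ a
    ... | h , ch , i1 , i2 with unif ch
    ... | inj₁ un = h , ch , un , i1
    ... | inj₂ un = _ , swap2 ch , (λ e e' → un e' e) , i2

  opaque
    -- The injective value `h (u i) (v i)` is used as second argument of `g`; it differs at
    -- different indices, so `u1-dom` applies wherever `u` differs.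
    fd-uniform : Essential → Uniform → FirstDominant
    fd-uniform ess unif W u v jn with injectU1 ess unif W u v jn
    ... | h , ch , uh , ih with injectU1 ess unif W u (λ i → h (u i) (v i)) (λ a b n → inj₂ (ih a b n))
    ... | g , cg , ug , ig = _ , c22 cg π1 ch , ig , λ a b n → u1-dom cg ug n (ih a b (λ e → n (cong u e)))

-- Boolean functions on arcs and principal ultrafilters.

maj3 : Bool → Bool → Bool → Bool
maj3 a b c = if a xor b then c else a

min3 : Bool → Bool → Bool → Bool
min3 a b c = a xor (b xor c)

is : Fin 3 → Fin 3 → Bool
is zero zero = true
is zero (suc _) = false
is (suc zero) zero = false
is (suc zero) (suc zero) = true
is (suc zero) (suc (suc _)) = false
is (suc (suc zero)) zero = false
is (suc (suc zero)) (suc zero) = false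
is (suc (suc zero)) (suc (suc zero)) = true

One : Bool → Bool → Bool → Set
One a b c = ((a ≡ true) × (b ≡ false) × (c ≡ false)) ⊎ ((a ≡ false) × (b ≡ true) × (c ≡ false)) ⊎ ((a ≡ false) × (b ≡ false) × (c ≡ true))

-- A two-valued self-dual map that picks exactly one block of every partition into
-- three blocks is a principal ultrafilter.
module Ultrafilter {k : ℕ} (U : (Fin k → Bool) → Bool)
  (Uext : ∀ {J K} → (∀ j → J j ≡ K j) → U J ≡ U K)
  (Uneg : ∀ J → U (λ j → not (J j)) ≡ not (U J))
  (Utop : U (λ _ → true) ≡ true)
  (one : ∀ (c : Fin k → Fin 3) → One (U (λ j → is zero (c j))) (U (λ j → is (suc zero) (c j))) (U (λ j → is (suc (suc zero)) (c j)))) where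

  below : ℕ → Fin k → Bool
  below n j = ⌊ toℕ j <? n ⌋

  private
    cf : ℕ → Fin k → Fin 3
    cf n j with <-cmp (toℕ j) n
    ... | tri< _ _ _ = zero
    ... | tri≈ _ _ _ = suc zero
    ... | tri> _ _ _ = suc (suc zero)

    cf0 : ∀ n j → below n j ≡ is zero (cf n j)
    cf0 n j with <-cmp (toℕ j) n | toℕ j <? n
    ... | tri< _ _ _ | yes _ = refl
    ... | tri< a _ _ | no b = ⊥-elim (b a)
    ... | tri≈ a _ _ | yes b = ⊥-elim (a b)
    ... | tri≈ _ _ _ | no _ = refl
    ... | tri> a _ _ | yes b = ⊥-elim (a b)
    ... | tri> _ _ _ | no _ = refl

    cf2 : ∀ n j → not (below (suc n) j) ≡ is (suc (suc zero)) (cf n j)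
    cf2 n j with <-cmp (toℕ j) n | toℕ j <? suc n
    ... | tri< _ _ _ | yes _ = refl
    ... | tri< a _ _ | no b = ⊥-elim (b (m<n⇒m<1+n a))
    ... | tri≈ _ _ _ | yes _ = refl
    ... | tri≈ _ refl _ | no b = ⊥-elim (b (n<1+n _))
    ... | tri> _ _ c | yes b = ⊥-elim (<⇒≱ c (m<1+n⇒m≤n b))
    ... | tri> _ _ _ | no _ = refl

    cf1 : ∀ n (j₀ : Fin k) → toℕ j₀ ≡ n → ∀ j → is (suc zero) (cf n j) ≡ ⌊ j ≟F j₀ ⌋
    cf1 n j₀ e j with <-cmp (toℕ j) n | j ≟F j₀
    ... | tri< _ a _ | yes refl = ⊥-elim (a e)
    ... | tri< _ _ _ | no _ = refl
    ... | tri≈ _ _ _ | yes _ = refl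
    ... | tri≈ _ a _ | no b = ⊥-elim (b (toℕ-injective (trans a (sym e))))
    ... | tri> _ a _ | yes refl = ⊥-elim (a e)
    ... | tri> _ _ _ | no _ = refl

  single : Fin k → Fin k → Bool
  single j₀ j = ⌊ j ≟F j₀ ⌋

  private
    not-f : ∀ {a} → not a ≡ true → a ≡ false
    not-f {false} _ = refl

    -- Partition into the indices below, at and above `n`. If no singleton is chosen, an unchosen
    -- initial segment forces the upper block to be chosen, so the next initial segment is unchosen
    -- as well; this reaches the full set.
    allsmall : (∀ j → U (single j) ≡ false) → ∀ n → n ≤ k → U (below n) ≡ false
    allsmall al zero _ = not-f (trans (sym (Uneg (below zero))) (trans (Uext (λ j → refl)) Utop))
    allsmall al (suc n) le with one (cf n)
    ... | inj₁ (p , _) = ⊥-elim (t≢f (trans (Uext (cf0 n)) p) (allsmall al n (<⇒≤ le)))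
    ... | inj₂ (inj₁ (_ , p , _)) = ⊥-elim (t≢f (trans (sym (Uext (cf1 n (fromℕ< le) (toℕ-fromℕ< le)))) p) (al (fromℕ< le)))
    ... | inj₂ (inj₂ (_ , _ , p)) = not-f (trans (sym (Uneg (below (suc n)))) (trans (Uext (cf2 n)) p))

    top : U (below k) ≡ true
    top = trans (Uext (λ j → h j)) Utop
      where h : ∀ j → below k j ≡ true
            h j with toℕ j <? k
            ... | yes _ = refl
            ... | no n = ⊥-elim (n (toℕ<n j))

    cj : Fin k → (Fin k → Bool) → Fin k → Fin 3
    cj j₀ J j = if single j₀ j then zero else (if J j then suc zero else suc (suc zero))

    cj0 : ∀ j₀ J j → single j₀ j ≡ is zero (cj j₀ J j)
    cj0 j₀ J j with j ≟F j₀ | J j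
    ... | yes _ | _ = refl
    ... | no _ | true = refl
    ... | no _ | false = refl

    cj2 : ∀ j₀ J → J j₀ ≡ true → ∀ j → not (J j) ≡ is (suc (suc zero)) (cj j₀ J j)
    cj2 j₀ J e j with j ≟F j₀ | J j in q
    ... | yes refl | true = refl
    ... | yes refl | false = ⊥-elim (t≢f e q)
    ... | no _ | true = refl
    ... | no _ | false = refl

    -- Partition into the chosen point, the rest of `J` and the complement of `J`: the complement is
    -- not chosen, and self-duality passes to `J`.
    pos : ∀ j₀ → U (single j₀) ≡ true → ∀ J → J j₀ ≡ true → U J ≡ true
    pos j₀ s J e with one (cj j₀ J)
    ... | inj₁ (_ , _ , p) = ¬f→t (λ q → t≢f (trans (Uneg J) (cong not q)) (trans (Uext (cj2 j₀ J e)) p))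
    ... | inj₂ (inj₁ (p , _)) = ⊥-elim (t≢f s (trans (Uext (cj0 j₀ J)) p))
    ... | inj₂ (inj₂ (p , _)) = ⊥-elim (t≢f s (trans (Uext (cj0 j₀ J)) p))

  principal : Σ (Fin k) λ j → ∀ J → U J ≡ J j
  principal with any? (λ j → U (single j) ≟B true)
  ... | no n = ⊥-elim (t≢f top (allsmall (λ j → ¬t→f (λ e → n (j , e))) k ≤-refl))
  ... | yes (j , s) = j , h
    where
    h : ∀ J → U J ≡ J j
    h J with J j in e
    ... | true = pos j s J e
    ... | false = not-f (trans (sym (Uneg J)) (pos j s (λ i → not (J i)) (cong not e)))

-- The uniform case: operations act on arcs through Boolean functions.

module UniformCase (cl : OpClone)
  (pres : PreservesArcs cl) where
  open ArcPreserving cl pres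

  sel : ∀ {k} → (Fin k → Bool) → ℕ → ℕ → Fin k → ℕ
  sel J a b j = if J j then a else b

  private
    Csel : ∀ b → C {2} (λ v → if b then v zero else v (suc zero))
    Csel true = Cproj zero
    Csel false = Cproj (suc zero)

    Gen : ∀ {k} → ℕ → (Fin k → ℕ) → Set
    Gen r x = ∀ j → (r ≢ x j) × (E r (x j) ≡ true)

    gse : ∀ {k r} {x : Fin k → ℕ} → Gen r x → ∀ i j → SE (x i) r (x j) r
    gse g i j = sw-se (se (proj₁ (g i)) (proj₁ (g j)) (trans (proj₂ (g i)) (sym (proj₂ (g j)))))

  selfalse : ∀ {k} {f : Op k} → C f → ∀ {x y} → (∀ j → E (y j) (x j) ≡ true) → E (f x) (f y) ≡ false
  selfalse cf h = asym _ _ (pres cf h)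

  module _ (unif : Uniform) {k} {f : Op k} (cf : C f) where

    private
      -- Coordinates with the same arc direction are reached from one of them by partial
      -- isomorphisms fixing `r` and `s`, which are consistent because `r` and `s` dominate all
      -- points involved. This contracts `f` to a binary `h`, and both sides become outcomes of `h`
      -- on disagreements, equal by uniformity.
      via : ∀ x y → x # y → ∀ {r s} → E r s ≡ true → Gen r x → Gen r y → Gen s x → Gen s y →
        E (f x) (f y) ≡ E (f (sel (λ j → E (x j) (y j)) r s)) (f (sel (λ j → E (x j) (y j)) s r))
      via x y n {r} {s} rs grx gry gsx gsy with em {Σ (Fin k) λ j → E (x j) (y j) ≡ true} | em {Σ (Fin k) λ j → E (x j) (y j) ≡ false}
      ... | no nt | _ = trans (selfalse cf (λ j → farc (n j) (ff j))) (sym (selfalse cf g))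
        where
        ff : ∀ j → E (x j) (y j) ≡ false
        ff j = ¬t→f (λ e → nt (j , e))
        g : ∀ j → E (sel (λ j → E (x j) (y j)) s r j) (sel (λ j → E (x j) (y j)) r s j) ≡ true
        g j rewrite ff j = rs
      ... | yes _ | no nf = trans (pres cf tt') (sym (pres cf g))
        where
        tt' : ∀ j → E (x j) (y j) ≡ true
        tt' j = ¬f→t (λ e → nf (j , e))
        g : ∀ j → E (sel (λ j → E (x j) (y j)) r s j) (sel (λ j → E (x j) (y j)) s r j) ≡ true
        g j rewrite tt' j = rs
      ... | yes (p , ep) | yes (q , q≡) = trans (cong₂ E (sym hx) (sym hy)) (trans out (cong₂ E hr hs))
        where
        W : Fin k → Set
        W j = Σ (ℕ → ℕ) λ u → C1 u × (u (if E (x j) (y j) then x p else x q) ≡ x j) × (u (if E (x j) (y j) then y p else y q) ≡ y j) × (u r ≡ r) × (u s ≡ s)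
        mv : ∀ i j → E (x i) (y i) ≡ E (x j) (y j) → Σ (ℕ → ℕ) λ u → C1 u × (u (x i) ≡ x j) × (u (y i) ≡ y j) × (u r ≡ r) × (u s ≡ s)
        mv i j e with homL ((x i , x j) ∷ (y i , y j) ∷ (r , r) ∷ (s , s) ∷ [])
            ((se (n i) (n j) e ∷ gse grx i j ∷ gse gsx i j ∷ []) ∷ (gse gry i j ∷ gse gsy i j ∷ []) ∷ ((refl , refl) ∷ []) ∷ [] ∷ [])
        ... | u , cu , a ∷ b ∷ c ∷ d ∷ [] = u , cu , a , b , c , d
        w : ∀ j → W j
        w j with E (x j) (y j) in e
        ... | true = mv p j (trans ep (sym e))
        ... | false = mv q j (trans q≡ (sym e))
        u : Fin k → ℕ → ℕ
        u j = proj₁ (w j)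
        h : ℕ → ℕ → ℕ
        h a b = f (λ j → u j (if E (x j) (y j) then a else b))
        ch : C2 h
        ch = mk2 (Ccomp {g = λ j v → u j (if E (x j) (y j) then v zero else v (suc zero))} cf (λ j → c1 (proj₁ (proj₂ (w j))) (Csel (E (x j) (y j)))))
        hx : h (x p) (x q) ≡ f x
        hx = Cext cf (λ j → proj₁ (proj₂ (proj₂ (w j))))
        hy : h (y p) (y q) ≡ f y
        hy = Cext cf (λ j → proj₁ (proj₂ (proj₂ (proj₂ (w j)))))
        ur : ∀ j → u j r ≡ r
        ur j = proj₁ (proj₂ (proj₂ (proj₂ (proj₂ (w j)))))
        us : ∀ j → u j s ≡ s
        us j = proj₂ (proj₂ (proj₂ (proj₂ (proj₂ (w j)))))
        pick : ∀ b j → u j (if b then r else s) ≡ (if b then r else s)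
        pick true j = ur j
        pick false j = us j
        pick' : ∀ b j → u j (if b then s else r) ≡ (if b then s else r)
        pick' true j = us j
        pick' false j = ur j
        hr : h r s ≡ f (sel (λ j → E (x j) (y j)) r s)
        hr = Cext cf (λ j → pick (E (x j) (y j)) j)
        hs : h s r ≡ f (sel (λ j → E (x j) (y j)) s r)
        hs = Cext cf (λ j → pick' (E (x j) (y j)) j)
        out : E (h (x p) (x q)) (h (y p) (y q)) ≡ E (h r s) (h s r)
        out with unif ch
        ... | inj₁ un = trans (un ep (farc (n q) q≡)) (sym (un rs rs))
        ... | inj₂ un = trans (asym _ _ (un ep (farc (n q) q≡))) (sym (asym _ _ (un rs rs)))

    sign-eq : ∀ {x y x' y'} → x # y → x' # y' → (∀ j → E (x j) (y j) ≡ E (x' j) (y' j)) → E (f x) (f y) ≡ E (f x') (f y')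
    sign-eq {x} {y} {x'} {y'} n n' e
      with ext (tabulate x ++ tabulate y ++ tabulate x' ++ tabulate y') (λ _ → true)
    ... | s , hs with ext (s ∷ tabulate x ++ tabulate y ++ tabulate x' ++ tabulate y') (λ _ → true)
    ... | r , hr = trans (via x y n (proj₂ (hr s (here refl))) (λ j → hr _ (there (i1 j))) (λ j → hr _ (there (i2 j))) (λ j → hs _ (i1 j)) (λ j → hs _ (i2 j)))
        (trans (cong₂ E (Cext cf (λ j → cong (λ b → if b then r else s) (e j))) (Cext cf (λ j → cong (λ b → if b then s else r) (e j))))
        (sym (via x' y' n' (proj₂ (hr s (here refl))) (λ j → hr _ (there (i3 j))) (λ j → hr _ (there (i4 j))) (λ j → hs _ (i3 j)) (λ j → hs _ (i4 j)))))
      where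
      i1 : ∀ j → x j ∈ tabulate x ++ tabulate y ++ tabulate x' ++ tabulate y'
      i1 j = ∈-++⁺ˡ (∈-tabulate⁺ j)
      i2 : ∀ j → y j ∈ tabulate x ++ tabulate y ++ tabulate x' ++ tabulate y'
      i2 j = ∈-++⁺ʳ (tabulate x) (∈-++⁺ˡ (∈-tabulate⁺ j))
      i3 : ∀ j → x' j ∈ tabulate x ++ tabulate y ++ tabulate x' ++ tabulate y'
      i3 j = ∈-++⁺ʳ (tabulate x) (∈-++⁺ʳ (tabulate y) (∈-++⁺ˡ (∈-tabulate⁺ j)))
      i4 : ∀ j → y' j ∈ tabulate x ++ tabulate y ++ tabulate x' ++ tabulate y'
      i4 j = ∈-++⁺ʳ (tabulate x) (∈-++⁺ʳ (tabulate y) (∈-++⁺ʳ (tabulate x') (∈-tabulate⁺ j)))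

    private
      b₀ a₀ : ℕ
      b₀ = 0
      a₀ = proj₁ (ext (b₀ ∷ []) (λ _ → true))
      ab : E a₀ b₀ ≡ true
      ab = proj₂ (proj₂ (ext (b₀ ∷ []) (λ _ → true)) b₀ (here refl))

      ban : ∀ b → (if b then a₀ else b₀) ≢ (if b then b₀ else a₀)
      ban true = arc≢ ab
      ban false e = arc≢ ab (sym e)

      bas : ∀ b → E (if b then a₀ else b₀) (if b then b₀ else a₀) ≡ b
      bas true = ab
      bas false = asym _ _ ab

    φ : (Fin k → Bool) → Bool
    φ J = E (f (sel J a₀ b₀)) (f (sel J b₀ a₀))

    φ-spec : ∀ {x y} → x # y → E (f x) (f y) ≡ φ (λ j → E (x j) (y j))
    φ-spec {x} {y} n = sign-eq n (λ j → ban (E (x j) (y j))) (λ j → sym (bas (E (x j) (y j))))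

    φ-ext : ∀ {J K} → (∀ j → J j ≡ K j) → φ J ≡ φ K
    φ-ext e = cong₂ E (Cext cf (λ j → cong (λ b → if b then a₀ else b₀) (e j))) (Cext cf (λ j → cong (λ b → if b then b₀ else a₀) (e j)))

    φ-neg : ∀ J → φ (λ j → not (J j)) ≡ not (φ J)
    φ-neg J = trans (cong₂ E (Cext cf (λ j → n1 (J j))) (Cext cf (λ j → n2 (J j)))) (flip (strict cf (λ j → ban (J j))))
      where
      n1 : ∀ b → (if not b then a₀ else b₀) ≡ (if b then b₀ else a₀)
      n1 true = refl
      n1 false = refl
      n2 : ∀ b → (if not b then b₀ else a₀) ≡ (if b then a₀ else b₀)
      n2 true = refl
      n2 false = refl

    φ-top : φ (λ _ → true) ≡ true
    φ-top = pres cf (λ _ → ab)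

  Sign3 : (ℕ → ℕ → ℕ → ℕ) → (Bool → Bool → Bool → Bool) → Set
  Sign3 m μ = ∀ {x y z x' y' z'} → x ≢ x' → y ≢ y' → z ≢ z' → E (m x y z) (m x' y' z') ≡ μ (E x x') (E y y') (E z z')

  Ternary : (Bool → Bool → Bool → Bool) → Set
  Ternary μ = Σ (ℕ → ℕ → ℕ → ℕ) λ m → C3 m × Sign3 m μ

  private
    cgμ : ∀ {m μ ν} → Sign3 m μ → (∀ a b c → μ a b c ≡ ν a b c) → Sign3 m ν
    cgμ s e n1 n2 n3 = trans (s n1 n2 n3) (e _ _ _)

    -- The self-dual function with values true, true, false on the three unit vectors. Substituted
    -- into its own third place it becomes majority.
    pix : Bool → Bool → Bool → Bool
    pix a b c = if a xor b then not c else a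

    pix→maj : Ternary pix → Ternary maj3
    pix→maj (m , cm , s) = _ , c33 cm p1 p2 cm , λ {x} {y} {z} {x'} {y'} {z'} n1 n2 n3 →
      trans (s n1 n2 (strict (un3 cm) {three x y z} {three x' y' z'} (λ { zero → n1 ; (suc zero) → n2 ; (suc (suc zero)) → n3 })))
        (trans (cong (pix (E x x') (E y y')) (s n1 n2 n3)) (pp (E x x') (E y y') (E z z')))
      where
      pp : ∀ a b c → pix a b (pix a b c) ≡ maj3 a b c
      pp true true _ = refl
      pp true false c = not-involutive c
      pp false true c = not-involutive c
      pp false false _ = refl

    -- Negation exchanges the vectors of weight two with the unit vectors, so self-duality and the
    -- value at the top leave only three values free.
    tab : (μ : Bool → Bool → Bool → Bool) → (∀ a b c → μ (not a) (not b) (not c) ≡ not (μ a b c)) → μ true true true ≡ true →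
      (ν : Bool → Bool → Bool → Bool) → (∀ a b c → ν (not a) (not b) (not c) ≡ not (ν a b c)) → ν true true true ≡ true →
      μ true false false ≡ ν true false false → μ false true false ≡ ν false true false → μ false false true ≡ ν false false true →
      ∀ a b c → μ a b c ≡ ν a b c
    tab μ d t ν d' t' e1 e2 e3 true true true = trans t (sym t')
    tab μ d t ν d' t' e1 e2 e3 false false false = trans (d true true true) (trans (cong not (trans t (sym t'))) (sym (d' true true true)))
    tab μ d t ν d' t' e1 e2 e3 true false false = e1
    tab μ d t ν d' t' e1 e2 e3 false true false = e2
    tab μ d t ν d' t' e1 e2 e3 false false true = e3
    tab μ d t ν d' t' e1 e2 e3 false true true = trans (d true false false) (trans (cong not e1) (sym (d' true false false)))
    tab μ d t ν d' t' e1 e2 e3 true false true = trans (d false true false) (trans (cong not e2) (sym (d' false true false)))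
    tab μ d t ν d' t' e1 e2 e3 true true false = trans (d false false true) (trans (cong not e3) (sym (d' false false true)))

    dmaj : ∀ a b c → maj3 (not a) (not b) (not c) ≡ not (maj3 a b c)
    dmaj true true c = refl
    dmaj true false c = refl
    dmaj false true c = refl
    dmaj false false c = refl

    dmin : ∀ a b c → min3 (not a) (not b) (not c) ≡ not (min3 a b c)
    dmin true true true = refl
    dmin true true false = refl
    dmin true false true = refl
    dmin true false false = refl
    dmin false true true = refl
    dmin false true false = refl
    dmin false false true = refl
    dmin false false false = refl

    dpix : ∀ a b c → pix (not a) (not b) (not c) ≡ not (pix a b c)
    dpix true true c = refl
    dpix true false c = refl
    dpix false true c = refl
    dpix false false c = refl

  Follows : ∀ {k} → Op k → Fin k → Set
  Follows f j = ∀ {x y} → x # y → E (f x) (f y) ≡ E (x j) (y j)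

  -- Identify variables along a partition into three blocks. On the unit vectors, all values false
  -- give majority, all true give minority, and exactly two true give `pix` up to a permutation,
  -- hence majority. Without these operations exactly one block is chosen, so the chosen sets form a
  -- principal ultrafilter.
  uniform-cases : Uniform → (∀ {k} {f : Op k} → C f → Σ (Fin k) (Follows f)) ⊎ (Ternary maj3 ⊎ Ternary min3)
  uniform-cases unif with em {Ternary maj3 ⊎ Ternary min3}
  ... | yes t = inj₂ t
  ... | no nt = inj₁ fol
    where
    module _ {k} {f : Op k} (cf : C f) where
      one : ∀ c → One (φ unif cf (λ j → is zero (c j))) (φ unif cf (λ j → is (suc zero) (c j))) (φ unif cf (λ j → is (suc (suc zero)) (c j)))
      one c = go (bool-em (φ unif cf (λ j → is zero (c j)))) (bool-em (φ unif cf (λ j → is (suc zero) (c j)))) (bool-em (φ unif cf (λ j → is (suc (suc zero)) (c j))))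
        where
        m : ℕ → ℕ → ℕ → ℕ
        m x y z = f (λ j → three x y z (c j))
        cm : C3 m
        cm = mk3 (Ccomp {g = λ j v → three (v zero) (v (suc zero)) (v (suc (suc zero))) (c j)} cf (λ j → pr (c j)))
          where
          pr : ∀ i → C {3} (λ v → three (v zero) (v (suc zero)) (v (suc (suc zero))) i)
          pr zero = Cproj zero
          pr (suc zero) = Cproj (suc zero)
          pr (suc (suc zero)) = Cproj (suc (suc zero))
        μ : Bool → Bool → Bool → Bool
        μ a b d = φ unif cf (λ j → three a b d (c j))
        sg : Sign3 m μ
        sg {x} {y} {z} {x'} {y'} {z'} n1 n2 n3 = trans (φ-spec unif cf (λ j → nn (c j))) (φ-ext unif cf (λ j → ee (c j)))
          where
          nn : ∀ i → three x y z i ≢ three x' y' z' i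
          nn zero = n1
          nn (suc zero) = n2
          nn (suc (suc zero)) = n3
          ee : ∀ i → E (three x y z i) (three x' y' z' i) ≡ three (E x x') (E y y') (E z z') i
          ee zero = refl
          ee (suc zero) = refl
          ee (suc (suc zero)) = refl
        dμ : ∀ a b d → μ (not a) (not b) (not d) ≡ not (μ a b d)
        dμ a b d = trans (φ-ext unif cf (λ j → g (c j))) (φ-neg unif cf _)
          where
          g : ∀ i → three (not a) (not b) (not d) i ≡ not (three a b d i)
          g zero = refl
          g (suc zero) = refl
          g (suc (suc zero)) = refl
        tμ : μ true true true ≡ true
        tμ = trans (φ-ext unif cf (λ j → g (c j))) (φ-top unif cf)
          where
          g : ∀ i → three true true true i ≡ true
          g zero = refl
          g (suc zero) = refl
          g (suc (suc zero)) = refl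
        e0 : μ true false false ≡ φ unif cf (λ j → is zero (c j))
        e0 = φ-ext unif cf (λ j → g (c j))
          where
          g : ∀ i → three true false false i ≡ is zero i
          g zero = refl
          g (suc zero) = refl
          g (suc (suc zero)) = refl
        e1 : μ false true false ≡ φ unif cf (λ j → is (suc zero) (c j))
        e1 = φ-ext unif cf (λ j → g (c j))
          where
          g : ∀ i → three false true false i ≡ is (suc zero) i
          g zero = refl
          g (suc zero) = refl
          g (suc (suc zero)) = refl
        e2 : μ false false true ≡ φ unif cf (λ j → is (suc (suc zero)) (c j))
        e2 = φ-ext unif cf (λ j → g (c j))
          where
          g : ∀ i → three false false true i ≡ is (suc (suc zero)) i
          g zero = refl
          g (suc zero) = refl
          g (suc (suc zero)) = refl
        mk : ∀ {ν} → (∀ a b d → ν (not a) (not b) (not d) ≡ not (ν a b d)) → ν true true true ≡ true →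
          φ unif cf (λ j → is zero (c j)) ≡ ν true false false → φ unif cf (λ j → is (suc zero) (c j)) ≡ ν false true false →
          φ unif cf (λ j → is (suc (suc zero)) (c j)) ≡ ν false false true → Sign3 m ν
        mk {ν} d t p q r = cgμ {m} sg (tab μ dμ tμ ν d t (trans e0 p) (trans e1 q) (trans e2 r))
        Φ0 Φ1 Φ2 : Bool
        Φ0 = φ unif cf (λ j → is zero (c j))
        Φ1 = φ unif cf (λ j → is (suc zero) (c j))
        Φ2 = φ unif cf (λ j → is (suc (suc zero)) (c j))
        go : Φ0 ≡ true ⊎ Φ0 ≡ false → Φ1 ≡ true ⊎ Φ1 ≡ false → Φ2 ≡ true ⊎ Φ2 ≡ false → One Φ0 Φ1 Φ2
        go (inj₁ a) (inj₂ b) (inj₂ d) = inj₁ (a , b , d)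
        go (inj₂ a) (inj₁ b) (inj₂ d) = inj₂ (inj₁ (a , b , d))
        go (inj₂ a) (inj₂ b) (inj₁ d) = inj₂ (inj₂ (a , b , d))
        go (inj₂ a) (inj₂ b) (inj₂ d) = ⊥-elim (nt (inj₁ (m , cm , mk dmaj refl a b d)))
        go (inj₁ a) (inj₁ b) (inj₁ d) = ⊥-elim (nt (inj₂ (m , cm , mk dmin refl a b d)))
        go (inj₁ a) (inj₁ b) (inj₂ d) = ⊥-elim (nt (inj₁ (pix→maj (m , cm , mk dpix refl a b d))))
        go (inj₁ a) (inj₂ b) (inj₁ d) = ⊥-elim (nt (inj₁ (pix→maj (_ , c33 cm p1 p3 p2 , λ n1 n2 n3 → mk {λ a b c → pix a c b} (λ a b c → dpix a c b) refl a b d n1 n3 n2))))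
        go (inj₂ a) (inj₁ b) (inj₁ d) = ⊥-elim (nt (inj₁ (pix→maj (_ , c33 cm p3 p1 p2 , λ n1 n2 n3 → mk {λ a b c → pix b c a} (λ a b c → dpix b c a) refl a b d n3 n1 n2))))
      module UL = Ultrafilter (φ unif cf) (φ-ext unif cf) (φ-neg unif cf) (φ-top unif cf) one
    fol : ∀ {k} {f : Op k} → C f → Σ (Fin k) (Follows f)
    fol cf with UL.principal cf
    ... | j , h = j , λ n → trans (φ-spec unif cf n) (h _)

-- The non-uniform case: arcs can be decided independently of each other.

module NonUniformCase (cl : OpClone)
  (pres : PreservesArcs cl) where
  open ArcPreserving cl pres
  open UniformCase cl pres

  Pt : Set
  Pt = ℕ × ℕ

  -- A point collects the two arguments of a binary operation, and `p ⇒ q` is a disagreement with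
  -- the forward arc in the first argument. Then `out h p q` is true when `h` decides for the first
  -- argument.
  _⇒_ Apart : Pt → Pt → Set
  p ⇒ q = (E (proj₁ p) (proj₁ q) ≡ true) × (E (proj₂ q) (proj₂ p) ≡ true)
  Apart p q = (proj₁ p ≢ proj₁ q) × (proj₂ p ≢ proj₂ q)

  ap-sym : ∀ {p q} → Apart p q → Apart q p
  ap-sym (a , b) = (λ e → a (sym e)) , (λ e → b (sym e))

  ⇒-ap : ∀ {p q} → p ⇒ q → Apart p q
  ⇒-ap (a , b) = arc≢ a , (λ e → arc≢ b (sym e))

  SP : Pt → Pt → Pt → Pt → Set
  SP p q p' q' = SE (proj₁ p) (proj₁ q) (proj₁ p') (proj₁ q') × SE (proj₂ p) (proj₂ q) (proj₂ p') (proj₂ q')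

  sw-sp : ∀ {p q p' q'} → SP p q p' q' → SP q p q' p'
  sw-sp (a , b) = sw-se a , sw-se b

  rf-sp : ∀ {p q} → SP p p q q
  rf-sp = rf-se , rf-se

  arc-sp : ∀ {p q p' q'} → p ⇒ q → p' ⇒ q' → SP p q p' q'
  arc-sp a@(a1 , a2) b@(b1 , b2) = se (arc≢ a1) (arc≢ b1) (trans a1 (sym b1)) , sw-se (se (arc≢ a2) (arc≢ b2) (trans a2 (sym b2)))

  sp-arc : ∀ {p q p' q'} → SP p q p' q' → p' ⇒ q' → p ⇒ q
  sp-arc (a , b) (c , d) = trans (proj₁ a) c , trans (proj₂ b) d

  opaque
    extS : (cs : List (Pt × (Pt × Pt))) → AllPairs (λ c d → Apart (proj₁ c) (proj₁ d)) cs → All (λ c → Apart (proj₁ (proj₂ c)) (proj₂ (proj₂ c))) cs →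
      Σ Pt λ m → All (λ c → Apart m (proj₁ c) × SP m (proj₁ c) (proj₁ (proj₂ c)) (proj₂ (proj₂ c))) cs
    extS cs ap al
      with extL (map (λ c → proj₁ (proj₁ c) , E (proj₁ (proj₁ (proj₂ c))) (proj₁ (proj₂ (proj₂ c)))) cs) (AP-map (AllPairs.map (λ n → ag (proj₁ n)) ap)) []
         | extL (map (λ c → proj₂ (proj₁ c) , E (proj₂ (proj₁ (proj₂ c))) (proj₂ (proj₂ (proj₂ c)))) cs) (AP-map (AllPairs.map (λ n → ag (proj₂ n)) ap)) []
    ... | m1 , h1 , _ | m2 , h2 , _ = (m1 , m2) , All.tabulate (λ {c} i →
          let (n1 , e1) = All.lookup (All-map⁻ h1) i ; (n2 , e2) = All.lookup (All-map⁻ h2) i ; (a1 , a2) = All.lookup al i in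
          (n1 , n2) , se n1 a1 e1 , se n2 a2 e2)

  app : (ℕ → ℕ → ℕ) → Pt → ℕ
  app h p = h (proj₁ p) (proj₂ p)

  out : (ℕ → ℕ → ℕ) → Pt → Pt → Bool
  out h p q = E (app h p) (app h q)

  app≢ : ∀ {h} → C2 h → ∀ {p q} → Apart p q → app h p ≢ app h q
  app≢ ch (a , b) = strict2 ch a b

  -- Unless (p,q) can be given outcome "second" and (r,s) outcome "first", the
  -- outcome "second" is inherited along every copy of the configuration.
  Good : Pt → Pt → Pt → Pt → Set
  Good p q r s = Σ (ℕ → ℕ → ℕ) λ h → C2 h × (out h p q ≡ false) × (out h r s ≡ true)

  imp : ∀ {p q r s} → ¬ Good p q r s → ∀ {h} → C2 h → ∀ {p' q' r' s'} →
    SP p' q' p q → SP p' r' p r → SP p' s' p s → SP q' r' q r → SP q' s' q s → SP r' s' r s →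
    out h p' q' ≡ false → out h r' s' ≡ false
  imp {p} {q} {r} {s} ng {h} ch {p'} {q'} {r'} {s'} a b c d e f o
    with homL ((proj₁ p , proj₁ p') ∷ (proj₁ q , proj₁ q') ∷ (proj₁ r , proj₁ r') ∷ (proj₁ s , proj₁ s') ∷ [])
           ((sym-se (proj₁ a) ∷ sym-se (proj₁ b) ∷ sym-se (proj₁ c) ∷ []) ∷ (sym-se (proj₁ d) ∷ sym-se (proj₁ e) ∷ []) ∷ (sym-se (proj₁ f) ∷ []) ∷ [] ∷ [])
       | homL ((proj₂ p , proj₂ p') ∷ (proj₂ q , proj₂ q') ∷ (proj₂ r , proj₂ r') ∷ (proj₂ s , proj₂ s') ∷ [])
           ((sym-se (proj₂ a) ∷ sym-se (proj₂ b) ∷ sym-se (proj₂ c) ∷ []) ∷ (sym-se (proj₂ d) ∷ sym-se (proj₂ e) ∷ []) ∷ (sym-se (proj₂ f) ∷ []) ∷ [] ∷ [])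
  ... | u , cu , u1 ∷ u2 ∷ u3 ∷ u4 ∷ [] | v , cv , v1 ∷ v2 ∷ v3 ∷ v4 ∷ [] =
    ¬t→f (λ t → ng (_ , pre2 ch cu cv , trans (cong₂ E (cong₂ h u1 v1) (cong₂ h u2 v2)) o , trans (cong₂ E (cong₂ h u3 v3) (cong₂ h u4 v4)) t))

  module _ {h₀ : ℕ → ℕ → ℕ} (ch₀ : C2 h₀) {a b c d : Pt} (ab : a ⇒ b) (cd : c ⇒ d)
    (ac : Apart a c) (ad : Apart a d) (bc : Apart b c) (bd : Apart b d)
    (oab : out h₀ a b ≡ true) (ocd : out h₀ c d ≡ false) where

    private
      ca = ap-sym ac
      da = ap-sym ad
      cb = ap-sym bc
      db = ap-sym bd

    -- A new disagreement `m ⇒ n` is placed so that it forms a copy of the configuration both after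
    -- `c ⇒ d` and before `a ⇒ b`; the outcome of `c ⇒ d` would be inherited through it by `a ⇒ b`.
    disjoint : ∀ {p q r s} → p ⇒ q → r ⇒ s → Apart p r → Apart p s → Apart q r → Apart q s → Good p q r s
    disjoint {p} {q} {r} {s} pq rs pr ps qr qs with em {Good p q r s}
    ... | yes g = g
    ... | no ng with extS ((c , r , p) ∷ (d , r , q) ∷ (a , p , r) ∷ (b , p , s) ∷ [])
           ((⇒-ap cd ∷ ca ∷ cb ∷ []) ∷ (da ∷ db ∷ []) ∷ (⇒-ap ab ∷ []) ∷ [] ∷ []) (ap-sym pr ∷ ap-sym qr ∷ pr ∷ ps ∷ [])
    ... | m , (mc , m1) ∷ (md , m2) ∷ (ma , m3) ∷ (mb , m4) ∷ []
      with extS ((c , s , p) ∷ (d , s , q) ∷ (a , q , r) ∷ (b , q , s) ∷ (m , s , r) ∷ [])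
           ((⇒-ap cd ∷ ca ∷ cb ∷ ap-sym mc ∷ []) ∷ (da ∷ db ∷ ap-sym md ∷ []) ∷ (⇒-ap ab ∷ ap-sym ma ∷ []) ∷ (ap-sym mb ∷ []) ∷ [] ∷ [])
           (ap-sym ps ∷ ap-sym qs ∷ qr ∷ qs ∷ ap-sym (⇒-ap rs) ∷ [])
    ... | n , (nc , n1) ∷ (nd , n2) ∷ (na , n3) ∷ (nb , n4) ∷ (nm , n5) ∷ [] = ⊥-elim (t≢f oab
        (imp ng ch₀ (arc-sp mn pq) m3 m4 n3 n4 (arc-sp ab rs)
          (imp ng ch₀ (arc-sp cd pq) (sw-sp m1) (sw-sp n1) (sw-sp m2) (sw-sp n2) (sw-sp n5) ocd)))
      where mn : m ⇒ n
            mn = sp-arc (sw-sp n5) rs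

    -- Along the walk `a ⇒ b ⇒ n ⇒ m ⇒ c ⇒ d` the outcome false would pass from each arc to the one
    -- entering its tail, from the last arc back to the first.
    path-in : ∀ {p q r} → p ⇒ q → r ⇒ p → Apart q r → Good p q r p
    path-in {p} {q} {r} pq rp qr with em {Good p q r p}
    ... | yes g = g
    ... | no ng with extS ((c , r , p) ∷ (d , r , q) ∷ (b , q , r) ∷ (a , r , p) ∷ [])
           ((⇒-ap cd ∷ cb ∷ ca ∷ []) ∷ (db ∷ da ∷ []) ∷ (ap-sym (⇒-ap ab) ∷ []) ∷ [] ∷ []) (⇒-ap rp ∷ ap-sym qr ∷ qr ∷ ⇒-ap rp ∷ [])
    ... | m , (mc , m1) ∷ (md , m2) ∷ (mb , m3) ∷ (ma , _) ∷ [] with extS ((m , r , p) ∷ (c , r , q) ∷ (b , p , r) ∷ (a , q , r) ∷ [])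
           ((mc ∷ mb ∷ ma ∷ []) ∷ (cb ∷ ca ∷ []) ∷ (ap-sym (⇒-ap ab) ∷ []) ∷ [] ∷ []) (⇒-ap rp ∷ ap-sym qr ∷ ap-sym (⇒-ap rp) ∷ qr ∷ [])
    ... | n , (nm , n1) ∷ (nc , n2) ∷ (nb , n3) ∷ (na , n4) ∷ [] =
        ⊥-elim (t≢f oab (st (sp-arc (sw-sp n3) rp) (arc-sp ab rp) (sw-sp n4)
          (st (sp-arc n1 rp) (sw-sp n3) (sw-sp m3) (st (sp-arc m1 rp) n1 n2 (st cd m1 m2 ocd)))))
      where
      st : ∀ {P Q R} → P ⇒ Q → SP R P r p → SP R Q r q → out h₀ P Q ≡ false → out h₀ R P ≡ false
      st PQ s1 s2 = imp ng ch₀ (arc-sp PQ pq) (sw-sp s1) rf-sp (sw-sp s2) (sw-sp (arc-sp PQ pq)) s1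

    -- The same in the opposite direction along `c ⇒ d ⇒ m ⇒ n ⇒ a ⇒ b`.
    path-out : ∀ {p q s} → p ⇒ q → q ⇒ s → Apart p s → Good p q q s
    path-out {p} {q} {s} pq qs ps with em {Good p q q s}
    ... | yes g = g
    ... | no ng with extS ((d , s , q) ∷ (c , s , p) ∷ (a , p , s) ∷ (b , p , s) ∷ [])
           ((ap-sym (⇒-ap cd) ∷ da ∷ db ∷ []) ∷ (ca ∷ cb ∷ []) ∷ (⇒-ap ab ∷ []) ∷ [] ∷ []) (ap-sym (⇒-ap qs) ∷ ap-sym ps ∷ ps ∷ ps ∷ [])
    ... | m , (md , m1) ∷ (mc , m2) ∷ (ma , m3) ∷ (mb , _) ∷ [] with extS ((m , s , q) ∷ (d , s , p) ∷ (a , q , s) ∷ (b , p , s) ∷ [])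
           ((md ∷ ma ∷ mb ∷ []) ∷ (da ∷ db ∷ []) ∷ (⇒-ap ab ∷ []) ∷ [] ∷ []) (ap-sym (⇒-ap qs) ∷ ap-sym ps ∷ ⇒-ap qs ∷ ps ∷ [])
    ... | n , (nm , n1) ∷ (nd , n2) ∷ (na , n3) ∷ (nb , n4) ∷ [] =
        ⊥-elim (t≢f oab (st (sp-arc n3 qs) (sw-sp (arc-sp ab qs)) (sw-sp n4)
          (st (sp-arc (sw-sp n1) qs) (sw-sp n3) (sw-sp m3) (st (sp-arc (sw-sp m1) qs) n1 n2 (st cd m1 m2 ocd)))))
      where
      st : ∀ {P Q S} → P ⇒ Q → SP S Q s q → SP S P s p → out h₀ P Q ≡ false → out h₀ Q S ≡ false
      st PQ s1 s2 = imp ng ch₀ (arc-sp PQ pq) (arc-sp PQ pq) (sw-sp s2) rf-sp (sw-sp s1) (sw-sp s1)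

    private
      rev⇒ : ∀ {p q} → p ⇒ q → swap q ⇒ swap p
      rev⇒ (x , y) = y , x

      f→t : ∀ {p q} → Apart p q → out h₀ p q ≡ false → out h₀ q p ≡ true
      f→t n o = farc (app≢ ch₀ n) o

    -- Here `hop` passes the outcome false between any two arcs with a common tail, so the arcs from
    -- `c` and from `a` to a common head `m` have different outcomes. Exchanging the two arguments
    -- turns the common head into a common tail and negates outcomes, so `hop` contradicts this.
    tails : ∀ {p q s} → p ⇒ q → p ⇒ s → Apart q s → Good p q p s
    tails {p} {q} {s} pq ps qs with em {Good p q p s}
    ... | yes g = g
    ... | no ng with extS ((c , q , p) ∷ (a , q , p) ∷ (d , p , q) ∷ (b , p , q) ∷ [])
           ((ca ∷ ⇒-ap cd ∷ cb ∷ []) ∷ (ad ∷ ⇒-ap ab ∷ []) ∷ (db ∷ []) ∷ [] ∷ [])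
           (ap-sym (⇒-ap pq) ∷ ap-sym (⇒-ap pq) ∷ ⇒-ap pq ∷ ⇒-ap pq ∷ [])
    ... | m , (mc , m1) ∷ (ma , m2) ∷ (md , _) ∷ (mb , _) ∷ [] =
        ⊥-elim (t≢f (f→t (ap-sym mc) cm) (hop (swap2 ch₀) (rev⇒ am⇒) (rev⇒ cm⇒) (swap ac) (asym _ _ am)))
      where
      cm⇒ : c ⇒ m
      cm⇒ = sp-arc (sw-sp m1) pq
      am⇒ : a ⇒ m
      am⇒ = sp-arc (sw-sp m2) pq
      hop : ∀ {h} → C2 h → ∀ {P Q S} → P ⇒ Q → P ⇒ S → Apart Q S → out h P Q ≡ false → out h P S ≡ false
      hop {h} ch {P} {Q} {S} PQ PS QS o with extS ((P , s , p) ∷ (Q , s , q) ∷ (S , q , s) ∷ [])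
           ((⇒-ap PQ ∷ ⇒-ap PS ∷ []) ∷ (QS ∷ []) ∷ [] ∷ []) (ap-sym (⇒-ap ps) ∷ ap-sym qs ∷ qs ∷ [])
      ... | N , (NP , n1) ∷ (NQ , n2) ∷ (NS , n3) ∷ [] = st (sp-arc (sw-sp n1) ps) (sw-sp (arc-sp PS ps)) (sw-sp n3) (st PQ n1 n2 o)
        where
        st : ∀ {P Q S} → P ⇒ Q → SP S P s p → SP S Q s q → out h P Q ≡ false → out h P S ≡ false
        st PQ s1 s2 = imp ng ch (arc-sp PQ pq) rf-sp (sw-sp s1) (sw-sp (arc-sp PQ pq)) (sw-sp s2) (sw-sp s1)
      cm : out h₀ c m ≡ false
      cm = hop ch₀ cd cm⇒ (ap-sym md) ocd
      am : out h₀ a m ≡ true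
      am = ¬f→t (λ o → t≢f oab (hop ch₀ am⇒ ab mb o))

    -- Dual to `tails`: `hop` joins arcs with a common head, and the exchange of arguments is
    -- applied at the common tail `m`.
    heads : ∀ {p q r} → p ⇒ q → r ⇒ q → Apart p r → Good p q r q
    heads {p} {q} {r} pq rq pr with em {Good p q r q}
    ... | yes g = g
    ... | no ng with extS ((d , p , q) ∷ (b , p , q) ∷ (c , p , q) ∷ (a , p , q) ∷ [])
           ((db ∷ ap-sym (⇒-ap cd) ∷ da ∷ []) ∷ (bc ∷ ap-sym (⇒-ap ab) ∷ []) ∷ (ca ∷ []) ∷ [] ∷ [])
           (⇒-ap pq ∷ ⇒-ap pq ∷ ⇒-ap pq ∷ ⇒-ap pq ∷ [])
    ... | m , (md , m1) ∷ (mb , m2) ∷ (mc , _) ∷ (ma , _) ∷ [] =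
        ⊥-elim (t≢f (f→t md dm) (hop (swap2 ch₀) (rev⇒ mb⇒) (rev⇒ md⇒) (swap bd) (asym _ _ bm)))
      where
      md⇒ : m ⇒ d
      md⇒ = sp-arc m1 pq
      mb⇒ : m ⇒ b
      mb⇒ = sp-arc m2 pq
      hop : ∀ {h} → C2 h → ∀ {P Q R} → P ⇒ Q → R ⇒ Q → Apart P R → out h P Q ≡ false → out h R Q ≡ false
      hop {h} ch {P} {Q} {R} PQ RQ PR o with extS ((Q , r , q) ∷ (P , r , p) ∷ (R , p , r) ∷ [])
           ((ap-sym (⇒-ap PQ) ∷ ap-sym (⇒-ap RQ) ∷ []) ∷ (PR ∷ []) ∷ [] ∷ []) (⇒-ap rq ∷ ap-sym pr ∷ pr ∷ [])
      ... | N , (NQ , n1) ∷ (NP , n2) ∷ (NR , n3) ∷ [] = st (sp-arc n1 rq) (arc-sp RQ rq) (sw-sp n3) (st PQ n1 n2 o)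
        where
        st : ∀ {P Q R} → P ⇒ Q → SP R Q r q → SP R P r p → out h P Q ≡ false → out h R Q ≡ false
        st PQ s1 s2 = imp ng ch (arc-sp PQ pq) (sw-sp s2) (arc-sp PQ pq) (sw-sp s1) rf-sp s1
      dm : out h₀ m d ≡ false
      dm = hop ch₀ cd md⇒ (ap-sym mc) ocd
      bm : out h₀ m b ≡ true
      bm = ¬f→t (λ o → t≢f oab (hop ch₀ mb⇒ ab ma o))

    Distinct2 : ∀ {J : Set} → J → J → J → J → Set
    Distinct2 k l i j = ¬ ((k ≡ i) × (l ≡ j)) × ¬ ((k ≡ j) × (l ≡ i))

    module _ {J : Set} (W : List J) (u w : J → ℕ) (iu : InjOn W u) (iw : InjOn W w) where

      private
        pt : J → Pt
        pt i = u i , w i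

        apt : ∀ {i j} → i ∈ W → j ∈ W → i ≢ j → Apart (pt i) (pt j)
        apt a b n = iu a b n , iw a b n

        Res : J → J → J → J → Set
        Res k l i j = Σ (ℕ → ℕ → ℕ) λ h → C2 h × (E (h (u k) (w k)) (h (u l) (w l)) ≡ E (w k) (w l)) × (E (h (u i) (w i)) (h (u j) (w j)) ≡ E (u i) (u j))

        mk⇒ : ∀ {k l} → k ∈ W → l ∈ W → k ≢ l → E (u k) (u l) ≢ E (w k) (w l) → E (u k) (u l) ≡ true → pt k ⇒ pt l
        mk⇒ a b n d e = e , farc (iw a b n) (¬t→f (λ q → d (trans e (sym q))))

        tco : ∀ {k l i j} → k ∈ W → l ∈ W → i ∈ W → j ∈ W → k ≢ l → i ≢ j → Distinct2 k l i j →
          pt k ⇒ pt l → pt i ⇒ pt j → Good (pt k) (pt l) (pt i) (pt j)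
        tco {k} {l} {i} {j} k∈ l∈ i∈ j∈ kl ij (n1 , n2) e e' with em {k ≡ i}
        ... | yes refl = tails e e' (apt l∈ j∈ (λ q → n1 (refl , q)))
        ... | no ki with em {k ≡ j}
        ... | yes refl = path-in e e' (apt l∈ i∈ (λ q → n2 (refl , q)))
        ... | no kj with em {l ≡ i}
        ... | yes refl = path-out e e' (apt k∈ j∈ kj)
        ... | no li with em {l ≡ j}
        ... | yes refl = heads e e' (apt k∈ i∈ ki)
        ... | no lj = disjoint e e' (apt k∈ i∈ ki) (apt k∈ j∈ kj) (apt l∈ i∈ li) (apt l∈ j∈ lj)

        tc1 : ∀ {k l i j} → k ∈ W → l ∈ W → i ∈ W → j ∈ W → k ≢ l → i ≢ j → Distinct2 k l i j →
          E (u k) (u l) ≢ E (w k) (w l) → E (u i) (u j) ≢ E (w i) (w j) → E (u k) (u l) ≡ true → E (u i) (u j) ≡ true → Res k l i j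
        tc1 k∈ l∈ i∈ j∈ kl ij dd d d' t t' with tco k∈ l∈ i∈ j∈ kl ij dd (mk⇒ k∈ l∈ kl d t) (mk⇒ i∈ j∈ ij d' t')
        ... | h , ch , a , b = h , ch , trans a (sym (¬t→f (λ q → d (trans t (sym q))))) , trans b (sym t')

        revE : ∀ {i j} {x y : J → ℕ} → x i ≢ x j → y i ≢ y j → E (x i) (x j) ≡ E (y i) (y j) → E (x j) (x i) ≡ E (y j) (y i)
        revE n m e = trans (flip n) (trans (cong not e) (sym (flip m)))

      two-pairs : ∀ {k l i j} → k ∈ W → l ∈ W → i ∈ W → j ∈ W → k ≢ l → i ≢ j → Distinct2 k l i j →
          E (u k) (u l) ≢ E (w k) (w l) → E (u i) (u j) ≢ E (w i) (w j) → Res k l i j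
      two-pairs {k} {l} {i} {j} k∈ l∈ i∈ j∈ kl ij (n1 , n2) d d' with bool-em (E (u k) (u l)) | bool-em (E (u i) (u j))
      ... | inj₁ t | inj₁ t' = tc1 k∈ l∈ i∈ j∈ kl ij (n1 , n2) d d' t t'
      ... | inj₂ f | inj₁ t' = let lk = λ e → kl (sym e) ; (h , ch , x , y) = tc1 l∈ k∈ i∈ j∈ lk ij ((λ (a , b) → n2 (b , a)) , (λ (a , b) → n1 (b , a)))
                                     (λ e → d (revE {l} {k} {u} {w} (iu l∈ k∈ lk) (iw l∈ k∈ lk) e)) d' (farc (iu k∈ l∈ kl) f) t' in
             h , ch , revE {l} {k} {λ z → h (u z) (w z)} {w} (strict2 ch (iu l∈ k∈ lk) (iw l∈ k∈ lk)) (iw l∈ k∈ lk) x , y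
      ... | inj₁ t | inj₂ f' = let ji = λ e → ij (sym e) ; (h , ch , x , y) = tc1 k∈ l∈ j∈ i∈ kl ji ((λ (a , b) → n2 (a , b)) , (λ (a , b) → n1 (a , b)))
                                     d (λ e → d' (revE {j} {i} {u} {w} (iu j∈ i∈ ji) (iw j∈ i∈ ji) e)) t (farc (iu i∈ j∈ ij) f') in
             h , ch , x , revE {j} {i} {λ z → h (u z) (w z)} {u} (strict2 ch (iu j∈ i∈ ji) (iw j∈ i∈ ji)) (iu j∈ i∈ ji) y
      ... | inj₂ f | inj₂ f' = let ji = λ e → ij (sym e) ; lk = λ e → kl (sym e) ; (h , ch , x , y) = tc1 l∈ k∈ j∈ i∈ lk ji ((λ (a , b) → n1 (b , a)) , (λ (a , b) → n2 (b , a)))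
                                     (λ e → d (revE {l} {k} {u} {w} (iu l∈ k∈ lk) (iw l∈ k∈ lk) e)) (λ e → d' (revE {j} {i} {u} {w} (iu j∈ i∈ ji) (iw j∈ i∈ ji) e)) (farc (iu k∈ l∈ kl) f) (farc (iu i∈ j∈ ij) f') in
             h , ch , revE {l} {k} {λ z → h (u z) (w z)} {w} (strict2 ch (iu l∈ k∈ lk) (iw l∈ k∈ lk)) (iw l∈ k∈ lk) x ,
               revE {j} {i} {λ z → h (u z) (w z)} {u} (strict2 ch (iu j∈ i∈ ji) (iw j∈ i∈ ji)) (iu j∈ i∈ ji) y

    opaque
      -- The second projection is right at the pair `k`, `l`. The other pairs are repaired one at a
      -- time by `two-pairs`, which keeps the arc at `k`, `l` and restores that of `u` at one pair;
      -- pairs already repaired stay so by unanimity with `u`.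
      flip-pair : ∀ {J : Set} (W : List J) (u v : J → ℕ) (iu : InjOn W u) (iv : InjOn W v) {k l : J} (k∈ : k ∈ W) (l∈ : l ∈ W) → k ≢ l →
        E (u k) (u l) ≢ E (v k) (v l) →
        Σ (ℕ → ℕ → ℕ) λ h → C2 h × (E (h (u k) (v k)) (h (u l) (v l)) ≡ E (v k) (v l)) ×
          (∀ {i j} → i ∈ W → j ∈ W → i ≢ j → Distinct2 k l i j → E (h (u i) (v i)) (h (u j) (v j)) ≡ E (u i) (u j))
      flip-pair {J} W u v iu iv {k} {l} k∈ l∈ kl d =
        let (h , ch , x , al) = go (dpairs W) (dpAll W (λ a b n → a , b , n)) in h , ch , x , λ a b n dd → All.lookup al (dp∈ a b n) dd
        where
        Ok : (ℕ → ℕ → ℕ) → J × J → Set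
        Ok h (i , j) = Distinct2 k l i j → E (h (u i) (v i)) (h (u j) (v j)) ≡ E (u i) (u j)
        go : ∀ ps → All (λ (i , j) → (i ∈ W) × (j ∈ W) × (i ≢ j)) ps → Σ (ℕ → ℕ → ℕ) λ h → C2 h × (E (h (u k) (v k)) (h (u l) (v l)) ≡ E (v k) (v l)) × All (Ok h) ps
        go [] [] = _ , π2 , refl , []
        go ((i , j) ∷ ps) ((i∈ , j∈ , ij) ∷ al) with go ps al
        ... | h , ch , x , ok with em {Distinct2 k l i j} | E (h (u i) (v i)) (h (u j) (v j)) ≟B E (u i) (u j)
        ... | no nd | _ = h , ch , x , (λ dd → ⊥-elim (nd dd)) ∷ ok
        ... | yes dd | yes e = h , ch , x , (λ _ → e) ∷ ok
        ... | yes dd | no ne with two-pairs W u w iu iw k∈ l∈ i∈ j∈ kl ij dd (λ q → d (trans q x)) (λ q → ne (sym q))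
          where
          w : J → ℕ
          w z = h (u z) (v z)
          iw : InjOn W w
          iw a b n = strict2 ch (iu a b n) (iv a b n)
        ... | g , cg , y1 , y2 = _ , c22 cg π1 ch , trans y1 x , (λ _ → y2) ∷
              All.zipWith (λ { {p , q} (o , (p∈ , q∈ , pq)) d' → unan2 cg (iu p∈ q∈ pq) (strict2 ch (iu p∈ q∈ pq) (iv p∈ q∈ pq)) (o d') }) (ok , al)

      -- Any tournament on W all of whose arcs are available separately is available.
      assemble : ∀ {J : Set} (W : List J) (R : (J → ℕ) → Set) → (∀ {h x y} → C2 h → R x → R y → R (λ i → h (x i) (y i))) →
        (Z : J → J → Bool) → (∀ {i j} → i ∈ W → j ∈ W → i ≢ j → Z j i ≡ not (Z i j)) →
        (x₀ : J → ℕ) → R x₀ → InjOn W x₀ →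
        (D : J → J → Set) → (∀ {i j} → D i j → D j i) →
        (∀ {i j} → i ∈ W → j ∈ W → i ≢ j → D i j → Σ (J → ℕ) λ x → R x × InjOn W x × (E (x i) (x j) ≡ Z i j)) →
        Σ (J → ℕ) λ t → R t × InjOn W t × (∀ {i j} → i ∈ W → j ∈ W → i ≢ j → D i j → E (t i) (t j) ≡ Z i j)
      assemble {J} W R clo Z odd x₀ r₀ i₀ D Dsym prov = let (t , rt , it , al) = go (dpairs W) (dpAll W (λ a b n → a , b , n)) in
          t , rt , it , λ a b n dd → All.lookup al (dp∈ a b n) dd
        where
        Ok : (J → ℕ) → J × J → Set
        Ok t (i , j) = D i j → E (t i) (t j) ≡ Z i j
        go : ∀ ps → All (λ (i , j) → (i ∈ W) × (j ∈ W) × (i ≢ j)) ps → Σ (J → ℕ) λ t → R t × InjOn W t × All (Ok t) ps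
        go [] [] = x₀ , r₀ , i₀ , []
        go ((k , l) ∷ ps) ((k∈ , l∈ , kl) ∷ al) with go ps al
        ... | t , rt , it , ok with em {D k l} | E (t k) (t l) ≟B Z k l
        ... | no nd | _ = t , rt , it , (λ dd → ⊥-elim (nd dd)) ∷ ok
        ... | yes dd | yes e = t , rt , it , (λ _ → e) ∷ ok
        ... | yes dd | no ne with prov k∈ l∈ kl dd
        ... | x , rx , ix , x≡ with flip-pair W t x it ix k∈ l∈ kl (λ q → ne (trans q x≡))
        ... | h , ch , hkl , hel = _ , clo ch rt rx , ih , (λ _ → e₀) ∷ All.zipWith (λ {p} → update {p}) (ok , al)
          where
          ih : InjOn W (λ i → h (t i) (x i))
          ih a b n = strict2 ch (it a b n) (ix a b n)
          e₀ : E (h (t k) (x k)) (h (t l) (x l)) ≡ Z k l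
          e₀ = trans hkl x≡
          update : ∀ {p} → Ok t p × ((proj₁ p ∈ W) × (proj₂ p ∈ W) × (proj₁ p ≢ proj₂ p)) → Ok (λ i → h (t i) (x i)) p
          update {i , j} (o , (i∈ , j∈ , ij)) d' with em {(k ≡ i) × (l ≡ j)}
          ... | yes (refl , refl) = e₀
          ... | no n1 with em {(k ≡ j) × (l ≡ i)}
          ... | yes (refl , refl) = trans (flip (ih k∈ l∈ kl)) (trans (cong not e₀) (sym (odd k∈ l∈ kl)))
          ... | no n2 = trans (hel i∈ j∈ ij (n1 , n2)) (o d')

-- Dominated injections and the orientation of ties.

module Dominance (cl : OpClone)
  (pres : PreservesArcs cl) where
  open ArcPreserving cl pres public
  open UniformCase cl pres public
  open NonUniformCase cl pres public

  strict3 : ∀ {h} → C3 h → ∀ {x y z x' y' z'} → x ≢ x' → y ≢ y' → z ≢ z' → h x y z ≢ h x' y' z'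
  strict3 (mk3 ch) {x} {y} {z} {x'} {y'} {z'} a b c = strict ch {three x y z} {three x' y' z'} (λ { zero → a ; (suc zero) → b ; (suc (suc zero)) → c })

  Loc : (Bool → Bool → Bool → Bool) → Set₁
  Loc μ = ∀ {J : Set} (W : List J) (u v w : J → ℕ) → InjOn W u → InjOn W v → InjOn W w →
    Σ (ℕ → ℕ → ℕ → ℕ) λ t → C3 t × (∀ {i j} → i ∈ W → j ∈ W → i ≢ j →
      E (t (u i) (v i) (w i)) (t (u j) (v j) (w j)) ≡ μ (E (u i) (u j)) (E (v i) (v j)) (E (w i) (w j)))

  ternary-loc : ∀ {μ} → Ternary μ → Loc μ
  ternary-loc (m , cm , s) W u v w iu iv iw = m , cm , λ a b n → s (iu a b n) (iv a b n) (iw a b n)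

  private
    nonuniform : ¬ Uniform → Σ (ℕ → ℕ → ℕ) λ h → C2 h × Σ Pt λ a → Σ Pt λ b → Σ Pt λ c → Σ Pt λ d →
      (a ⇒ b) × (c ⇒ d) × (out h a b ≡ true) × (out h c d ≡ false)
    nonuniform nu with em {Σ (ℕ → ℕ → ℕ) λ h → C2 h × Σ Pt λ a → Σ Pt λ b → Σ Pt λ c → Σ Pt λ d →
      (a ⇒ b) × (c ⇒ d) × (out h a b ≡ true) × (out h c d ≡ false)}
    ... | yes r = r
    ... | no nr = ⊥-elim (nu un)
      where
      un : Uniform
      un {h} ch with em {Σ Pt λ c → Σ Pt λ d → (c ⇒ d) × (out h c d ≡ false)}
      ... | no n = inj₁ (λ {x} {y} {x'} {y'} e e' → ¬f→t (λ o → n ((x , x') , (y , y') , (e , e') , o)))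
      ... | yes (c , d , cd , o) = inj₂ (λ {x} {y} {x'} {y'} e e' → farc (strict2 ch (arc≢ e) (λ q → arc≢ e' (sym q))) (¬t→f (λ o' →
          nr (h , ch , (x , x') , (y , y') , c , d , (e , e') , cd , o' , o))))

    fresh : (L : List Pt) → Σ Pt λ m → Σ Pt λ n → (m ⇒ n) × (∀ p → p ∈ L → Apart m p × Apart n p)
    fresh L with extL [] [] (map proj₁ L) | extL [] [] (map proj₂ L)
    ... | n1 , _ , a1 | n2 , _ , a2 with extL ((n1 , true) ∷ []) ([] ∷ []) (map proj₁ L) | extL ((n2 , false) ∷ []) ([] ∷ []) (map proj₂ L)
    ... | m1 , (_ , e1) ∷ [] , b1 | m2 , (k2 , e2) ∷ [] , b2 = (m1 , m2) , (n1 , n2) , (e1 , farc k2 e2) ,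
        λ p i → (b1 _ (∈-map⁺ proj₁ i) , b2 _ (∈-map⁺ proj₂ i)) , (a1 _ (∈-map⁺ proj₁ i) , a2 _ (∈-map⁺ proj₂ i))

    -- A fresh disagreement apart from all four points has one of the two outcomes and replaces the
    -- known witness of that outcome.
    generic : ¬ Uniform → Σ (ℕ → ℕ → ℕ) λ h → C2 h × Σ Pt λ a → Σ Pt λ b → Σ Pt λ c → Σ Pt λ d →
      (a ⇒ b) × (c ⇒ d) × (Apart a c × Apart a d × Apart b c × Apart b d) × (out h a b ≡ true) × (out h c d ≡ false)
    generic nu with nonuniform nu
    ... | h , ch , a , b , c , d , ab , cd , oab , ocd with fresh (a ∷ b ∷ c ∷ d ∷ [])
    ... | m , n , mn , ap with ap a (here refl) | ap b (there (here refl)) | ap c (there (there (here refl))) | ap d (there (there (there (here refl))))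
    ... | ma , na | mb , nb | mc , nc | md , nd with bool-em (out h m n)
    ... | inj₁ o = h , ch , m , n , c , d , mn , cd , (mc , md , nc , nd) , o , ocd
    ... | inj₂ o = h , ch , a , b , m , n , ab , mn , (ap-sym ma , ap-sym na , ap-sym mb , ap-sym nb) , oab , o

    maj-choice : ∀ a b c → (a ≡ maj3 a b c) ⊎ (b ≡ maj3 a b c) ⊎ (c ≡ maj3 a b c)
    maj-choice true true c = inj₁ refl
    maj-choice true false c = inj₂ (inj₂ refl)
    maj-choice false true c = inj₂ (inj₂ refl)
    maj-choice false false c = inj₁ refl

    maj-odd : ∀ a b c → maj3 (not a) (not b) (not c) ≡ not (maj3 a b c)
    maj-odd true true c = refl
    maj-odd true false c = refl
    maj-odd false true c = refl
    maj-odd false false c = refl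

  -- Each arc of the majority tournament is the arc of `u`, `v` or `w`, hence available separately.
  nonuniform-maj : ¬ Uniform → Loc maj3
  nonuniform-maj nu W u v w iu iv iw with generic nu
  ... | h₀ , ch₀ , a , b , c , d , ab , cd , (ac , ad , bc , bd) , oab , ocd
    with assemble ch₀ ab cd ac ad bc bd oab ocd W
      (λ x → Σ (ℕ → ℕ → ℕ → ℕ) λ t → C3 t × (∀ i → x i ≡ t (u i) (v i) (w i)))
      (λ { {h} ch (t , ct , et) (s , cs , es) → _ , c23 ch ct cs , λ i → cong₂ h (et i) (es i) })
      (λ i j → maj3 (E (u i) (u j)) (E (v i) (v j)) (E (w i) (w j)))
      (λ {i} {j} a b n → trans (cong₂ (λ (p , q) r → maj3 p q r) (cong₂ _,_ (flip (iu a b n)) (flip (iv a b n))) (flip (iw a b n))) (maj-odd (E (u i) (u j)) (E (v i) (v j)) (E (w i) (w j))))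
      -- Every pair is prescribed: `ℕ` only serves as an inhabited condition.
      u (_ , p1 , (λ i → refl)) iu (λ _ _ → Data.Nat.ℕ) (λ x → x)
      (λ {i} {j} a b n _ → prov a b n (maj-choice (E (u i) (u j)) (E (v i) (v j)) (E (w i) (w j))))
    where
    M : _ → _ → Bool
    M i j = maj3 (E (u i) (u j)) (E (v i) (v j)) (E (w i) (w j))
    prov : ∀ {i j} → i ∈ W → j ∈ W → i ≢ j → (E (u i) (u j) ≡ M i j) ⊎ (E (v i) (v j) ≡ M i j) ⊎ (E (w i) (w j) ≡ M i j) →
      Σ (_ → ℕ) λ x → (Σ (ℕ → ℕ → ℕ → ℕ) λ t → C3 t × (∀ i → x i ≡ t (u i) (v i) (w i))) × InjOn W x × (E (x i) (x j) ≡ M i j)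
    prov a b n (inj₁ e) = u , (_ , p1 , (λ i → refl)) , iu , e
    prov a b n (inj₂ (inj₁ e)) = v , (_ , p2 , (λ i → refl)) , iv , e
    prov a b n (inj₂ (inj₂ e)) = w , (_ , p3 , (λ i → refl)) , iw , e
  ... | x , (t , ct , et) , ix , al = t , ct , λ a b n → trans (cong₂ E (sym (et _)) (sym (et _))) (al a b n 0)

  private
    zsel : ∀ {A : Set} → Dec A → Bool → Bool → Bool
    zsel (yes _) a b = a
    zsel (no _) a b = b

    zno : ∀ {A : Set} (d : Dec A) {a b} → ¬ A → zsel d a b ≡ b
    zno (yes p) n = ⊥-elim (n p)
    zno (no _) n = refl

  -- The target has the arcs of `u` where `u` differs, each provided by `orient`. On ties the arcs
  -- of `i₀` merely complete it to a tournament and are not demanded.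
  fd-nonuniform : Essential → ¬ Uniform → FirstDominant
  fd-nonuniform ess nu W u v jn with generic nu
  ... | h₀ , ch₀ , a , b , c , d , ab , cd , (ac , ad , bc , bd) , oab , ocd with inject ess W u v jn
  ... | i₀ , ci , ii with assemble ch₀ ab cd ac ad bc bd oab ocd W
      (λ x → Σ (ℕ → ℕ → ℕ) λ t → C2 t × (∀ i → x i ≡ t (u i) (v i)))
      (λ { {h} ch (t , ct , et) (s , cs , es) → _ , c22 ch ct cs , λ i → cong₂ h (et i) (es i) })
      (λ i j → zsel (u i ≟ u j) (E (i₀ (u i) (v i)) (i₀ (u j) (v j))) (E (u i) (u j)))
      (λ {i} {j} a b n → odd a b n (u i ≟ u j) (u j ≟ u i))
      (λ i → i₀ (u i) (v i)) (_ , ci , (λ i → refl)) ii (λ i j → u i ≢ u j) (λ n e → n (sym e))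
      (λ {i} {j} a b n un → let (g , cg , ig , e) = orient ess W u v jn a b un in
         (λ i → g (u i) (v i)) , (g , cg , (λ i → refl)) , (λ a b n → ig a b n) , trans e (sym (zno (u i ≟ u j) un)))
    where
    odd : ∀ {i j} → i ∈ W → j ∈ W → i ≢ j → ∀ (p : Dec (u i ≡ u j)) (q : Dec (u j ≡ u i)) →
      zsel q (E (i₀ (u j) (v j)) (i₀ (u i) (v i))) (E (u j) (u i)) ≡ not (zsel p (E (i₀ (u i) (v i)) (i₀ (u j) (v j))) (E (u i) (u j)))
    odd a b n (yes _) (yes _) = flip (ii a b n)
    odd a b n (no m) (no _) = flip m
    odd a b n (yes p) (no q) = ⊥-elim (q (sym p))
    odd a b n (no p) (yes q) = ⊥-elim (p (sym q))
  ... | x , (t , ct , et) , ix , al = t , ct , (λ a b n → subst₂ _≢_ (et _) (et _) (ix a b n)) ,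
      λ {i} {j} a b un → trans (cong₂ E (sym (et _)) (sym (et _))) (trans (al a b (λ e → un (cong u e)) un) (zno (u i ≟ u j) un))

  AllFollow : Set
  AllFollow = ∀ {k} {f : Op k} → C f → Σ (Fin k) (Follows f)

  arc-cases : Essential → AllFollow ⊎ (FirstDominant × (Loc maj3 ⊎ Loc min3))
  arc-cases ess with em {Uniform}
  ... | no nu = inj₂ (fd-nonuniform ess nu , inj₁ (nonuniform-maj nu))
  ... | yes unif with uniform-cases unif
  ... | inj₁ f = inj₁ f
  ... | inj₂ (inj₁ t) = inj₂ (fd-uniform ess unif , inj₁ (ternary-loc {maj3} t))
  ... | inj₂ (inj₂ t) = inj₂ (fd-uniform ess unif , inj₂ (ternary-loc {min3} t))

  VInj : List Pt → Set
  VInj W = InjOn W proj₂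

  Fib : Pt → Pt → Set
  Fib p p' = (proj₁ p ≡ proj₁ p') × (E (proj₂ p) (proj₂ p') ≡ true)

  FDp : List Pt → (ℕ → ℕ → ℕ) → Set
  FDp W q = FD W proj₁ proj₂ q

  -- Ties are copied from the second coordinate when `ε` is false and reversed when it is true.
  LexOn : Bool → List Pt → Set
  LexOn ε W = Σ (ℕ → ℕ → ℕ) λ q → C2 q × FDp W q × (∀ {p p'} → p ∈ W → p' ∈ W → Fib p p' → out q p p' ≡ not ε)

  jpt : ∀ W → JInj W proj₁ proj₂
  jpt W {x , y} {x' , y'} _ _ n with x ≟ x'
  ... | no m = inj₁ m
  ... | yes refl = inj₂ (λ e → n (cong (x ,_) e))

  fib≢ : ∀ {p p'} → Fib p p' → p ≢ p'
  fib≢ (_ , e) refl = t≢f e (irrefl _)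

  FD-⊆ : ∀ {W W'} → (∀ {p} → p ∈ W → p ∈ W') → ∀ {q} → FDp W' q → FDp W q
  FD-⊆ s (i , d) = (λ a b n → i (s a) (s b) n) , (λ a b n → d (s a) (s b) n)

  move : (ℕ → ℕ) → (ℕ → ℕ) → Pt → Pt
  move g1 g2 p = g1 (proj₁ p) , g2 (proj₂ p)

  FD-move : ∀ {W g1 g2 q} → C1 g1 → C1 g2 → FDp (map (move g1 g2) W) q → FDp W (λ x y → q (g1 x) (g2 y))
  FD-move {W} {g1} {g2} {q} c1' c2' (i , d) = (λ {p} {p'} a b n → i (∈-map⁺ _ a) (∈-map⁺ _ b) (ne p p' n)) ,
      (λ {p} {p'} a b n → trans (d (∈-map⁺ (move g1 g2) a) (∈-map⁺ (move g1 g2) b) (inj1 c1' n)) (emb c1' _ _))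
    where
    ne : ∀ p p' → p ≢ p' → move g1 g2 p ≢ move g1 g2 p'
    ne p p' n e with jpt (p ∷ p' ∷ []) (here refl) (there (here refl)) n
    ... | inj₁ m = inj1 c1' m (cong proj₁ e)
    ... | inj₂ m = inj1 c2' m (cong proj₂ e)

  module MajLex (fd : FirstDominant) (lm : Loc maj3) where

    private
      KP : Set
      KP = ∀ (W : List Pt) → VInj W → ∀ {p p'} → p ∈ W → p' ∈ W → Fib p p' → Σ (ℕ → ℕ → ℕ) λ q → C2 q × FDp W q × (out q p p' ≡ true)

      NK : Set
      NK = Σ (List Pt) λ W → Σ Pt λ p → Σ Pt λ p' → (p ∈ W) × (p' ∈ W) × Fib p p' × (∀ q → C2 q → FDp W q → out q p p' ≡ false)

      -- Majority is applied to `q`, `r` and the second coordinate. Ties already treated are kept by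
      -- `q` and the coordinate, the new one by `r` and the coordinate; off ties `q` and `r` agree
      -- by dominance.
      kept : KP → ∀ W → VInj W → LexOn false W
      kept kp W vi = let (q , cq , f , al) = go (dpairs W) (dpAll W (λ a b n → a , b)) in q , cq , f , λ a b fb → All.lookup al (dp∈ a b (fib≢ fb)) fb
        where
        go : ∀ ps → All (λ (p , p') → (p ∈ W) × (p' ∈ W)) ps → Σ (ℕ → ℕ → ℕ) λ q → C2 q × FDp W q × All (λ (p , p') → Fib p p' → out q p p' ≡ true) ps
        go [] [] = let (q , cq , f) = fd W proj₁ proj₂ (jpt W) in q , cq , f , []
        go ((p , p') ∷ ps) ((p∈ , p'∈) ∷ al) with go ps al
        ... | q , cq , f , ok with em {Fib p p'}
        ... | no nf = q , cq , f , (λ fb → ⊥-elim (nf fb)) ∷ ok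
        ... | yes fb with kp W vi p∈ p'∈ fb
        ... | r , cr , fr , o with lm W (app q) (app r) proj₂ (proj₁ f) (proj₁ fr) vi
        ... | t , ct , mt = _ , c32 ct cq cr π2 , ((λ a b n → strict3 ct (proj₁ f a b n) (proj₁ fr a b n) (vi a b n)) , dom) ,
              (λ _ → trans (mt p∈ p'∈ (fib≢ fb)) (trans (cong₂ (maj3 (out q p p')) o (proj₂ fb)) (m1 (out q p p')))) ∷
              All.zipWith (λ { {x , x'} (ox , (x∈ , x'∈)) fx → trans (mt x∈ x'∈ (fib≢ fx)) (trans (cong₂ (λ a b → maj3 a (out r x x') b) (ox fx) (proj₂ fx)) (m2 _)) }) (ok , al)
          where
          m1 : ∀ a → maj3 a true true ≡ true
          m1 true = refl
          m1 false = refl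
          m2 : ∀ a → maj3 true a true ≡ true
          m2 true = refl
          m2 false = refl
          m3 : ∀ a b → maj3 a a b ≡ a
          m3 true b = refl
          m3 false b = refl
          dom : ∀ {x x'} → x ∈ W → x' ∈ W → proj₁ x ≢ proj₁ x' → E (t (app q x) (app r x) (proj₂ x)) (t (app q x') (app r x') (proj₂ x')) ≡ E (proj₁ x) (proj₁ x')
          dom {x} {x'} a b n = trans (mt a b (λ e → n (cong proj₁ e))) (trans (cong₂ (λ a b → maj3 a b (E (proj₂ x) (proj₂ x'))) (proj₂ f a b n) (proj₂ fr a b n)) (m3 _ _))

      -- A copy of the bad configuration is placed on every tie of `W`; an operation dominated on
      -- `W` and on all copies has to reverse every tie.
      reversed : NK → ∀ W → LexOn true W
      reversed (W₀ , p₀ , p₀' , p∈ , p'∈ , fb₀ , bad) W with go (dpairs W)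
        where
        go : ∀ ps → Σ (List Pt) λ L → ∀ q → C2 q → FDp L q → All (λ (p , p') → Fib p p' → out q p p' ≡ false) ps
        go [] = [] , λ _ _ _ → []
        go ((p , p') ∷ ps) with go ps | em {Fib p p'}
        ... | L , hl | no nf = L , λ q cq f → (λ fb → ⊥-elim (nf fb)) ∷ hl q cq f
        ... | L , hl | yes fb with homL ((proj₁ p₀ , proj₁ p) ∷ []) ([] ∷ [])
              | homL ((proj₂ p₀ , proj₂ p) ∷ (proj₂ p₀' , proj₂ p') ∷ []) ((se (arc≢ (proj₂ fb₀)) (arc≢ (proj₂ fb)) (trans (proj₂ fb₀) (sym (proj₂ fb))) ∷ []) ∷ [] ∷ [])
        ... | g1 , cg1 , e1 ∷ [] | g2 , cg2 , e2 ∷ e3 ∷ [] = map (move g1 g2) W₀ ++ L , λ q cq f →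
            (λ _ → trans (cong₂ E (cong₂ q (sym e1) (sym e2)) (cong₂ q (trans (sym (proj₁ fb)) (trans (sym e1) (cong g1 (proj₁ fb₀)))) (sym e3)))
               (bad _ (pre2 cq cg1 cg2) (FD-move cg1 cg2 (FD-⊆ {map (move g1 g2) W₀} {map (move g1 g2) W₀ ++ L} ∈-++⁺ˡ f)))) ∷
            hl q cq (FD-⊆ {L} {map (move g1 g2) W₀ ++ L} (∈-++⁺ʳ (map (move g1 g2) W₀)) f)
      ... | L , hl with fd (W ++ L) proj₁ proj₂ (jpt (W ++ L))
      ... | q , cq , f = q , cq , FD-⊆ {W} {W ++ L} ∈-++⁺ˡ f , λ a b fb → All.lookup (hl q cq (FD-⊆ {L} {W ++ L} (∈-++⁺ʳ W) f)) (dp∈ a b (fib≢ fb)) fb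

    maj-lex : Σ Bool λ ε → ∀ W → VInj W → LexOn ε W
    maj-lex with em {NK}
    ... | yes nk = true , λ W _ → reversed nk W
    ... | no n = false , kept (λ W vi {p} {p'} a b fb → kp W a b fb)
      where
      kp : ∀ W {p p'} → p ∈ W → p' ∈ W → Fib p p' → Σ (ℕ → ℕ → ℕ) λ q → C2 q × FDp W q × (out q p p' ≡ true)
      kp W {p} {p'} a b fb with em {Σ (ℕ → ℕ → ℕ) λ q → C2 q × FDp W q × (out q p p' ≡ true)}
      ... | yes r = r
      ... | no nr = ⊥-elim (n (W , p , p' , a , b , fb , λ q cq f → ¬t→f (λ o → nr (q , cq , f , o))))

bound : ∀ {A : Set} (f : A → ℕ) (xs : List A) → Σ ℕ λ N → ∀ x → x ∈ xs → f x < N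
bound f [] = 0 , λ _ ()
bound f (y ∷ xs) with bound f xs
... | N , h = suc (f y) ⊔ N , λ { x (here refl) → m≤m⊔n (suc (f y)) N ; x (there m) → ≤-trans (h x m) (m≤n⊔m (suc (f y)) N) }

allpairs-∈ : ∀ {A : Set} {R : A → A → Set} (xs : List A) → (∀ {x y} → x ∈ xs → y ∈ xs → R x y) → AllPairs R xs
allpairs-∈ [] h = []
allpairs-∈ (x ∷ xs) h = All.tabulate (λ m → h (here refl) (there m)) ∷ allpairs-∈ xs (λ a b → h (there a) (there b))

-- Orienting ties with minority.

module MinLex (cl : OpClone)
  (pres : PreservesArcs cl)
  (closed2 : ∀ (h : ℕ → ℕ → ℕ) → (∀ (L : List (ℕ × ℕ)) → Σ (ℕ → ℕ → ℕ) λ g → OpCloneProps.C2 cl g × (∀ x y → (x , y) ∈ L → g x y ≡ h x y)) → OpCloneProps.C2 cl h)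
  (fd : ArcPreserving.FirstDominant cl pres) (lm : Dominance.Loc cl pres min3) where
  open Dominance cl pres
  open Dense em tour ext

  min3-same : ∀ v a → min3 v a a ≡ v
  min3-same true true = refl
  min3-same true false = refl
  min3-same false true = refl
  min3-same false false = refl

  min3-aba : ∀ a b → min3 a b a ≡ b
  min3-aba true true = refl
  min3-aba true false = refl
  min3-aba false true = refl
  min3-aba false false = refl

  min3-aab : ∀ a b → min3 a a b ≡ b
  min3-aab true true = refl
  min3-aab true false = refl
  min3-aab false true = refl
  min3-aab false false = refl

  -- A dominant injection of the whole plane, as a limit of local ones.
  private
    bit : (ℕ → ℕ → ℕ) → ℕ → Bool
    bit q k = out q (pairs (proj₁ (pairs k))) (pairs (proj₂ (pairs k)))

    Loc' : ℕ → (ℕ → Bool) → List Pt → (ℕ → ℕ → ℕ) → Set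
    Loc' k b L q = C2 q × FDp L q × (∀ i → i < k → bit q i ≡ b i)

    Inv : ℕ → (ℕ → Bool) → Set
    Inv k b = ∀ L → Σ (ℕ → ℕ → ℕ) (Loc' k b L)

    ext-bit : ∀ k b c q → (∀ i → i < k → bit q i ≡ b i) → bit q k ≡ c → ∀ i → i < suc k → bit q i ≡ upd b k c i
    ext-bit k b c q h e i l with m≤n⇒m<n∨m≡n (m<1+n⇒m≤n l)
    ... | inj₁ l' = trans (h i l') (sym (upd-below b k c l'))
    ... | inj₂ refl = trans e (sym (upd-at b k c))

    -- If true is impossible as next bit on some `L₀`, then adding `L₀` to any finite set shows that
    -- false is possible there.
    step : ∀ k b → Inv k b → Σ Bool λ c → Inv (suc k) (upd b k c)
    step k b inv with em {Σ (List Pt) λ L → ∀ q → Loc' k b L q → bit q k ≢ true}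
    ... | yes (L₀ , h) = false , λ L → let (q , cq , f , e) = inv (L ++ L₀) in
           q , cq , FD-⊆ {L} {L ++ L₀} ∈-++⁺ˡ f , ext-bit k b false q e (¬t→f (h q (cq , FD-⊆ {L₀} {L ++ L₀} (∈-++⁺ʳ L) f , e)))
    ... | no n = true , λ L → go L
      where
      go : ∀ L → Σ (ℕ → ℕ → ℕ) (Loc' (suc k) (upd b k true) L)
      go L with em {Σ (ℕ → ℕ → ℕ) λ q → Loc' k b L q × (bit q k ≡ true)}
      ... | yes (q , (cq , f , e) , t) = q , cq , f , ext-bit k b true q e t
      ... | no nq = ⊥-elim (n (L , λ q lq t → nq (q , lq , t)))

    start : Inv 0 (λ _ → true)
    start L = let (q , cq , f) = fd L proj₁ proj₂ (jpt L) in q , cq , f , λ _ ()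

    open Choose Inv (λ _ → true) start step

    M : ℕ → ℕ → Bool
    M i j = limit (code (i , j))

    locM : (L : List Pt) (Is : List ℕ) → Σ (ℕ → ℕ → ℕ) λ q → C2 q × FDp L q × (∀ i j → i ∈ Is → j ∈ Is → out q (pairs i) (pairs j) ≡ M i j)
    locM L Is with bound (λ i → proj₁ (bound (λ j → code (i , j)) Is)) Is
    ... | N , h with limit-inv N
    ... | b , inv , ag' with inv L
    ... | q , cq , f , e = q , cq , f , λ i j i∈ j∈ →
        let l = ≤-trans (proj₂ (bound (λ j → code (i , j)) Is) j j∈) (≤-trans (Data.Nat.Properties.n≤1+n _) (h i i∈)) in
        trans (cong₂ (λ u v → out q (pairs u) (pairs v)) (sym (cong proj₁ (pairs-code (i , j)))) (sym (cong proj₂ (pairs-code (i , j)))))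
          (trans (e (code (i , j)) l) (ag' _ l))

    preM : PreTournament M
    preM = record
      { pirr = λ i → let (q , _ , _ , e) = locM [] (i ∷ []) in trans (sym (e i i (here refl) (here refl))) (irrefl _)
      ; pasym = λ i j t → let (q , _ , _ , e) = locM [] (i ∷ j ∷ []) in
          trans (sym (e j i (there (here refl)) (here refl))) (asym _ _ (trans (e i j (here refl) (there (here refl))) t))
      ; pcong = λ i j k a b → let (q , _ , _ , e) = locM [] (i ∷ j ∷ k ∷ [])
                                  i∈ = here refl ; j∈ = there (here refl) ; k∈ = there (there (here refl))
                                  q≡ = eqT (trans (e i j i∈ j∈) a) (trans (e j i j∈ i∈) b) in
          trans (sym (e i k i∈ k∈)) (trans (cong (λ z → E z (app q (pairs k))) q≡) (e j k j∈ k∈)) ,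
          trans (sym (e k i k∈ i∈)) (trans (cong (E (app q (pairs k))) q≡) (e k j k∈ j∈)) }

    φ∞ = realize M preM 0

  opaque
    q∞ : ℕ → ℕ → ℕ
    q∞ x y = proj₁ φ∞ (code (x , y))

    loc∞ : ∀ L → Σ (ℕ → ℕ → ℕ) λ q → C2 q × FDp L q × (∀ {p p'} → p ∈ L → p' ∈ L → out q∞ p p' ≡ out q p p')
    loc∞ L with locM L (map code L)
    ... | q , cq , f , e = q , cq , f , λ {p} {p'} a b → trans (proj₂ (proj₂ φ∞) (code p) (code p'))
        (trans (sym (e _ _ (∈-map⁺ code a) (∈-map⁺ code b))) (cong₂ (out q) (pairs-code p) (pairs-code p')))

    cq∞ : C2 q∞
    cq∞ = closed2 q∞ go
      where
      go : ∀ L → Σ (ℕ → ℕ → ℕ) λ g → C2 g × (∀ x y → (x , y) ∈ L → g x y ≡ q∞ x y)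
      go L with loc∞ L
      ... | q , cq , f , e with homL (map (λ p → app q p , app q∞ p) L) (AP-map (allpairs-∈ L (λ a b → sym (e a b) , sym (e b a))))
      ... | u , cu , h = _ , c12 cu cq , λ x y m → All.lookup (All-map⁻ h) m

    fd∞ : ∀ L → FDp L q∞
    fd∞ L with loc∞ L
    ... | q , cq , (i , d) , e = (λ a b n → se-≢ (sym (e a b) , sym (e b a)) (i a b n)) , (λ a b n → trans (e a b) (d a b n))

  D : ℕ → ℕ → ℕ → Bool
  D x y z = out q∞ (x , y) (x , z)

  -- A block of two tails and two heads over a point `x` which shows that the orientation `D x` of
  -- ties is not a function of the tail plus a function of the head.
  Odd : Set
  Odd = Σ ℕ λ x → Σ (Bool → ℕ) λ y → Σ (Bool → ℕ) λ z → (∀ i j → E (y i) (z j) ≡ true) ×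
    (min3 (D x (y false) (z false)) (D x (y false) (z true)) (D x (y true) (z false)) ≢ D x (y true) (z true))

  -- Four copies of a finite set, differing only in the second coordinates of p and p':
  -- in the sum of the four sign vectors only the pair p, p' survives.
  module SingleFlip (odd : Odd) where
    private
      x = proj₁ odd
      y = proj₁ (proj₂ odd)
      z = proj₁ (proj₂ (proj₂ odd))
      yz = proj₁ (proj₂ (proj₂ (proj₂ odd)))
      viol = proj₂ (proj₂ (proj₂ (proj₂ odd)))

      Twin : ℕ → ℕ → ℕ × ℕ → Set
      Twin p p' (w , w*) = (w ≢ p) × (w ≢ p') × (∀ i → SE w p w* (y i)) × (∀ j → SE w p' w* (z j))

      opaque
        -- The replacement of `w` sees both points `y` as `w` sees `p`, and both points `z` as `w`
        -- sees `p'`; so the four maps can share it.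
        twins : ∀ p p' (ws : List ℕ) → All (λ w → (w ≢ p) × (w ≢ p')) ws →
          Σ (List (ℕ × ℕ)) λ ps → AllPairs SEp ps × All (Twin p p') ps × (∀ w → w ∈ ws → Σ ℕ λ w* → (w , w*) ∈ ps)
        twins p p' [] [] = [] , [] , [] , λ _ ()
        twins p p' (w ∷ ws) ((np , np') ∷ al) with twins p p' ws al
        ... | ps , ap , tw , cov with em {Σ ℕ λ w* → (w , w*) ∈ ps}
        ... | yes (w* , m) = ps , ap , tw , λ { v (here refl) → w* , m ; v (there k) → cov v k }
        ... | no new with extL ((y false , E w p) ∷ (y true , E w p) ∷ (z false , E w p') ∷ (z true , E w p') ∷ map (λ (v , v*) → v* , E w v) ps)
               (((λ _ → refl) ∷ ag (arc≢ (yz false false)) ∷ ag (arc≢ (yz false true)) ∷ All-map (All.map (λ t → ag (λ e → ny t false (sym e))) tw)) ∷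
                (ag (arc≢ (yz true false)) ∷ ag (arc≢ (yz true true)) ∷ All-map (All.map (λ t → ag (λ e → ny t true (sym e))) tw)) ∷
                ((λ _ → refl) ∷ All-map (All.map (λ t → ag (λ e → nz t false (sym e))) tw)) ∷
                All-map (All.map (λ t → ag (λ e → nz t true (sym e))) tw) ∷
                AP-map (AllPairs.map (λ s e → cong (E w) (se-≡ (sym-se s) e)) ap)) []
          where
          ny : ∀ {v} → Twin p p' v → ∀ i → proj₂ v ≢ y i
          ny (a , _ , s , _) i = se-≢ (s i) a
          nz : ∀ {v} → Twin p p' v → ∀ i → proj₂ v ≢ z i
          nz (_ , a , _ , s) i = se-≢ (s i) a
        ... | w* , (n1 , e1) ∷ (n2 , e2) ∷ (n3 , e3) ∷ (n4 , e4) ∷ hs , _ =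
            (w , w*) ∷ ps , All.tabulate (λ {v} m → let (n , e) = All.lookup (All-map⁻ hs) m in se (λ q → new (proj₂ v , subst (λ r → (r , proj₂ v) ∈ ps) (sym q) m)) n (sym e)) ∷ ap ,
            (np , np' , (λ { false → se np n1 (sym e1) ; true → se np n2 (sym e2) }) , (λ { false → se np' n3 (sym e3) ; true → se np' n4 (sym e4) })) ∷ tw ,
            λ { v (here refl) → w* , here refl ; v (there k) → let (u , m) = cov v k in u , there m }

    module _ (W : List Pt) (vi : VInj W) {p p' : Pt} (p∈ : p ∈ W) (p'∈ : p' ∈ W) (fb : Fib p p') where
      private
        oth : List Pt
        oth = filter (λ r → em {(r ≢ p) × (r ≢ p')}) W

        othm : ∀ {r} → r ∈ oth → (r ∈ W) × (r ≢ p) × (r ≢ p')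
        othm m = ∈-filter⁻ (λ r → em {(r ≢ p) × (r ≢ p')}) {xs = W} m

        T = twins (proj₂ p) (proj₂ p') (map proj₂ oth) (All-map (All.tabulate (λ m → let (a , b , c) = othm m in vi a p∈ b , vi a p'∈ c)))
        ps = proj₁ T

        g1 : Σ (ℕ → ℕ) λ u → C1 u × All (λ p → u (proj₁ p) ≡ proj₂ p) ((proj₁ p , x) ∷ [])
        g1 = homL ((proj₁ p , x) ∷ []) ([] ∷ [])

        g2 : ∀ i j → Σ (ℕ → ℕ) λ u → C1 u × All (λ p → u (proj₁ p) ≡ proj₂ p) ((proj₂ p , y i) ∷ (proj₂ p' , z j) ∷ ps)
        g2 i j = homL ((proj₂ p , y i) ∷ (proj₂ p' , z j) ∷ ps)
          ((se (arc≢ (proj₂ fb)) (arc≢ (yz i j)) (trans (proj₂ fb) (sym (yz i j))) ∷ All.map (λ t → sw-se (proj₁ (proj₂ (proj₂ t)) i)) (proj₁ (proj₂ (proj₂ T)))) ∷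
           All.map (λ t → sw-se (proj₂ (proj₂ (proj₂ t)) j)) (proj₁ (proj₂ (proj₂ T))) ∷ proj₁ (proj₂ T))

        qq : Bool → Bool → ℕ → ℕ → ℕ
        qq i j a b = q∞ (proj₁ g1 a) (proj₁ (g2 i j) b)

        cqq : ∀ i j → C2 (qq i j)
        cqq i j = pre2 cq∞ (proj₁ (proj₂ g1)) (proj₁ (proj₂ (g2 i j)))

        fqq : ∀ i j → FDp W (qq i j)
        fqq i j = FD-move (proj₁ (proj₂ g1)) (proj₁ (proj₂ (g2 i j))) (fd∞ (map (move (proj₁ g1) (proj₁ (g2 i j))) W))

        data Role (r : Pt) : Set where
          isp : r ≡ p → (∀ i j → app (qq i j) r ≡ q∞ x (y i)) → Role r
          isp' : r ≡ p' → (∀ i j → app (qq i j) r ≡ q∞ x (z j)) → Role r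
          other : (c : ℕ) → (∀ i j → app (qq i j) r ≡ c) → Role r

        role : ∀ r → r ∈ W → Role r
        role r m with em {r ≡ p} | em {r ≡ p'}
        ... | yes refl | _ = isp refl (λ i j → cong₂ q∞ (All.lookup (proj₂ (proj₂ g1)) (here refl)) (All.lookup (proj₂ (proj₂ (g2 i j))) (here refl)))
        ... | no _ | yes refl = isp' refl (λ i j → cong₂ q∞ (trans (cong (proj₁ g1) (sym (proj₁ fb))) (All.lookup (proj₂ (proj₂ g1)) (here refl))) (All.lookup (proj₂ (proj₂ (g2 i j))) (there (here refl))))
        ... | no a | no b with proj₂ (proj₂ (proj₂ T)) (proj₂ r) (∈-map⁺ proj₂ (∈-filter⁺ (λ r → em {(r ≢ p) × (r ≢ p')}) m (a , b)))
        ... | w* , m* = other (q∞ (proj₁ g1 (proj₁ r)) w*) (λ i j → cong (q∞ (proj₁ g1 (proj₁ r))) (All.lookup (proj₂ (proj₂ (g2 i j))) (there (there m*))))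

        tri = lm W (app (qq false false)) (app (qq false true)) (app (qq true false)) (proj₁ (fqq false false)) (proj₁ (fqq false true)) (proj₁ (fqq true false))
        t = proj₁ tri

        oo : Bool → Bool → Pt → Pt → Bool
        oo i j = out (qq i j)

        -- A pair with `p` depends on `i` only, one with `p'` on `j` only, the others on neither. In
        -- each case two of the three summands cancel and the third is the fourth value.
        cmp : ∀ {r r'} → r ≢ r' → Role r → Role r' → ¬ ((r ≡ p) × (r' ≡ p')) → ¬ ((r ≡ p') × (r' ≡ p)) →
          min3 (oo false false r r') (oo false true r r') (oo true false r r') ≡ oo true true r r'
        cmp n (isp refl _) (isp refl _) _ _ = ⊥-elim (n refl)
        cmp n (isp e _) (isp' e' _) k _ = ⊥-elim (k (e , e'))
        cmp n (isp' e _) (isp e' _) _ k = ⊥-elim (k (e , e'))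
        cmp n (isp' refl _) (isp' refl _) _ _ = ⊥-elim (n refl)
        cmp n (isp _ f) (other c h) _ _ = trans (cong₂ (λ (a , b) d → min3 a b d) (cong₂ _,_ (cong₂ E (f false false) (h false false)) (cong₂ E (f false true) (h false true))) (cong₂ E (f true false) (h true false)))
          (trans (min3-aab (E (q∞ x (y false)) c) (E (q∞ x (y true)) c)) (sym (cong₂ E (f true true) (h true true))))
        cmp n (other c h) (isp _ f) _ _ = trans (cong₂ (λ (a , b) d → min3 a b d) (cong₂ _,_ (cong₂ E (h false false) (f false false)) (cong₂ E (h false true) (f false true))) (cong₂ E (h true false) (f true false)))
          (trans (min3-aab (E c (q∞ x (y false))) (E c (q∞ x (y true)))) (sym (cong₂ E (h true true) (f true true))))
        cmp n (isp' _ f) (other c h) _ _ = trans (cong₂ (λ (a , b) d → min3 a b d) (cong₂ _,_ (cong₂ E (f false false) (h false false)) (cong₂ E (f false true) (h false true))) (cong₂ E (f true false) (h true false)))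
          (trans (min3-aba (E (q∞ x (z false)) c) (E (q∞ x (z true)) c)) (sym (cong₂ E (f true true) (h true true))))
        cmp n (other c h) (isp' _ f) _ _ = trans (cong₂ (λ (a , b) d → min3 a b d) (cong₂ _,_ (cong₂ E (h false false) (f false false)) (cong₂ E (h false true) (f false true))) (cong₂ E (h true false) (f true false)))
          (trans (min3-aba (E c (q∞ x (z false))) (E c (q∞ x (z true)))) (sym (cong₂ E (h true true) (f true true))))
        cmp n (other c h) (other d f) _ _ = trans (cong₂ (λ (a , b) d → min3 a b d) (cong₂ _,_ (cong₂ E (h false false) (f false false)) (cong₂ E (h false true) (f false true))) (cong₂ E (h true false) (f true false)))
          (trans (min3-aab (E c d) (E c d)) (sym (cong₂ E (h true true) (f true true))))

      Diff : (ℕ → ℕ → ℕ) → (ℕ → ℕ → ℕ) → Set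
      Diff q₁ q₂ = C2 q₁ × C2 q₂ × FDp W q₁ × FDp W q₂ × (out q₁ p p' ≢ out q₂ p p') ×
        (∀ {r r'} → r ∈ W → r' ∈ W → r ≢ r' → ¬ ((r ≡ p) × (r' ≡ p')) → ¬ ((r ≡ p') × (r' ≡ p)) → out q₁ r r' ≡ out q₂ r r')

      opaque
        single : Σ (ℕ → ℕ → ℕ) λ q₁ → Σ (ℕ → ℕ → ℕ) λ q₂ → Diff q₁ q₂
        single = _ , qq true true , c32 (proj₁ (proj₂ tri)) (cqq false false) (cqq false true) (cqq true false) , cqq true true ,
          ((λ a b n → strict3 (proj₁ (proj₂ tri)) (proj₁ (fqq false false) a b n) (proj₁ (fqq false true) a b n) (proj₁ (fqq true false) a b n)) ,
           (λ {r} {r'} a b n → trans (proj₂ (proj₂ tri) a b (λ e → n (cong proj₁ e)))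
             (trans (cong₂ (λ (a , b) d → min3 a b d) (cong₂ _,_ (proj₂ (fqq false false) a b n) (proj₂ (fqq false true) a b n)) (proj₂ (fqq true false) a b n)) (min3-same (E (proj₁ r) (proj₁ r')) (E (proj₁ r) (proj₁ r')))))) ,
          fqq true true , atp , λ {r} {r'} a b n k l → trans (proj₂ (proj₂ tri) a b n) (cmp n (role r a) (role r' b) k l)
          where
          np : p ≢ p'
          np = fib≢ fb
          vp : ∀ i j → app (qq i j) p ≡ q∞ x (y i)
          vp i j = cong₂ q∞ (All.lookup (proj₂ (proj₂ g1)) (here refl)) (All.lookup (proj₂ (proj₂ (g2 i j))) (here refl))
          vp' : ∀ i j → app (qq i j) p' ≡ q∞ x (z j)
          vp' i j = cong₂ q∞ (trans (cong (proj₁ g1) (sym (proj₁ fb))) (All.lookup (proj₂ (proj₂ g1)) (here refl))) (All.lookup (proj₂ (proj₂ (g2 i j))) (there (here refl)))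
          vo : ∀ i j → oo i j p p' ≡ D x (y i) (z j)
          vo i j = cong₂ E (vp i j) (vp' i j)
          atp : E (t (app (qq false false) p) (app (qq false true) p) (app (qq true false) p)) (t (app (qq false false) p') (app (qq false true) p') (app (qq true false) p')) ≢ oo true true p p'
          atp e = viol (trans (sym (trans (proj₂ (proj₂ tri) p∈ p'∈ np) (cong₂ (λ (a , b) d → min3 a b d) (cong₂ _,_ (vo false false) (vo false true)) (vo true false)))) (trans e (vo true true)))

    -- Adding `q₁` and `q₂`, which differ only at one tie, to `q` by minority flips exactly this
    -- tie, so wrong ties are corrected one at a time.
    all-kept : ∀ W → VInj W → LexOn false W
    all-kept W vi = let (q , cq , f , al) = go (dpairs W) (dpAll W (λ a b n → a , b , n)) in q , cq , f , λ a b fb → All.lookup al (dp∈ a b (fib≢ fb)) fb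
      where
      go : ∀ ps → All (λ (p , p') → (p ∈ W) × (p' ∈ W) × (p ≢ p')) ps → Σ (ℕ → ℕ → ℕ) λ q → C2 q × FDp W q × All (λ (p , p') → Fib p p' → out q p p' ≡ true) ps
      go [] [] = q∞ , cq∞ , fd∞ W , []
      go ((p , p') ∷ ps) ((p∈ , p'∈ , pn) ∷ al) with go ps al
      ... | q , cq , f , ok with em {Fib p p'} | bool-em (out q p p')
      ... | no nf | _ = q , cq , f , (λ fb → ⊥-elim (nf fb)) ∷ ok
      ... | yes fb | inj₁ t = q , cq , f , (λ _ → t) ∷ ok
      ... | yes fb | inj₂ o with single W vi p∈ p'∈ fb
      ... | q₁ , q₂ , c₁ , c₂ , f₁ , f₂ , df , sm with lm W (app q) (app q₁) (app q₂) (proj₁ f) (proj₁ f₁) (proj₁ f₂)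
      ... | t , ct , mt = _ , c32 ct cq c₁ c₂ , ((λ a b n → strict3 ct (proj₁ f a b n) (proj₁ f₁ a b n) (proj₁ f₂ a b n)) ,
             (λ {r} {r'} a b n → trans (mt a b (λ e → n (cong proj₁ e))) (trans (cong₂ (λ (a , b) d → min3 a b d) (cong₂ _,_ (proj₂ f a b n) (proj₂ f₁ a b n)) (proj₂ f₂ a b n)) (min3-same (E (proj₁ r) (proj₁ r')) (E (proj₁ r) (proj₁ r')))))) ,
             (λ _ → atp) ∷ All.zipWith (λ {r} → upd' {r}) (ok , al)
        where
        flp : ∀ a b c → a ≡ false → b ≢ c → min3 a b c ≡ true
        flp _ true true refl n = ⊥-elim (n refl)
        flp _ true false refl n = refl
        flp _ false true refl n = refl
        flp _ false false refl n = ⊥-elim (n refl)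
        nq : Pt → ℕ
        nq r = t (app q r) (app q₁ r) (app q₂ r)
        atp : E (nq p) (nq p') ≡ true
        atp = trans (mt p∈ p'∈ pn) (flp (out q p p') (out q₁ p p') (out q₂ p p') o df)
        upd' : ∀ {r} → (Fib (proj₁ r) (proj₂ r) → out q (proj₁ r) (proj₂ r) ≡ true) × ((proj₁ r ∈ W) × (proj₂ r ∈ W) × (proj₁ r ≢ proj₂ r)) →
          Fib (proj₁ r) (proj₂ r) → E (nq (proj₁ r)) (nq (proj₂ r)) ≡ true
        upd' {r , r'} (o' , r∈ , r'∈ , rn) fr with em {(r ≡ p) × (r' ≡ p')}
        ... | yes (refl , refl) = atp
        ... | no k = trans (mt r∈ r'∈ rn) (trans (cong (min3 (out q r r') (out q₁ r r')) (sym (sm r∈ r'∈ rn k l))) (trans (min3-same (out q r r') (out q₁ r r')) (o' fr)))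
          where
          l : ¬ ((r ≡ p') × (r' ≡ p))
          l (refl , refl) = t≢f (proj₂ fr) (asym _ _ (proj₂ fb))

  -- Otherwise D x y z = ρ y + σ z on arcs, and a dense colour (ρ,σ) makes it constant.
  module Constant (even : ¬ Odd) where
    private
      b₀ a₀ : ℕ
      b₀ = 0
      a₀ = proj₁ (ext (b₀ ∷ []) (λ _ → true))
      ab : E a₀ b₀ ≡ true
      ab = proj₂ (proj₂ (ext (b₀ ∷ []) (λ _ → true)) b₀ (here refl))

      -- It describes the points between `a₀` and `b₀`. For such `y` and `z` with an arc from `y` to
      -- `z`, the tails `a₀`, `y` and heads `b₀`, `z` form a block to which additivity applies.
      K₀ : Cond
      K₀ = a₀ ∷ b₀ ∷ [] , λ x → decide (x ≡ b₀)

      k₀a : ∀ {y} → Meets K₀ y → E a₀ y ≡ true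
      k₀a m = let (n , e) = m a₀ (here refl) in farc n (trans e (decide-no (arc≢ ab)))

      k₀b : ∀ {y} → Meets K₀ y → E y b₀ ≡ true
      k₀b m = let (n , e) = m b₀ (there (here refl)) in trans e (decide-yes refl)

      Col : ℕ → Bool → Bool → ℕ → Set
      Col x r s y = (⊤ × (D x y b₀ ≡ r)) × (D x a₀ y ≡ s)

      value : ∀ {x y z r s} → Meets K₀ y → Meets K₀ z → E y z ≡ true → Col x r s y → Col x r s z → D x y z ≡ min3 r s (D x a₀ b₀)
      value {x} {y} {z} {r} {s} my mz e (( _ , ry) , sy) ((_ , rz) , sz) with D x y z ≟B min3 r s (D x a₀ b₀)
      ... | yes q = q
      ... | no n = ⊥-elim (even (x , (λ b → if b then y else a₀) , (λ b → if b then z else b₀) , arcs ,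
          λ q → n (trans (sym q) (trans (cong₂ (λ u v → min3 (D x a₀ b₀) u v) sz ry) (perm (D x a₀ b₀) s r)))))
        where
        arcs : ∀ i j → E (if i then y else a₀) (if j then z else b₀) ≡ true
        arcs true true = e
        arcs true false = k₀b my
        arcs false true = k₀a mz
        arcs false false = ab
        perm : ∀ d s r → min3 d s r ≡ min3 r s d
        perm true true true = refl
        perm true true false = refl
        perm true false true = refl
        perm true false false = refl
        perm false true true = refl
        perm false true false = refl
        perm false false true = refl
        perm false false false = refl

      KD : Bool → ℕ → Cond → Set
      KD κ x K = Σ Bool λ r → Σ Bool λ s → (min3 r s (D x a₀ b₀) ≡ κ) × Dense (Col x r s) K

      S : Bool → ℕ → Cond → Set
      S κ x K = Σ Cond λ K' → (K' ⊒ K) × KD κ x K'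

      colour : ∀ x K → S true x K ⊎ S false x K
      colour x K with dense-split (dense-all K) (λ y → D x y b₀)
      ... | K₁ , l₁ , r , d₁ with dense-split d₁ (λ y → D x a₀ y)
      ... | K₂ , l₂ , s , d₂ with bool-em (min3 r s (D x a₀ b₀))
      ... | inj₁ e = inj₁ (K₂ , ⊒-trans {K'' = K₂} l₂ l₁ , r , s , e , d₂)
      ... | inj₂ e = inj₂ (K₂ , ⊒-trans {K'' = K₂} l₂ l₁ , r , s , e , d₂)

      Pick : Bool → Cond → Cond → Set
      Pick κ L₀ K₁ = ∀ L K → L ⊒ L₀ → K ⊒ K₁ → Σ ℕ λ x → Meets L x × S κ x K

      opaque
        -- If some conditions exclude parity false for all rows below them, parity true occurs
        -- everywhere below; otherwise parity false can always be met by a suitable row.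
        pick : Σ Bool λ κ → Σ Cond λ L₀ → Σ Cond λ K₁ → (K₁ ⊒ K₀) × Pick κ L₀ K₁
        pick with em {Σ Cond λ L → Σ Cond λ K → (K ⊒ K₀) × (∀ x → Meets L x → ¬ S false x K)}
        ... | yes (L₀ , K₁ , le , h) = true , L₀ , K₁ , le , λ L K ll lk → let (x , m) = ext (proj₁ L) (proj₂ L) in x , m , go x (sat-⊒ {z = x} ll m) K lk
          where
          go : ∀ x → Meets L₀ x → ∀ K → K ⊒ K₁ → S true x K
          go x m K lk with colour x K
          ... | inj₁ s = s
          ... | inj₂ (K' , l , kd) = ⊥-elim (h x m (K' , ⊒-trans {K'' = K'} l lk , kd))
        ... | no n = false , ([] , λ _ → true) , K₀ , ⊒-refl {K₀} , λ L K ll lk → go L K lk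
          where
          go : ∀ L K → K ⊒ K₀ → Σ ℕ λ x → Meets L x × S false x K
          go L K lk with em {Σ ℕ λ x → Meets L x × S false x K}
          ... | yes r = r
          ... | no nr = ⊥-elim (n (L , K , lk , λ x m s → nr (x , m , s)))

      κ = proj₁ pick
      L₀ = proj₁ (proj₂ pick)
      K₁ = proj₁ (proj₂ (proj₂ pick))

      opaque
        -- First coordinates are chosen one at a time while the condition on columns is
        -- strengthened; the colours found dense for earlier rows remain dense.
        rows : (xs : List ℕ) → Σ (List (ℕ × ℕ)) λ ps → Σ Cond λ K → AllPairs SEp ps × (K ⊒ K₁) ×
          All (λ v → Meets L₀ (proj₂ v) × KD κ (proj₂ v) K) ps × (∀ x → x ∈ xs → Σ ℕ λ x̂ → (x , x̂) ∈ ps)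
        rows [] = [] , K₁ , [] , ⊒-refl {K₁} , [] , λ _ ()
        rows (x ∷ xs) with rows xs
        ... | ps , K , ap , le , al , cov with em {Σ ℕ λ x̂ → (x , x̂) ∈ ps}
        ... | yes (x̂ , m) = ps , K , ap , le , al , λ { v (here refl) → x̂ , m ; v (there k) → cov v k }
        ... | no new with addC L₀ (map (λ (v , v̂) → v̂ , E x v) ps) (All-map (All.map (λ { {v , v̂} (m , _) k → proj₁ (m v̂ k) refl }) al))
                      (AP-map (AllPairs.map (λ s e → cong (E x) (se-≡ (sym-se s) e)) ap))
        ... | L , ll , hits with proj₂ (proj₂ (proj₂ (proj₂ pick))) L K ll le
        ... | x̂ , mx , K' , lk , kd = (x , x̂) ∷ ps , K' ,
              All.tabulate (λ {v} m → let (n , e) = All.lookup (All-map⁻ (hits x̂ mx)) m in se (λ q → new (proj₂ v , subst (λ r → (r , proj₂ v) ∈ ps) (sym q) m)) n (sym e)) ∷ ap ,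
              ⊒-trans {K'' = K'} lk le ,
              (sat-⊒ {z = x̂} ll mx , kd) ∷ All.map (λ { (m , r , s , e , d) → m , r , s , e , dense-⊒ {X = Col _ r s} lk d }) al ,
              λ { v (here refl) → x̂ , here refl ; v (there k) → let (u , m) = cov v k in u , there m }

      opaque
        -- One colour is fixed for each row, so that both ends of a tie use the same one.
        rs : ℕ → Cond → Bool × Bool
        rs x K with em {KD κ x K}
        ... | yes (r , s , _) = r , s
        ... | no _ = true , true

        rs-spec : ∀ {x K} → KD κ x K → (min3 (proj₁ (rs x K)) (proj₂ (rs x K)) (D x a₀ b₀) ≡ κ) × Dense (Col x (proj₁ (rs x K)) (proj₂ (rs x K))) K
        rs-spec {x} {K} kd with em {KD κ x K}
        ... | yes (r , s , e , d) = e , d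
        ... | no n = ⊥-elim (n kd)

      module _ (K : Cond) (g : ℕ → ℕ) (W : List Pt) (vi : VInj W) (kd : ∀ {r} → r ∈ W → KD κ (g (proj₁ r)) K) where
        Coloured : Pt → ℕ → Set
        Coloured r ŷ = let (a , b) = rs (g (proj₁ r)) K in Col (g (proj₁ r)) a b ŷ

        opaque
          columns : ∀ V → (∀ {r} → r ∈ V → r ∈ W) → Σ (List (ℕ × ℕ)) λ ps → AllPairs SEp ps × All (λ v → Meets K (proj₂ v)) ps ×
            (∀ {r} → r ∈ V → Σ ℕ λ ŷ → ((proj₂ r , ŷ) ∈ ps) × Coloured r ŷ) ×
            (∀ y ŷ → (y , ŷ) ∈ ps → Σ Pt λ r → (r ∈ V) × (proj₂ r ≡ y) × Coloured r ŷ)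
          columns [] sub = [] , [] , [] , (λ ()) , (λ _ _ ())
          columns (r ∷ V) sub with columns V (λ m → sub (there m))
          ... | ps , ap , al , cov , back with em {Σ ℕ λ ŷ → (proj₂ r , ŷ) ∈ ps}
          ... | yes (ŷ , m) = ps , ap , al , (λ { (here refl) → old ; (there k) → cov k }) , λ y ŷ m → let (r , k , e) = back y ŷ m in r , there k , e
            where
            -- Second coordinates are injective on `W`, so each column belongs to one point and has
            -- to meet the colour of one row only.
            old : Σ ℕ λ ŷ → ((proj₂ r , ŷ) ∈ ps) × Coloured r ŷ
            old with back (proj₂ r) ŷ m
            ... | r' , k , e , c with em {r' ≡ r}
            ... | yes refl = ŷ , m , c
            ... | no ne = ⊥-elim (vi (sub (there k)) (sub (here refl)) ne e)
          ... | no new with dense-hit (proj₂ (rs-spec (kd (sub (here refl))))) (map (λ (v , v̂) → v̂ , E (proj₂ r) v) ps)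
                (All-map (All.map (λ { {v , v̂} m k → proj₁ (m v̂ k) refl }) al)) (AP-map (AllPairs.map (λ s e → cong (E (proj₂ r)) (se-≡ (sym-se s) e)) ap))
          ... | ŷ , c , mt , hits = (proj₂ r , ŷ) ∷ ps ,
               All.tabulate (λ {v} m → let (n , e) = All.lookup (All-map⁻ hits) m in se (λ q → new (proj₂ v , subst (λ s → (s , proj₂ v) ∈ ps) (sym q) m)) n (sym e)) ∷ ap ,
               mt ∷ al , (λ { (here refl) → ŷ , here refl , c ; (there k) → let (u , m , c') = cov k in u , there m , c' }) ,
               λ { y u (here refl) → r , here refl , refl , c ; y u (there m) → let (r' , k , e) = back y u m in r' , there k , e }

    constant : Σ Bool λ ε → ∀ W → VInj W → LexOn ε W
    constant = not κ , go
      where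
      go : ∀ W → VInj W → LexOn (not κ) W
      go W vi = _ , pre2 cq∞ cg1 cg2 , FD-move cg1 cg2 (fd∞ (map (move g1 g2) W)) , (λ {p} {p'} a b fb → fin p p' a b fb)
        where
        R = rows (map proj₁ W)
        K = proj₁ (proj₂ R)
        le : K ⊒ K₁
        le = proj₁ (proj₂ (proj₂ (proj₂ R)))
        al = proj₁ (proj₂ (proj₂ (proj₂ (proj₂ R))))
        cov = proj₂ (proj₂ (proj₂ (proj₂ (proj₂ R))))
        H1 = homL (proj₁ R) (proj₁ (proj₂ (proj₂ R)))
        g1 = proj₁ H1
        cg1 : C1 g1
        cg1 = proj₁ (proj₂ H1)
        kd : ∀ {r} → r ∈ W → KD κ (g1 (proj₁ r)) K
        kd {r} m = let (x̂ , k) = cov (proj₁ r) (∈-map⁺ proj₁ m) in subst (λ u → KD κ u K) (sym (All.lookup (proj₂ (proj₂ H1)) k)) (proj₂ (All.lookup al k))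
        Q = columns K g1 W vi kd W (λ m → m)
        mq = proj₁ (proj₂ (proj₂ Q))
        cv : ∀ {r} → r ∈ W → Σ ℕ λ ŷ → ((proj₂ r , ŷ) ∈ proj₁ Q) × Coloured K g1 W vi kd r ŷ
        cv = proj₁ (proj₂ (proj₂ (proj₂ Q)))
        H2 = homL (proj₁ Q) (proj₁ (proj₂ Q))
        g2 = proj₁ H2
        cg2 : C1 g2
        cg2 = proj₁ (proj₂ H2)
        K0 : ∀ {y} → Meets K y → Meets K₀ y
        K0 {y} m = sat-⊒ {z = y} (⊒-trans {K'' = K} le (proj₁ (proj₂ (proj₂ (proj₂ pick))))) m
        fin : ∀ p p' → p ∈ W → p' ∈ W → Fib p p' → out q∞ (move g1 g2 p) (move g1 g2 p') ≡ not (not κ)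
        fin (x , y) (.x , y') a b (refl , e) = trans (cong₂ (D (g1 x)) em1 em2)
            (trans (value (K0 (All.lookup mq (proj₁ (proj₂ (cv a))))) (K0 (All.lookup mq (proj₁ (proj₂ (cv b)))))
                (trans (cong₂ E (sym em1) (sym em2)) (trans (emb cg2 y y') e)) (proj₂ (proj₂ (cv a))) (proj₂ (proj₂ (cv b))))
              (trans (proj₁ (rs-spec (kd a))) (sym (not-involutive κ))))
          where
          em1 = All.lookup (proj₂ (proj₂ H2)) (proj₁ (proj₂ (cv a)))
          em2 = All.lookup (proj₂ (proj₂ H2)) (proj₁ (proj₂ (cv b)))

  min-lex : Σ Bool λ ε → ∀ W → VInj W → LexOn ε W
  min-lex with em {Odd}
  ... | yes o = false , SingleFlip.all-kept o
  ... | no n = Constant.constant n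

-- Types of pairs and behaviours invariant under rotation.

data Ty : Set where
  eq : Ty
  ne : Bool → Ty

tyOf : (ℕ → ℕ → Bool) → ℕ → ℕ → Ty
tyOf E x y with x ≟ y
... | yes _ = eq
... | no _ = ne (E x y)

tyOf-ne : ∀ E {x y b} → x ≢ y → E x y ≡ b → tyOf E x y ≡ ne b
tyOf-ne E {x} {y} n refl with x ≟ y
... | yes e = ⊥-elim (n e)
... | no _ = refl

tyOf-eq : ∀ E {x y} → x ≡ y → tyOf E x y ≡ eq
tyOf-eq E {x} {y} e with x ≟ y
... | yes _ = refl
... | no n = ⊥-elim (n e)

-- Distinct triples differ in some coordinate, so the value of `β` at three equalities is never
-- consulted.
Local : (E : ℕ → ℕ → Bool) → ((ℕ → ℕ → ℕ → ℕ) → Set) → (Ty → Ty → Ty → Bool) → Set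
Local E P β = ∀ (F : List ℕ) → Σ (ℕ → ℕ → ℕ → ℕ) λ s → P s × (∀ {x y z x' y' z'} → x ∈ F → y ∈ F → z ∈ F → x' ∈ F → y' ∈ F → z' ∈ F →
    (x , y , z) ≢ (x' , y' , z') → (s x y z ≢ s x' y' z') × (E (s x y z) (s x' y' z') ≡ β (tyOf E x x') (tyOf E y y') (tyOf E z z')))

LocalCyclic : (E : ℕ → ℕ → Bool) → ((ℕ → ℕ → ℕ → ℕ) → Set) → Set
LocalCyclic E P = Σ (Ty → Ty → Ty → Bool) λ β → (∀ a b c → β a b c ≡ β b c a) × Local E P β

lex2 : Bool → Ty → Ty → Ty
lex2 ε (ne a) _ = ne a
lex2 ε eq (ne b) = ne (ε xor b)
lex2 ε eq eq = eq

lex3 : Bool → Ty → Ty → Ty → Ty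
lex3 ε a b c = lex2 ε a (lex2 ε b c)

apply3 : (Bool → Bool → Bool → Bool) → Ty → Ty → Ty → Bool
apply3 μ (ne a) (ne b) (ne c) = μ a b c
-- A filler: the three rotated lexicographic types in `cyc` are equalities all at once or not at
-- all.
apply3 μ _ _ _ = false

cyc : (Bool → Bool → Bool → Bool) → Bool → Ty → Ty → Ty → Bool
cyc μ ε a b c = apply3 μ (lex3 ε a b c) (lex3 ε b c a) (lex3 ε c a b)

cyc-cyc : ∀ μ ε → (∀ a b c → μ a b c ≡ μ b c a) → ∀ a b c → cyc μ ε a b c ≡ cyc μ ε b c a
cyc-cyc μ ε h a b c = rot (lex3 ε a b c) (lex3 ε b c a) (lex3 ε c a b)
  where
  rot : ∀ x y z → apply3 μ x y z ≡ apply3 μ y z x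
  rot (ne a) (ne b) (ne c) = h a b c
  rot eq eq eq = refl
  rot eq eq (ne _) = refl
  rot eq (ne _) eq = refl
  rot eq (ne _) (ne _) = refl
  rot (ne _) eq eq = refl
  rot (ne _) eq (ne _) = refl
  rot (ne _) (ne _) eq = refl

maj-cyc : ∀ a b c → maj3 a b c ≡ maj3 b c a
maj-cyc true true true = refl
maj-cyc true true false = refl
maj-cyc true false true = refl
maj-cyc true false false = refl
maj-cyc false true true = refl
maj-cyc false true false = refl
maj-cyc false false true = refl
maj-cyc false false false = refl

min-cyc : ∀ a b c → min3 a b c ≡ min3 b c a
min-cyc true true true = refl
min-cyc true true false = refl
min-cyc true false true = refl
min-cyc true false false = refl
min-cyc false true true = refl
min-cyc false true false = refl
min-cyc false false true = refl
min-cyc false false false = refl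

module ArcDichotomy (cl : OpClone)
  (pres : PreservesArcs cl)
  (closed2 : ∀ (h : ℕ → ℕ → ℕ) → (∀ (L : List (ℕ × ℕ)) → Σ (ℕ → ℕ → ℕ) λ g → OpCloneProps.C2 cl g × (∀ x y → (x , y) ∈ L → g x y ≡ h x y)) → OpCloneProps.C2 cl h) where
  open Dominance cl pres

  private
    ty : ℕ → ℕ → Ty
    ty = tyOf E

  module _ (fd : FirstDominant) (ε : Bool) (lex : ∀ W → VInj W → LexOn ε W) where

    -- The value `g y x` is injective on `W`, as the tie-orienting `q` requires of second
    -- coordinates, and has the arcs of `y` wherever `y` differs. So on a tie in `x`, `q` sees the
    -- arc of `y`.
    lexp : ∀ (W : List Pt) → Σ (ℕ → ℕ → ℕ) λ p → C2 p × (∀ {r r'} → r ∈ W → r' ∈ W → r ≢ r' → (app p r ≢ app p r') ×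
      (ty (app p r) (app p r') ≡ lex2 ε (ty (proj₁ r) (proj₁ r')) (ty (proj₂ r) (proj₂ r'))))
    lexp W = (λ x y → q x (g y x)) , c22 cq π1 (swap2 cg) , λ {r} {r'} a b n → dist a b n , type a b n
      where
      G = fd W proj₂ proj₁ (λ a b n → sw (jpt W a b n))
        where sw : ∀ {A B : Set} → A ⊎ B → B ⊎ A
              sw (inj₁ a) = inj₂ a
              sw (inj₂ a) = inj₁ a
      g = proj₁ G
      cg : C2 g
      cg = proj₁ (proj₂ G)
      ig : InjOn W (λ r → g (proj₂ r) (proj₁ r))
      ig = proj₁ (proj₂ (proj₂ G))
      dg = proj₂ (proj₂ (proj₂ G))
      m : Pt → Pt
      m r = proj₁ r , g (proj₂ r) (proj₁ r)
      W' : List Pt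
      W' = map m W
      vi : VInj W'
      vi a b n with ∈-map⁻ m a | ∈-map⁻ m b
      ... | r , r∈ , refl | r' , r'∈ , refl = ig r∈ r'∈ (λ e → n (cong m e))
      L = lex W' vi
      q = proj₁ L
      cq : C2 q
      cq = proj₁ (proj₂ L)
      fq : FDp W' q
      fq = proj₁ (proj₂ (proj₂ L))
      mn : ∀ {r r'} → r ∈ W → r' ∈ W → r ≢ r' → m r ≢ m r'
      mn a b n e = ig a b n (cong proj₂ e)
      dist : ∀ {r r'} → r ∈ W → r' ∈ W → r ≢ r' → app q (m r) ≢ app q (m r')
      dist a b n = proj₁ fq (∈-map⁺ m a) (∈-map⁺ m b) (mn a b n)
      type : ∀ {r r'} → r ∈ W → r' ∈ W → r ≢ r' → ty (app q (m r)) (app q (m r')) ≡ lex2 ε (ty (proj₁ r) (proj₁ r')) (ty (proj₂ r) (proj₂ r'))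
      type {x , y} {x' , y'} a b n with x ≟ x'
      ... | no nx = tyOf-ne E (dist a b n) (proj₂ fq (∈-map⁺ m a) (∈-map⁺ m b) nx)
      ... | yes refl with y ≟ y'
      ... | yes refl = ⊥-elim (n refl)
      ... | no ny with bool-em (E y y')
      ... | inj₁ t = trans (tyOf-ne E (dist a b n) (trans (proj₂ (proj₂ (proj₂ L)) (∈-map⁺ m a) (∈-map⁺ m b) (refl , trans (dg a b ny) t)) (x1 ε))) (cong (λ c → ne (ε xor c)) (sym t))
        where x1 : ∀ ε → not ε ≡ (ε xor true)
              x1 true = refl
              x1 false = refl
      ... | inj₂ f = trans (tyOf-ne E (dist a b n) (trans (flip' (dist b a (λ e → n (sym e))) (proj₂ (proj₂ (proj₂ L)) (∈-map⁺ m b) (∈-map⁺ m a) (refl , trans (dg b a (λ e → ny (sym e))) (farc ny f)))) (x2 ε))) (cong (λ c → ne (ε xor c)) (sym f))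
        where x2 : ∀ ε → not (not ε) ≡ (ε xor false)
              x2 true = refl
              x2 false = refl

    private
      Tri : Set
      Tri = ℕ × ℕ × ℕ

      lexL : (F : List ℕ) → Σ (ℕ → ℕ → ℕ → ℕ) λ l → C3 l × (∀ {x y z x' y' z'} → x ∈ F → y ∈ F → z ∈ F → x' ∈ F → y' ∈ F → z' ∈ F →
        (x , y , z) ≢ (x' , y' , z') → (l x y z ≢ l x' y' z') × (ty (l x y z) (l x' y' z') ≡ lex3 ε (ty x x') (ty y y') (ty z z')))
      lexL F with lexp (cartesianProduct F F)
      ... | p , cp , hp with lexp (map (λ (x , y , z) → x , p y z) (cartesianProduct F (cartesianProduct F F)))
      ... | q , cq , hq = (λ x y z → q x (p y z)) , c23 cq p1 (c23 cp p2 p3) , λ {x} {y} {z} {x'} {y'} {z'} a b c a' b' c' n →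
            let m = ∈-map⁺ (λ (x , y , z) → x , p y z) (∈-cartesianProduct⁺ a (∈-cartesianProduct⁺ b c))
                m' = ∈-map⁺ (λ (x , y , z) → x , p y z) (∈-cartesianProduct⁺ a' (∈-cartesianProduct⁺ b' c'))
                (d , t) = hq m m' (nn x y z x' y' z' b c b' c' n) in
            d , trans t (cong (lex2 ε (ty x x')) (inner y z y' z' b c b' c'))
        where
        nn : ∀ x y z x' y' z' → y ∈ F → z ∈ F → y' ∈ F → z' ∈ F → (x , y , z) ≢ (x' , y' , z') → (x , p y z) ≢ (x' , p y' z')
        nn x y z x' y' z' b c b' c' n e with em {(y , z) ≡ (y' , z')}
        ... | yes refl = n (cong (_, y , z) (cong proj₁ e))
        ... | no k = proj₁ (hp (∈-cartesianProduct⁺ b c) (∈-cartesianProduct⁺ b' c') k) (cong proj₂ e)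
        inner : ∀ y z y' z' → y ∈ F → z ∈ F → y' ∈ F → z' ∈ F → ty (p y z) (p y' z') ≡ lex2 ε (ty y y') (ty z z')
        inner y z y' z' b c b' c' with em {(y , z) ≡ (y' , z')}
        ... | yes refl = trans (tyOf-eq E refl) (sym (cong₂ (lex2 ε) (tyOf-eq E {y} refl) (tyOf-eq E {z} refl)))
        ... | no k = proj₂ (hp (∈-cartesianProduct⁺ b c) (∈-cartesianProduct⁺ b' c') k)

    local : ∀ μ → Loc μ → Local E C3 (cyc μ ε)
    local μ lm F with lexL F
    ... | l , cl' , hl with lm (cartesianProduct F (cartesianProduct F F)) (λ (x , y , z) → l x y z) (λ (x , y , z) → l y z x) (λ (x , y , z) → l z x y)
             (λ a b n → proj₁ (H a b n)) (λ a b n → proj₁ (H' a b n)) (λ a b n → proj₁ (H'' a b n))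
      where
      Fs : List Tri
      Fs = cartesianProduct F (cartesianProduct F F)
      parts : ∀ {x y z} → (x , y , z) ∈ Fs → (x ∈ F) × (y ∈ F) × (z ∈ F)
      parts m with ∈-cartesianProduct⁻ F (cartesianProduct F F) m
      ... | a , m' with ∈-cartesianProduct⁻ F F m'
      ... | b , c = a , b , c
      H : ∀ {r r' : Tri} → r ∈ Fs → r' ∈ Fs → r ≢ r' → _
      H {x , y , z} {x' , y' , z'} a b n = let (i , j , k) = parts a ; (i' , j' , k') = parts b in hl i j k i' j' k' n
      H' : ∀ {r r' : Tri} → r ∈ Fs → r' ∈ Fs → r ≢ r' → _
      H' {x , y , z} {x' , y' , z'} a b n = let (i , j , k) = parts a ; (i' , j' , k') = parts b in hl j k i j' k' i' (λ { refl → n refl })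
      H'' : ∀ {r r' : Tri} → r ∈ Fs → r' ∈ Fs → r ≢ r' → _
      H'' {x , y , z} {x' , y' , z'} a b n = let (i , j , k) = parts a ; (i' , j' , k') = parts b in hl k i j k' i' j' (λ { refl → n refl })
    ... | t , ct , ht = _ , c33 ct cl' (c33 cl' p2 p3 p1) (c33 cl' p3 p1 p2) , λ {x} {y} {z} {x'} {y'} {z'} a b c a' b' c' n →
        let m = ∈-cartesianProduct⁺ a (∈-cartesianProduct⁺ b c)
            m' = ∈-cartesianProduct⁺ a' (∈-cartesianProduct⁺ b' c')
            (d1 , e1) = hl a b c a' b' c' n
            (d2 , e2) = hl b c a b' c' a' (λ { refl → n refl })
            (d3 , e3) = hl c a b c' a' b' (λ { refl → n refl }) in
        strict3 ct d1 d2 d3 , trans (ht m m' n) (fin (trans (sym (tyOf-ne E d1 refl)) e1) (trans (sym (tyOf-ne E d2 refl)) e2) (trans (sym (tyOf-ne E d3 refl)) e3))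
      where
      fin : ∀ {a b c x y z} → ne a ≡ x → ne b ≡ y → ne c ≡ z → μ a b c ≡ apply3 μ x y z
      fin refl refl refl = refl

  local-cases : Essential → AllFollow ⊎ LocalCyclic E C3
  local-cases ess with arc-cases ess
  ... | inj₁ f = inj₁ f
  ... | inj₂ (fd , inj₁ lm) = let (ε , lex) = MajLex.maj-lex fd lm in inj₂ (cyc maj3 ε , cyc-cyc maj3 ε maj-cyc , local fd ε lex maj3 lm)
  ... | inj₂ (fd , inj₂ lm) = let (ε , lex) = MinLex.min-lex cl pres closed2 fd lm in inj₂ (cyc min3 ε , cyc-cyc min3 ε min-cyc , local fd ε lex min3 lm)

-- Automorphisms and switching

-- The polymorphisms of 𝔸 with its automorphisms are one instance; after switching at
-- the point 0, the operations fixing 0 with the stabiliser of 0 form another.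
record CoreClone : Set₁ where
  field
    em : ExcludedMiddle 0ℓ
    E : ℕ → ℕ → Bool
    tour : IsTournament E
    ext : Extension E
    G : Set
    to from : G → ℕ → ℕ
    to-from : ∀ g x → to g (from g x) ≡ x
    from-to : ∀ g x → from g (to g x) ≡ x
    mul : ∀ g h → Σ G λ k → ∀ x → to k x ≡ to g (to h x)
    inv : ∀ g → Σ G λ k → ∀ x → to k x ≡ from g x
    homG : ∀ {n} (a b : Fin n → ℕ) → Inj a → Inj b → (∀ i j → E (a i) (a j) ≡ E (b i) (b j)) → Σ G λ g → ∀ i → to g (a i) ≡ b i
    C : ∀ {k} → Op k → Set
    Cext : ∀ {k} {f : Op k} → C f → ∀ {x y} → x ≗' y → f x ≡ f y
    Cproj : ∀ {k} (j : Fin k) → C (λ v → v j)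
    Ccomp : ∀ {n k} {f : Op n} {g : Fin n → Op k} → C f → (∀ j → C (g j)) → C (λ v → f (λ j → g j v))
    CG : ∀ g → C {1} (λ v → to g (v zero))
    core : ∀ {u : ℕ → ℕ} → C {1} (λ v → u (v zero)) → (F : List ℕ) → Σ G λ g → ∀ x → x ∈ F → to g x ≡ u x
    closed : ∀ {k} (f : Op k) → (∀ {x y} → x ≗' y → f x ≡ f y) → (∀ (L : List (Fin k → ℕ)) → Σ (Op k) λ g → C g × (∀ x → x ∈ L → g x ≡ f x)) → C f

cons : ∀ {n} → ℕ → (Fin n → ℕ) → Fin (suc n) → ℕ
cons x a zero = x
cons x a (suc i) = a i

module CoreCloneProps (w : CoreClone) where
  open CoreClone w public
  open TournamentProps tour public
  open Extending tour ext public
  open Dense em tour ext public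

  toinj : ∀ g {x y} → to g x ≡ to g y → x ≡ y
  toinj g {x} {y} e = trans (sym (from-to g x)) (trans (cong (from g) e) (from-to g y))

  Eqv : ∀ {n} → (Fin n → ℕ) → (Fin n → ℕ) → Set
  Eqv a b = Σ G λ g → ∀ i → to g (a i) ≡ b i

  eqv-trans : ∀ {n} {a b c : Fin n → ℕ} → Eqv a b → Eqv b c → Eqv a c
  eqv-trans (g , p) (h , q) = let (k , e) = mul h g in k , λ i → trans (e _) (trans (cong (to h) (p i)) (q i))

  eqv-sym : ∀ {n} {a b : Fin n → ℕ} → Eqv a b → Eqv b a
  eqv-sym (g , p) = let (k , e) = inv g in k , λ i → trans (e _) (trans (cong (from g) (sym (p i))) (from-to g _))

  opaque
    homGL : (ps : List (ℕ × ℕ)) → AllPairs SEp ps → Σ G λ g → All (λ p → to g (proj₁ p) ≡ proj₂ p) ps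
    homGL ps ap with tuple ps ap
    ... | t with homG (Tuple.a t) (Tuple.b t) (Tuple.ia t) (Tuple.ib t) (Tuple.same t)
    ... | g , h = g , All.tabulate (λ {p} m → let (i , q , r) = Tuple.cover t p m in trans (cong (to g) (sym q)) (trans (h i) r))

  private
    arcG : ∀ {a b c d} → a ≢ b → c ≢ d → E a b ≡ E c d → Σ G λ g → (to g a ≡ c) × (to g b ≡ d)
    arcG {a} {b} {c} {d} n m e with homGL ((a , c) ∷ (b , d) ∷ []) ((se n m e ∷ []) ∷ [] ∷ [])
    ... | g , p ∷ q ∷ [] = g , p , q

  -- The group elements at the coordinates turn `f` into a unary operation, which the core property
  -- replaces on `a` and `b` by a single group element.
  pull : ∀ {k} {f : Op k} → C f → ∀ {x y a b} → (∀ j → Σ G λ g → (to g a ≡ x j) × (to g b ≡ y j)) → Σ G λ g → (to g a ≡ f x) × (to g b ≡ f y)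
  pull {k} {f} cf {x} {y} {a} {b} h with core {λ s → f (λ j → to (proj₁ (h j)) s)} (Ccomp {g = λ j v → to (proj₁ (h j)) (v zero)} cf (λ j → CG (proj₁ (h j)))) (a ∷ b ∷ [])
  ... | g , q = g , trans (q a (here refl)) (Cext cf (λ j → proj₁ (proj₂ (h j)))) , trans (q b (there (here refl))) (Cext cf (λ j → proj₂ (proj₂ (h j))))

  Reverses : Set
  Reverses = Σ G λ g → Σ ℕ λ a → Σ ℕ λ b → (E a b ≡ true) × (E (to g a) (to g b) ≡ false)

  private
    pairG : Reverses → ∀ {a b c d} → a ≢ b → c ≢ d → Σ G λ g → (to g a ≡ c) × (to g b ≡ d)
    pairG (h , p , q , e , f) {a} {b} {c} {d} n m with E a b ≟B E c d
    ... | yes s = arcG n m s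
    ... | no s = main (bool-em (E a b))
      where
      pq : p ≢ q
      pq = arc≢ e
      hpq : to h p ≢ to h q
      hpq k = pq (toinj h k)
      use : ∀ {u v u' v'} → u ≢ v → u' ≢ v' → E u v ≡ E p q → E u' v' ≡ E (to h p) (to h q) → Σ G λ g → (to g u ≡ u') × (to g v ≡ v')
      use nu nv s1 s2 = let (g1 , a1 , b1) = arcG nu pq s1 ; (g2 , a2 , b2) = arcG hpq nv (sym s2) ; (k1 , e1) = mul h g1 ; (k2 , e2) = mul g2 k1 in
        k2 , trans (e2 _) (trans (cong (to g2) (trans (e1 _) (cong (to h) a1))) a2) , trans (e2 _) (trans (cong (to g2) (trans (e1 _) (cong (to h) b1))) b2)
      main : _ → _
      main (inj₁ t) = use n m (trans t (sym e)) (trans (¬t→f (λ q → s (trans t (sym q)))) (sym f))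
      main (inj₂ t) = let (g , x , y) = use (λ k → n (sym k)) (λ k → m (sym k)) (trans (farc n t) (sym e))
                                         (trans (flip' m (¬f→t (λ q → s (trans t (sym q))))) (sym f)) in g , y , x

    presG : ¬ Reverses → ∀ g {a b} → E a b ≡ true → E (to g a) (to g b) ≡ true
    presG nr g e = ¬f→t (λ f → nr (g , _ , _ , e , f))

    arcT : Σ ℕ λ a → Σ ℕ λ b → E a b ≡ true
    arcT = let (a , h) = ext (0 ∷ []) (λ _ → true) in a , 0 , proj₂ (h 0 (here refl))

  pres-op : (∀ g {a b} → E a b ≡ true → E (to g a) (to g b) ≡ true) → ∀ {k} {f : Op k} → C f → ∀ {x y} → (∀ j → E (x j) (y j) ≡ true) → E (f x) (f y) ≡ true
  pres-op pg cf h = let (a , b , e) = arcT ; (g , p , q) = pull cf (λ j → arcG (arc≢ e) (arc≢ (h j)) (trans e (sym (h j)))) in subst₂ (λ u v → E u v ≡ true) p q (pg g e)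

  opaque
    -- If `G` reverses some arc, all pairs of distinct points are equivalent, and `f` acts on one
    -- pair as an injective group element. Otherwise operations preserve arcs; with `z` between `x`
    -- and `y` in every coordinate, equal values would have arcs both ways with `f z`.
    strictW : ∀ {k} {f : Op k} → C f → ∀ {x y} → x # y → f x ≢ f y
    strictW {k} {f} cf {x} {y} n with em {Reverses}
    ... | yes r = λ e → let (a , b , ab) = arcT ; (g , p , q) = pull cf (λ j → pairG r (arc≢ ab) (n j)) in arc≢ ab (toinj g (trans p (trans e (sym q))))
    ... | no nr = λ e → t≢f xz (asym _ _ (subst (λ u → E (f z) u ≡ true) (sym e) zy))
      where
      Z : ∀ j → Σ ℕ λ z → (E (x j) z ≡ true) × (E z (y j) ≡ true)
      Z j with extL ((x j , false) ∷ (y j , true) ∷ []) ((ag (n j) ∷ []) ∷ [] ∷ []) []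
      ... | z , (a , b) ∷ (c , d) ∷ [] , _ = z , farc a b , d
      z : Fin k → ℕ
      z j = proj₁ (Z j)
      xz : E (f x) (f z) ≡ true
      xz = pres-op (presG nr) cf (λ j → proj₁ (proj₂ (Z j)))
      zy : E (f z) (f y) ≡ true
      zy = pres-op (presG nr) cf (λ j → proj₂ (proj₂ (Z j)))

  opClone : OpClone
  opClone = record { em = em ; E = E ; tour = tour ; ext = ext ; C = C ; Cext = Cext ; Cproj = Cproj ; Ccomp = Ccomp
    ; hom = λ a b ia ib s → let (g , h) = homG a b ia ib s in to g , CG g , h ; strict = strictW }

  Rigid : Set
  Rigid = ∀ g → (∀ a b → E (to g a) (to g b) ≡ E a b) ⊎ (∀ {a b} → a ≢ b → E (to g a) (to g b) ≡ not (E a b))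

  StarFlip : Set
  StarFlip = ∀ {n} (a b : Fin n → ℕ) → Inj a → Inj b → ∀ i → (∀ j k → j ≢ i → k ≢ i → E (a j) (a k) ≡ E (b j) (b k)) →
    (∀ j → j ≢ i → E (a i) (a j) ≡ not (E (b i) (b j))) → Eqv a b

  record Star {n} (x : ℕ) (r : Fin n → ℕ) (τ : Fin n → Bool) (M : Fin n → Fin n → Bool) : Set where
    field
      inj : Inj r
      off : ∀ s → x ≢ r s
      arm : ∀ s → E x (r s) ≡ τ s
      mat : ∀ s s' → s ≢ s' → E (r s) (r s') ≡ M s s'

  star-same : ∀ {n x x' r r' τ M} → Star {n} x r τ M → Star x' r' τ M → Eqv (cons x r) (cons x' r')
  star-same {n} {x} {x'} {r} {r'} S S' = homG (cons x r) (cons x' r') (ci S) (ci S') sm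
    where
    open Star
    ci : ∀ {x r τ M} → Star {n} x r τ M → Inj (cons x r)
    ci S {zero} {zero} e = refl
    ci S {zero} {suc j} e = ⊥-elim (off S j e)
    ci S {suc i} {zero} e = ⊥-elim (off S i (sym e))
    ci S {suc i} {suc j} e = cong suc (inj S e)
    sm : ∀ i j → E (cons x r i) (cons x r j) ≡ E (cons x' r' i) (cons x' r' j)
    sm zero zero = trans (irrefl _) (sym (irrefl _))
    sm zero (suc j) = trans (arm S j) (sym (arm S' j))
    sm (suc i) zero = trans (flip' (off S i) (arm S i)) (sym (flip' (off S' i) (arm S' i)))
    sm (suc i) (suc j) with i ≟F j
    ... | yes refl = trans (irrefl _) (sym (irrefl _))
    ... | no n = trans (mat S i j n) (sym (mat S' i j n))

  -- Stars with the same data are equivalent by `star-same`, so the choice of the two realisations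
  -- does not matter and the relation is transitive.
  Rel : ∀ {n} → (Fin n → Fin n → Bool) → (Fin n → Bool) → (Fin n → Bool) → Set
  Rel {n} M τ τ' = Σ ℕ λ x → Σ ℕ λ x' → Σ (Fin n → ℕ) λ r → Σ (Fin n → ℕ) λ r' → Star x r τ M × Star x' r' τ' M × Eqv (cons x r) (cons x' r')

  rel-sym : ∀ {n M} {τ τ' : Fin n → Bool} → Rel M τ τ' → Rel M τ' τ
  rel-sym (x , x' , r , r' , S , S' , e) = x' , x , r' , r , S' , S , eqv-sym e

  rel-trans : ∀ {n M} {τ τ' τ'' : Fin n → Bool} → Rel M τ τ' → Rel M τ' τ'' → Rel M τ τ''
  rel-trans (x , x' , r , r' , S , S' , e) (y , y' , q , q' , T , T' , f) = x , y' , r , q' , S , T' , eqv-trans e (eqv-trans (star-same S' T) f)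

  Odd : ∀ {n} → (Fin n → Fin n → Bool) → Set
  Odd M = ∀ s s' → s ≢ s' → M s' s ≡ not (M s s')

  -- A dummy point at index i lets the remaining points keep their indices.
  rel-eqv : ∀ {n} (a b : Fin n → ℕ) → Inj a → Inj b → ∀ i → (∀ j k → j ≢ i → k ≢ i → E (a j) (a k) ≡ E (b j) (b k)) →
    (τ' : Fin n → Bool) → (∀ j → j ≢ i → E (b i) (b j) ≡ τ' j) → (∀ M → Odd M → Rel M (λ j → E (a i) (a j)) τ') → Eqv a b
  rel-eqv {n} a b ia ib i same τ' opp rel = eqv-trans (homG a a' ia (ci S ia) (typ a ia S (λ j k _ _ → refl) (λ j _ → refl)))
      (eqv-trans (g , mv) (eqv-sym (homG b b' ib (ci S' ib) (typ b ib S' (λ j k p q → sym (same j k p q)) opp))))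
    where
    M : Fin n → Fin n → Bool
    M j k with j ≟F i | k ≟F i
    ... | yes _ | _ = true
    ... | no _ | yes _ = false
    ... | no _ | no _ = E (a j) (a k)
    Mab : ∀ j k → j ≢ i → k ≢ i → M j k ≡ E (a j) (a k)
    Mab j k p q with j ≟F i | k ≟F i
    ... | yes e | _ = ⊥-elim (p e)
    ... | no _ | yes e = ⊥-elim (q e)
    ... | no _ | no _ = refl
    odd : Odd M
    odd j k n with j ≟F i | k ≟F i
    ... | yes p | yes q = ⊥-elim (n (trans p (sym q)))
    ... | yes _ | no _ = refl
    ... | no _ | yes _ = refl
    ... | no _ | no _ = flip (λ e → n (ia e))
    R = rel M odd
    x = proj₁ R
    x' = proj₁ (proj₂ R)
    r = proj₁ (proj₂ (proj₂ R))
    r' = proj₁ (proj₂ (proj₂ (proj₂ R)))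
    S = proj₁ (proj₂ (proj₂ (proj₂ (proj₂ R))))
    S' = proj₁ (proj₂ (proj₂ (proj₂ (proj₂ (proj₂ R)))))
    g = proj₁ (proj₂ (proj₂ (proj₂ (proj₂ (proj₂ (proj₂ R))))))
    ge = proj₂ (proj₂ (proj₂ (proj₂ (proj₂ (proj₂ (proj₂ R))))))
    put : ℕ → (Fin n → ℕ) → Fin n → ℕ
    put x r j with j ≟F i
    ... | yes _ = x
    ... | no _ = r j
    a' b' : Fin n → ℕ
    a' = put x r
    b' = put x' r'
    mv : ∀ j → to g (a' j) ≡ b' j
    mv j with j ≟F i
    ... | yes _ = ge zero
    ... | no _ = ge (suc j)
    open Star
    ci : ∀ {x r τ M} → Star {n} x r τ M → ∀ {c : Fin n → ℕ} → Inj c → Inj (put x r)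
    ci S _ {j} {k} e with j ≟F i | k ≟F i
    ... | yes p | yes q = trans p (sym q)
    ... | yes _ | no _ = ⊥-elim (off S k e)
    ... | no _ | yes _ = ⊥-elim (off S j (sym e))
    ... | no _ | no _ = inj S e
    typ : ∀ (c : Fin n → ℕ) → Inj c → ∀ {x r τ} → Star {n} x r τ M → (∀ j k → j ≢ i → k ≢ i → E (c j) (c k) ≡ E (a j) (a k)) →
      (∀ j → j ≢ i → E (c i) (c j) ≡ τ j) → ∀ j k → E (c j) (c k) ≡ E (put x r j) (put x r k)
    typ c ic S sm ar j k with j ≟F i | k ≟F i
    ... | yes refl | yes refl = trans (irrefl _) (sym (irrefl _))
    ... | yes refl | no q = trans (ar k q) (sym (arm S k))
    ... | no p | yes refl = trans (flip' (λ e → p (sym (ic e))) (ar j p)) (sym (flip' (off S j) (arm S j)))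
    ... | no p | no q with j ≟F k
    ... | yes refl = trans (irrefl _) (sym (irrefl _))
    ... | no jk = trans (sm j k p q) (sym (trans (mat S j k jk) (Mab j k p q)))

  star-flip : (∀ {n} (M : Fin n → Fin n → Bool) τ → Odd M → Rel M τ (λ s → not (τ s))) → StarFlip
  star-flip rel a b ia ib i same opp = rel-eqv a b ia ib i same (λ j → not (E (a i) (a j)))
    (λ j n → trans (sym (not-involutive _)) (cong not (sym (opp j n)))) (λ M o → rel M _ o)

  opaque
    stars : ∀ {n} (M : Fin n → Fin n → Bool) → Odd M → ∀ τ p₀ → Σ (Fin n → ℕ) λ a → Star p₀ a τ M
    stars {zero} M o τ p₀ = (λ ()) , record { inj = λ { {()} } ; off = λ () ; arm = λ () ; mat = λ () }
    stars {suc n} M o τ p₀ with stars (λ i j → M (suc i) (suc j)) (λ i j k → o (suc i) (suc j) (λ { refl → k refl })) (λ i → τ (suc i)) p₀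
    ... | a , S with extL ((p₀ , not (τ zero)) ∷ tabulate (λ j → a j , M zero (suc j)))
              (All-tab (λ j e → ⊥-elim (Star.off S j e)) ∷ AP-tab (λ k e → ⊥-elim (k (Star.inj S e)))) []
    ... | z , (zp , ep) ∷ hs , _ = cons z a , record { inj = λ {i} {j} → ij i j ; off = λ { zero e → zp (sym e) ; (suc s) → Star.off S s }
          ; arm = λ { zero → trans (flip' zp ep) (not-involutive _) ; (suc s) → Star.arm S s } ; mat = mt }
      where
      zr : ∀ j → (z ≢ a j) × (E z (a j) ≡ M zero (suc j))
      zr j = All-tab⁻ hs j
      ij : ∀ i j → cons z a i ≡ cons z a j → i ≡ j
      ij zero zero e = refl
      ij zero (suc j) e = ⊥-elim (proj₁ (zr j) e)
      ij (suc i) zero e = ⊥-elim (proj₁ (zr i) (sym e))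
      ij (suc i) (suc j) e = cong suc (Star.inj S e)
      mt : ∀ s s' → s ≢ s' → E (cons z a s) (cons z a s') ≡ M s s'
      mt zero zero k = ⊥-elim (k refl)
      mt zero (suc j) k = proj₂ (zr j)
      mt (suc i) zero k = trans (flip' (proj₁ (zr i)) (proj₂ (zr i))) (sym (o zero (suc i) (λ ())))
      mt (suc i) (suc j) k = Star.mat S i j (λ { refl → k refl })

-- Automorphisms: rigidity, or switching at a point.

module AutomorphismCases (w : CoreClone) where
  open CoreCloneProps w

  private
    splitN : ∀ n (χ : Fin n → ℕ → Bool) {X K} → Dense X K → Σ Cond λ K' → (K' ⊒ K) × Σ (Fin n → Bool) λ t → Dense (λ r → X r × (∀ i → χ i r ≡ t i)) K'
    splitN zero χ {X} {K} d = K , ⊒-refl {K} , (λ ()) , λ K' l → let (z , x , m) = d K' l in z , (x , λ ()) , m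
    splitN (suc n) χ {X} {K} d with dense-split d (χ zero)
    ... | K₁ , l₁ , b , d₁ with splitN n (λ i → χ (suc i)) d₁
    ... | K₂ , l₂ , t , d₂ = K₂ , ⊒-trans {K'' = K₂} l₂ l₁ , t' , λ K' l → let (z , ((x , e) , es) , m) = d₂ K' l in z , (x , λ { zero → e ; (suc i) → es i }) , m
      where t' : Fin (suc n) → Bool
            t' zero = b
            t' (suc i) = t i

  module Config (g : G) (d : Fin 6 → ℕ) (di : Inj d) where
    Cell : Set
    Cell = Fin 6 → Bool

    dd : Fin 6 → ℕ
    dd i = to g (d i)

    ddi : Inj dd
    ddi e = di (toinj g e)

    private
      Kc : Cell → Cond
      Kc c = tabulate dd , λ x → decide (Σ (Fin 6) λ i → (dd i ≡ x) × (c i ≡ true))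

      Kc-meets : ∀ c {r} → Meets (Kc c) r → ∀ i → (r ≢ dd i) × (E r (dd i) ≡ c i)
      Kc-meets c {r} m i with m (dd i) (∈-tabulate⁺ {f = dd} i)
      ... | n , e with bool-em (c i)
      ... | inj₁ t = n , trans e (trans (decide-yes (i , refl , t)) (sym t))
      ... | inj₂ f = n , trans e (trans (decide-no (λ (j , q , t) → t≢f (trans (cong c (sym (ddi q))) t) f)) (sym f))

    opaque
      -- Among the points with arcs `c` to the images of `d`, density settles how the preimage of a
      -- generic point is joined to `d` itself. The settled values are recorded as `T c`.
      sel : ∀ (c : Cell) → Σ Cond λ K → (K ⊒ Kc c) × Σ (Fin 6 → Bool) λ t → Dense (λ r → ⊤ × (∀ i → E (from g r) (d i) ≡ t i)) K
      sel c = splitN 6 (λ i r → E (from g r) (d i)) (dense-all (Kc c))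

    T : Cell → Fin 6 → Bool
    T c = proj₁ (proj₂ (proj₂ (sel c)))

    record Built {n} (M : Fin n → Fin n → Bool) (c : Fin n → Cell) (A : List ℕ) (r : Fin n → ℕ) : Set where
      field
        inj : Inj r
        mat : ∀ s s' → s ≢ s' → E (r s) (r s') ≡ M s s'
        off : ∀ s k → r s ≢ dd k
        img : ∀ s k → E (r s) (dd k) ≡ c s k
        dom : ∀ s k → E (from g (r s)) (d k) ≡ T (c s) k
        avoid : ∀ s a → a ∈ A → r s ≢ a
    open Built

    opaque
      build : ∀ n (M : Fin n → Fin n → Bool) → Odd M → (c : Fin n → Cell) (A : List ℕ) → Σ (Fin n → ℕ) (Built M c A)
      build zero M o c A = (λ ()) , record { inj = λ { {()} } ; mat = λ () ; off = λ () ; img = λ () ; dom = λ () ; avoid = λ () }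
      -- The other leaves are kept off the points controlled by the condition of the new leaf, so
      -- that its arcs to them can still be prescribed.
      build (suc n) M o c A with build n (λ i j → M (suc i) (suc j)) (λ i j k → o (suc i) (suc j) (λ { refl → k refl })) (λ i → c (suc i)) (A ++ proj₁ (proj₁ (sel (c zero))))
      ... | r , B with dense-hit (proj₂ (proj₂ (proj₂ (sel (c zero))))) (tabulate (λ j → r j , M zero (suc j)) ++ map (_, true) (filter (λ a → em {¬ (a ∈ proj₁ (proj₁ (sel (c zero))))}) A))
             (All-++ (All-tab (λ j m → avoid B j (r j) (∈-++⁺ʳ A m) refl)) (All-map (All.tabulate (λ m → proj₂ (∈-filter⁻ (λ a → em {¬ (a ∈ proj₁ (proj₁ (sel (c zero))))}) {xs = A} m)))))
             (AP-++ (AP-tab (λ k q → ⊥-elim (k (inj B q)))) (AP-map (allpairs-∈ _ (λ _ _ _ → refl)))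
               (All-tab (λ j → All-map (All.tabulate (λ {a} m q → ⊥-elim (avoid B j a (∈-++⁺ˡ (proj₁ (∈-filter⁻ (λ a → em {¬ (a ∈ proj₁ (proj₁ (sel (c zero))))}) {xs = A} m))) q))))))
      ... | z , (_ , dz) , mz , hits with All-++⁻ (tabulate (λ j → r j , M zero (suc j))) hits
      ... | h1 , h2 = cons z r , record
            { inj = λ {i} {j} → ij i j ; mat = mt ; off = λ { zero k → proj₁ (Kc-meets (c zero) mz' k) ; (suc s) k → off B s k }
            ; img = λ { zero k → proj₂ (Kc-meets (c zero) mz' k) ; (suc s) k → img B s k } ; dom = λ { zero k → dz k ; (suc s) k → dom B s k }
            ; avoid = λ { zero a m → av a m ; (suc s) a m → avoid B s a (∈-++⁺ˡ m) } }
        where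
        mz' : Meets (Kc (c zero)) z
        mz' = sat-⊒ {z = z} (proj₁ (proj₂ (sel (c zero)))) mz
        zr : ∀ j → (z ≢ r j) × (E z (r j) ≡ M zero (suc j))
        zr j = All-tab⁻ h1 j
        ij : ∀ i j → cons z r i ≡ cons z r j → i ≡ j
        ij zero zero e = refl
        ij zero (suc j) e = ⊥-elim (proj₁ (zr j) e)
        ij (suc i) zero e = ⊥-elim (proj₁ (zr i) (sym e))
        ij (suc i) (suc j) e = cong suc (inj B e)
        mt : ∀ s s' → s ≢ s' → E (cons z r s) (cons z r s') ≡ M s s'
        mt zero zero k = ⊥-elim (k refl)
        mt zero (suc j) k = proj₂ (zr j)
        mt (suc i) zero k = trans (flip' (proj₁ (zr i)) (proj₂ (zr i))) (sym (o zero (suc i) (λ ())))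
        mt (suc i) (suc j) k = mat B i j (λ { refl → k refl })
        av : ∀ a → a ∈ A → z ≢ a
        av a m with em {¬ (a ∈ proj₁ (proj₁ (sel (c zero))))}
        ... | yes na = proj₁ (All.lookup (All-map⁻ h2) (∈-filter⁺ (λ a → em {¬ (a ∈ proj₁ (proj₁ (sel (c zero))))}) m na))
        ... | no nna with em {a ∈ proj₁ (proj₁ (sel (c zero)))}
        ... | yes ma = proj₁ (mz a ma)
        ... | no na = ⊥-elim (nna na)

    conjugate : ∀ {n} {a b : Fin n → ℕ} → Eqv a b → Eqv (λ i → to g (a i)) (λ i → to g (b i))
    conjugate (α , e) = let (k , p) = inv g ; (k₁ , q) = mul α k ; (k₂ , q₂) = mul g k₁ in
      k₂ , λ i → trans (q₂ _) (cong (to g) (trans (q _) (trans (cong (to α) (trans (p _) (from-to g _))) (e i))))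

    dstar : ∀ {n M c A r} → Built {n} M c A r → ∀ i → Star (dd i) r (λ s → not (c s i)) M
    dstar B i = record { inj = inj B ; off = λ s e → off B s i (sym e) ; arm = λ s → flip' (off B s i) (img B s i) ; mat = mat B }

    -- The preimages of the leaves look alike from `d i` and `d j`, so a group element moves one
    -- star of preimages to the other. Conjugated by `g` it moves `dd i` to `dd j` and fixes the
    -- leaves.
    cells : ∀ {n} (M : Fin n → Fin n → Bool) → Odd M → (c : Fin n → Cell) → ∀ i j → (∀ s → T (c s) i ≡ T (c s) j) →
      Rel M (λ s → not (c s i)) (λ s → not (c s j))
    cells {n} M o c i j ag' with build n M o c []
    ... | r , B = dd i , dd j , r , r , dstar B i , dstar B j , fix (conjugate (star-same (fstar i) fj'))
      where
      fr : Fin n → ℕ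
      fr s = from g (r s)
      frd : ∀ s k → fr s ≢ d k
      frd s k e = off B s k (trans (sym (to-from g (r s))) (cong (to g) e))
      fri : Inj fr
      fri {s} {s'} e = inj B (trans (sym (to-from g _)) (trans (cong (to g) e) (to-from g _)))
      fstar : ∀ k → Star (d k) fr (λ s → not (T (c s) k)) (λ s s' → E (fr s) (fr s'))
      fstar k = record { inj = fri ; off = λ s e → frd s k (sym e) ; arm = λ s → flip' (frd s k) (dom B s k) ; mat = λ _ _ _ → refl }
      fj' : Star (d j) fr (λ s → not (T (c s) i)) (λ s s' → E (fr s) (fr s'))
      fj' = record { inj = fri ; off = λ s e → frd s j (sym e) ; arm = λ s → trans (flip' (frd s j) (dom B s j)) (cong not (sym (ag' s))) ; mat = λ _ _ _ → refl }
      fix : Eqv (λ k → to g (cons (d i) fr k)) (λ k → to g (cons (d j) fr k)) → Eqv (cons (dd i) r) (cons (dd j) r)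
      fix (k , e) = k , λ { zero → e zero ; (suc s) → trans (cong (to k) (sym (to-from g (r s)))) (trans (e (suc s)) (to-from g (r s))) }

    rel-cong : ∀ {n M} {τ τ' θ θ' : Fin n → Bool} → (∀ s → τ s ≡ θ s) → (∀ s → τ' s ≡ θ' s) → Rel M τ τ' → Rel M θ θ'
    rel-cong e e' (x , x' , r , r' , S , S' , q) = x , x' , r , r' ,
        record { inj = Star.inj S ; off = Star.off S ; arm = λ s → trans (Star.arm S s) (e s) ; mat = Star.mat S } ,
        record { inj = Star.inj S' ; off = Star.off S' ; arm = λ s → trans (Star.arm S' s) (e' s) ; mat = Star.mat S' } , q

    SC : Set
    SC = ∀ {n} (M : Fin n → Fin n → Bool) τ → Odd M → Rel M τ (λ s → not (τ s))

    private
      hit : ∀ θ x y → x ≢ y → not (if θ xor x then x else y) ≡ θ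
      hit true true true n = ⊥-elim (n refl)
      hit true true false n = refl
      hit true false true n = refl
      hit true false false n = ⊥-elim (n refl)
      hit false true true n = ⊥-elim (n refl)
      hit false true false n = refl
      hit false false true n = refl
      hit false false false n = ⊥-elim (n refl)

      pickc : Bool → Cell → Cell → Cell
      pickc b c c' = if b then c else c'

      pk : ∀ b c c' i → pickc b c c' i ≡ (if b then c i else c' i)
      pk true c c' i = refl
      pk false c c' i = refl

      pT : ∀ b c c' i j → T c i ≡ T c j → T c' i ≡ T c' j → T (pickc b c c') i ≡ T (pickc b c c') j
      pT true c c' i j p q = p
      pT false c c' i j p q = q

      -- The cells agree at `i` and differ at `j`, so a star with constant arms is related to a star
      -- with arbitrary arms; two such steps connect any two.
      sc-row : ∀ i j c c' → T c i ≡ T c j → T c' i ≡ T c' j → c i ≡ c' i → c j ≢ c' j → SC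
      sc-row i j c c' p q e n M τ o = rel-trans (rel-sym (to' τ)) (to' (λ s → not (τ s)))
        where
        to' : ∀ θ → Rel M (λ _ → not (c i)) θ
        to' θ = rel-cong (λ s → cong not (trans (pk (θ s xor c j) c c' i) (iff (θ s xor c j)))) (λ s → trans (cong not (pk (θ s xor c j) c c' j)) (hit (θ s) (c j) (c' j) n))
          (cells M o (λ s → pickc (θ s xor c j) c c') i j (λ s → pT (θ s xor c j) c c' i j p q))
          where iff : ∀ b → (if b then c i else c' i) ≡ c i
                iff true = refl
                iff false = sym e

      -- The two cells are complementary at `i` and at `j`, and each has opposite values there.
      -- Choosing between them leaf by leaf gives `τ` at one centre and its complement at the other.
      sc-opp : ∀ i j c c' → T c i ≡ T c j → T c' i ≡ T c' j → c i ≢ c' i → c j ≢ c' j → c i ≢ c j → SC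
      sc-opp i j c c' p q n n' m M τ o = rel-cong (λ s → trans (cong not (pk (τ s xor c i) c c' i)) (hit (τ s) (c i) (c' i) n))
          (λ s → trans (cong not (trans (pk (τ s xor c i) c c' j) (trans (sw (τ s xor c i)) refl))) (cong not (hit (τ s) (c i) (c' i) n)))
          (cells M o (λ s → pickc (τ s xor c i) c c') i j (λ s → pT (τ s xor c i) c c' i j p q))
        where
        opp' : c' j ≡ not (c' i)
        opp' with c i | c' i | c j | c' j
        ... | true | true | _ | _ = ⊥-elim (n refl)
        ... | false | false | _ | _ = ⊥-elim (n refl)
        ... | true | false | true | _ = ⊥-elim (m refl)
        ... | true | false | false | true = refl
        ... | true | false | false | false = ⊥-elim (n' refl)
        ... | false | true | false | _ = ⊥-elim (m refl)
        ... | false | true | true | false = refl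
        ... | false | true | true | true = ⊥-elim (n' refl)
        sw : ∀ b → (if b then c j else c' j) ≡ not (if b then c i else c' i)
        sw true = ≢→not (λ e → m (sym e))
        sw false = opp'

    module NoStar (nsc : ¬ SC) where
      -- P i j c : the points d i and d j look alike from the points of cell c.
      P : Fin 6 → Fin 6 → Cell → Set
      P i j c = T c i ≡ T c j

      private
        forb : ∀ {i j} c c' → P i j c → P i j c' → c i ≢ c j → (c i ≡ c' i → c j ≢ c' j) → ⊥
        forb {i} {j} c c' p q m h with c i ≟B c' i | c j ≟B c' j
        ... | yes a | _ = nsc (sc-row i j c c' p q a (h a))
        ... | no a | yes b = nsc (sc-row j i c c' (sym p) (sym q) b a)
        ... | no a | no b = nsc (sc-opp i j c c' p q a b m)

        third : ∀ (i j : Fin 6) → Σ (Fin 6) λ k → (k ≢ i) × (k ≢ j)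
        third i j with zero ≟F i | zero ≟F j | suc zero ≟F i | suc zero ≟F j
        ... | no a | no b | _ | _ = zero , a , b
        ... | _ | _ | no a | no b = suc zero , a , b
        ... | yes refl | _ | _ | yes refl = suc (suc zero) , (λ ()) , (λ ())
        ... | _ | yes refl | yes refl | _ = suc (suc zero) , (λ ()) , (λ ())
        ... | yes refl | _ | yes () | _
        ... | _ | yes refl | _ | yes ()

        cel : Fin 6 → Fin 6 → Bool → Bool → Bool → Cell
        cel i j a b e l with l ≟F i | l ≟F j
        ... | yes _ | _ = a
        ... | no _ | yes _ = b
        ... | no _ | no _ = e

        cel-i : ∀ i j a b e → cel i j a b e i ≡ a
        cel-i i j a b e with i ≟F i
        ... | yes _ = refl
        ... | no n = ⊥-elim (n refl)

        cel-j : ∀ i j a b e → i ≢ j → cel i j a b e j ≡ b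
        cel-j i j a b e n with j ≟F i | j ≟F j
        ... | yes q | _ = ⊥-elim (n (sym q))
        ... | no _ | yes _ = refl
        ... | no _ | no m = ⊥-elim (m refl)

        cel-k : ∀ i j a b e k → k ≢ i → k ≢ j → cel i j a b e k ≡ e
        cel-k i j a b e k n m with k ≟F i | k ≟F j
        ... | yes q | _ = ⊥-elim (n q)
        ... | no _ | yes q = ⊥-elim (m q)
        ... | no _ | no _ = refl

        pigeon : ∀ (a b c : Bool) → a ≢ b → (a ≡ c) ⊎ (b ≡ c)
        pigeon true true c n = ⊥-elim (n refl)
        pigeon true false true n = inj₁ refl
        pigeon true false false n = inj₂ refl
        pigeon false true true n = inj₂ refl
        pigeon false true false n = inj₁ refl
        pigeon false false c n = ⊥-elim (n refl)

      -- Otherwise `forb` excludes `P i j` in every cell `D a e`, where `i` and `j` share the value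
      -- `a` and `k` has `e`. There `k` must look like `i` or like `j`, and among three such cells
      -- two make the same choice, which is forbidden again.
      alike : ∀ {i j} c → i ≢ j → P i j c → c i ≡ c j
      alike {i} {j} c ij p with c i ≟B c j
      ... | yes e = e
      ... | no m with third i j
      ... | k , ki , kj = ⊥-elim (go (at true false) (at false true) (at true true))
        where
        D : Bool → Bool → Cell
        D a e = cel i j a a e
        Di : ∀ a e → D a e i ≡ a
        Di a e = cel-i i j a a e
        Dj : ∀ a e → D a e j ≡ a
        Dj a e = cel-j i j a a e ij
        Dk : ∀ a e → D a e k ≡ e
        Dk a e = cel-k i j a a e k ki kj
        at : ∀ a e → P i k (D a e) ⊎ P j k (D a e)
        at a e = pigeon _ _ _ (λ q → forb c (D a e) p q m (λ x y → m (trans x (trans (Di a e) (trans (sym (Dj a e)) (sym y))))))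
        tf : ∀ {l} a e a' e' → (∀ a e → D a e l ≡ a) → P l k (D a e) → P l k (D a' e') → a ≢ e → (a ≡ a' → e ≢ e') → ⊥
        tf a e a' e' h q q' n f = forb (D a e) (D a' e') q q' (λ x → n (trans (sym (h a e)) (trans x (Dk a e)))) (λ x y → f (trans (sym (h a e)) (trans x (h a' e'))) (trans (sym (Dk a e)) (trans y (Dk a' e'))))
        go : P i k (D true false) ⊎ P j k (D true false) → P i k (D false true) ⊎ P j k (D false true) → P i k (D true true) ⊎ P j k (D true true) → ⊥
        go (inj₁ x) (inj₁ y) _ = tf {i} true false false true Di x y (λ ()) (λ ())
        go (inj₂ x) (inj₂ y) _ = tf {j} true false false true Dj x y (λ ()) (λ ())
        go (inj₁ x) (inj₂ y) (inj₁ z) = tf {i} true false true true Di x z (λ ()) (λ _ ())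
        go (inj₁ x) (inj₂ y) (inj₂ z) = tf {j} false true true true Dj y z (λ ()) (λ ())
        go (inj₂ x) (inj₁ y) (inj₂ z) = tf {j} true false true true Dj x z (λ ()) (λ _ ())
        go (inj₂ x) (inj₁ y) (inj₁ z) = tf {i} false true true true Di y z (λ ()) (λ ())

      -- Among three Booleans of `T c` two coincide, and by `alike` neither can be the one at `k`.
      twin : ∀ {i j k} c → k ≢ i → k ≢ j → c i ≡ c j → c k ≢ c i → P i j c
      twin {i} {j} {k} c ki kj e n with T c i ≟B T c j
      ... | yes q = q
      ... | no q with pigeon _ _ (T c k) q
      ... | inj₁ p = ⊥-elim (n (alike c ki (sym p)))
      ... | inj₂ p = ⊥-elim (n (trans (alike c kj (sym p)) (sym e)))

      private
        -- The last two of the six points have fixed values true and false; they supply the third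
        -- index with a different value that `twin` asks for.
        cell2 : Bool → Bool → Cell
        cell2 p q zero = p
        cell2 p q (suc zero) = q
        cell2 p q (suc (suc zero)) = p
        cell2 p q (suc (suc (suc zero))) = q
        cell2 p q (suc (suc (suc (suc zero)))) = true
        cell2 p q (suc (suc (suc (suc (suc zero))))) = false

        y₀ z₀ y₁ z₁ : Fin 6
        y₀ = zero
        z₀ = suc zero
        y₁ = suc (suc zero)
        z₁ = suc (suc (suc zero))

        Pyy : ∀ p q → P y₀ y₁ (cell2 p q)
        Pyy true q = twin {k = suc (suc (suc (suc (suc zero))))} (cell2 true q) (λ ()) (λ ()) refl (λ ())
        Pyy false q = twin {k = suc (suc (suc (suc zero)))} (cell2 false q) (λ ()) (λ ()) refl (λ ())

        Pzz : ∀ p q → P z₀ z₁ (cell2 p q)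
        Pzz p true = twin {k = suc (suc (suc (suc (suc zero))))} (cell2 p true) (λ ()) (λ ()) refl (λ ())
        Pzz p false = twin {k = suc (suc (suc (suc zero)))} (cell2 p false) (λ ()) (λ ()) refl (λ ())

      module Single (e₀ : E (d y₀) (d z₀) ≡ true) (e₁ : E (d y₁) (d z₁) ≡ true)
        (k₀ : E (dd y₀) (dd z₀) ≡ true) (k₁ : E (dd y₁) (dd z₁) ≡ false) where

        private
          put : ∀ {A : Set} {n} → Fin n → A → (Fin n → A) → Fin n → A
          put s₀ x r s with s ≟F s₀
          ... | yes _ = x
          ... | no _ = r s

          -- The pairs at indices `y₀`, `z₀` and `y₁`, `z₁` look alike from the preimages of the
          -- leaves, but `g` keeps the arc of the first and reverses that of the second. Taking the
          -- images of `z₀` and `z₁` as leaf `s₀` changes this one arm.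
          one : ∀ {n} (M : Fin n → Fin n → Bool) → Odd M → ∀ τ s₀ → Rel M (put s₀ true τ) (put s₀ false τ)
          one {n} M o τ s₀ with build n M o (λ s → cell2 (not (τ s)) (not (M s₀ s))) []
          ... | r , B = dd y₀ , dd y₁ , put s₀ (dd z₀) r , put s₀ (dd z₁) r ,
                star y₀ z₀ true k₀ (λ s → cong not refl) (λ s → refl) (λ q → di≢ y₀ z₀ (λ ()) q) , star y₁ z₁ false k₁ (λ s → refl) (λ s → refl) (λ q → di≢ y₁ z₁ (λ ()) q) , fin
            where
            di≢ : ∀ i j → i ≢ j → dd i ≢ dd j
            di≢ i j n q = n (ddi q)
            star : ∀ y z b → E (dd y) (dd z) ≡ b → (∀ s → not (cell2 (not (τ s)) (not (M s₀ s)) y) ≡ not (not (τ s))) → (∀ s → cell2 (not (τ s)) (not (M s₀ s)) z ≡ not (M s₀ s)) →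
              dd y ≢ dd z → Star (dd y) (put s₀ (dd z) r) (put s₀ b τ) M
            star y z b e hy hz yz = record { inj = λ {i} {j} → ij i j ; off = of ; arm = ar ; mat = mt }
              where
              ij : ∀ i j → put s₀ (dd z) r i ≡ put s₀ (dd z) r j → i ≡ j
              ij i j q with i ≟F s₀ | j ≟F s₀
              ... | yes a | yes b = trans a (sym b)
              ... | yes _ | no _ = ⊥-elim (off B j z (sym q))
              ... | no _ | yes _ = ⊥-elim (off B i z q)
              ... | no _ | no _ = inj B q
              of : ∀ s → dd y ≢ put s₀ (dd z) r s
              of s q with s ≟F s₀
              ... | yes _ = yz q
              ... | no _ = off B s y (sym q)
              ar : ∀ s → E (dd y) (put s₀ (dd z) r s) ≡ put s₀ b τ s
              ar s with s ≟F s₀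
              ... | yes _ = e
              ... | no _ = trans (flip' (off B s y) (img B s y)) (trans (hy s) (not-involutive _))
              mt : ∀ s s' → s ≢ s' → E (put s₀ (dd z) r s) (put s₀ (dd z) r s') ≡ M s s'
              mt s s' n with s ≟F s₀ | s' ≟F s₀
              ... | yes a | yes b = ⊥-elim (n (trans a (sym b)))
              ... | yes refl | no q = trans (flip' (off B s' z) (img B s' z)) (trans (cong not (hz s')) (not-involutive _))
              ... | no q | yes refl = trans (img B s z) (trans (hz s) (sym (o s₀ s (λ e → q (sym e)))))
              ... | no _ | no _ = mat B s s' n
            fr : Fin n → ℕ
            fr s = from g (r s)
            frd : ∀ s k → fr s ≢ d k
            frd s k e = off B s k (trans (sym (to-from g (r s))) (cong (to g) e))
            fri : Inj fr
            fri {s} {s'} e = inj B (trans (sym (to-from g _)) (trans (cong (to g) e) (to-from g _)))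
            tup : Fin 6 → Fin 6 → Fin (suc (suc n)) → ℕ
            tup y z = cons (d y) (cons (d z) fr)
            ti : ∀ {y z} → y ≢ z → Inj (tup y z)
            ti n {zero} {zero} e = refl
            ti n {zero} {suc zero} e = ⊥-elim (n (di e))
            ti n {zero} {suc (suc j)} e = ⊥-elim (frd j _ (sym e))
            ti n {suc zero} {zero} e = ⊥-elim (n (di (sym e)))
            ti n {suc zero} {suc zero} e = refl
            ti n {suc zero} {suc (suc j)} e = ⊥-elim (frd j _ (sym e))
            ti n {suc (suc i)} {zero} e = ⊥-elim (frd i _ e)
            ti n {suc (suc i)} {suc zero} e = ⊥-elim (frd i _ e)
            ti n {suc (suc i)} {suc (suc j)} e = cong (λ k → suc (suc k)) (fri e)
            dy : ∀ s → E (fr s) (d y₀) ≡ E (fr s) (d y₁)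
            dy s = trans (dom B s y₀) (trans (Pyy (not (τ s)) (not (M s₀ s))) (sym (dom B s y₁)))
            dz : ∀ s → E (fr s) (d z₀) ≡ E (fr s) (d z₁)
            dz s = trans (dom B s z₀) (trans (Pzz (not (τ s)) (not (M s₀ s))) (sym (dom B s z₁)))
            fl : ∀ {a b c} → a ≢ b → a ≢ c → E a b ≡ E a c → E b a ≡ E c a
            fl p q e = trans (flip' p e) (sym (flip q))
            ts : ∀ i j → E (tup y₀ z₀ i) (tup y₀ z₀ j) ≡ E (tup y₁ z₁ i) (tup y₁ z₁ j)
            ts zero zero = trans (irrefl _) (sym (irrefl _))
            ts zero (suc zero) = trans e₀ (sym e₁)
            ts zero (suc (suc j)) = fl (frd j y₀) (frd j y₁) (dy j)
            ts (suc zero) zero = trans (asym _ _ e₀) (sym (asym _ _ e₁))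
            ts (suc zero) (suc zero) = trans (irrefl _) (sym (irrefl _))
            ts (suc zero) (suc (suc j)) = fl (frd j z₀) (frd j z₁) (dz j)
            ts (suc (suc i)) zero = dy i
            ts (suc (suc i)) (suc zero) = dz i
            ts (suc (suc i)) (suc (suc j)) = refl
            mv = conjugate (homG (tup y₀ z₀) (tup y₁ z₁) (ti {y₀} {z₀} (λ ())) (ti {y₁} {z₁} (λ ())) ts)
            fin : Eqv (cons (dd y₀) (put s₀ (dd z₀) r)) (cons (dd y₁) (put s₀ (dd z₁) r))
            fin = proj₁ mv , λ { zero → proj₂ mv zero ; (suc s) → h s }
              where
              h : ∀ s → to (proj₁ mv) (put s₀ (dd z₀) r s) ≡ put s₀ (dd z₁) r s
              h s with s ≟F s₀
              ... | yes _ = proj₂ mv (suc zero)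
              ... | no _ = trans (cong (to (proj₁ mv)) (sym (to-from g (r s)))) (trans (proj₂ mv (suc (suc s))) (to-from g (r s)))

          many : ∀ {n} (M : Fin n → Fin n → Bool) → Odd M → ∀ L τ τ' → (∀ s → ¬ (s ∈ L) → τ s ≡ τ' s) → Rel M τ τ'
          many M o [] τ τ' h = rel-cong (λ s → not-involutive (τ s)) (λ s → trans (not-involutive (τ s)) (h s (λ ()))) (cells M o (λ s _ → not (τ s)) y₀ y₀ (λ _ → refl))
          many M o (s₀ ∷ L) τ τ' h = rel-trans step (many M o L (put s₀ (τ' s₀) τ) τ' h')
            where
            h' : ∀ s → ¬ (s ∈ L) → put s₀ (τ' s₀) τ s ≡ τ' s
            h' s n with s ≟F s₀
            ... | yes refl = refl
            ... | no k = h s (λ { (here e) → k e ; (there m) → n m })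
            self : ∀ b → τ s₀ ≡ b → ∀ s → put s₀ b τ s ≡ τ s
            self b e s with s ≟F s₀
            ... | yes refl = sym e
            ... | no _ = refl
            same : ∀ b → τ s₀ ≡ b → τ' s₀ ≡ b → Rel M τ (put s₀ (τ' s₀) τ)
            same b e e' = rel-cong (λ s → not-involutive (τ s)) (λ s → trans (not-involutive (τ s)) (sym (self (τ' s₀) (trans e (sym e')) s))) (cells M o (λ s _ → not (τ s)) y₀ y₀ (λ _ → refl))
            step : Rel M τ (put s₀ (τ' s₀) τ)
            step with bool-em (τ s₀) | bool-em (τ' s₀)
            ... | inj₁ a | inj₁ b = same true a b
            ... | inj₂ a | inj₂ b = same false a b
            ... | inj₁ a | inj₂ b = subst (λ c → Rel M τ (put s₀ c τ)) (sym b) (rel-cong (self true a) (λ _ → refl) (one M o τ s₀))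
            ... | inj₂ a | inj₁ b = subst (λ c → Rel M τ (put s₀ c τ)) (sym b) (rel-cong (self false a) (λ _ → refl) (rel-sym (one M o τ s₀)))

        sc : SC
        sc {n} M τ o = many M o (tabulate (λ i → i)) τ (λ s → not (τ s)) (λ s k → ⊥-elim (k (∈-tabulate⁺ s)))

  private
    orientArc : ∀ g {a b} → a ≢ b → (R : Bool → Bool) → (∀ x → R (not x) ≡ not (R x)) → E (to g a) (to g b) ≡ R (E a b) → Σ ℕ λ c → Σ ℕ λ d → (E c d ≡ true) × (E (to g c) (to g d) ≡ R true)
    orientArc g {a} {b} n R odd e with bool-em (E a b)
    ... | inj₁ t = a , b , t , trans e (cong R t)
    ... | inj₂ f = b , a , farc n f , trans (flip' (λ q → n (toinj g q)) e) (trans (sym (odd (E a b))) (cong (λ x → R (not x)) f))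

    freshArc : (L : List ℕ) → Σ ℕ λ m → Σ ℕ λ n → (E m n ≡ true) × (∀ x → x ∈ L → (m ≢ x) × (n ≢ x))
    freshArc L with extL [] [] L
    ... | n , _ , a with extL ((n , true) ∷ []) ([] ∷ []) L
    ... | m , (_ , e) ∷ [] , b = m , n , e , λ x i → b x i , a x i

  Mixed : Set
  Mixed = Σ G λ g → Σ ℕ λ a → Σ ℕ λ b → Σ ℕ λ c → Σ ℕ λ d → (E a b ≡ true) × (E c d ≡ true) × (E (to g a) (to g b) ≡ true) × (E (to g c) (to g d) ≡ false)

  mixed : ¬ Mixed → Rigid
  mixed nm g with em {Σ ℕ λ a → Σ ℕ λ b → E (to g a) (to g b) ≢ E a b}
  ... | no n = inj₁ pr
    where
    pr : ∀ a b → E (to g a) (to g b) ≡ E a b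
    pr a b with E (to g a) (to g b) ≟B E a b
    ... | yes e = e
    ... | no k = ⊥-elim (n (a , b , k))
  ... | yes (a , b , k) = inj₂ rv
    where
    ab : a ≢ b
    ab refl = k (trans (irrefl _) (sym (irrefl _)))
    rv : ∀ {x y} → x ≢ y → E (to g x) (to g y) ≡ not (E x y)
    rv {x} {y} n with E (to g x) (to g y) ≟B not (E x y)
    ... | yes e = e
    ... | no l with orientArc g ab not (λ _ → refl) (≢→not k) | orientArc g n (λ z → z) (λ _ → refl) (trans (≢→not l) (not-involutive _))
    ... | c , d , e1 , e2 | p , q , e3 , e4 = ⊥-elim (nm (g , p , q , c , d , e3 , e1 , e4 , e2))

  private
    disj : Mixed → Σ G λ g → Σ ℕ λ a → Σ ℕ λ b → Σ ℕ λ c → Σ ℕ λ d → (E a b ≡ true) × (E c d ≡ true) × (E (to g a) (to g b) ≡ true) × (E (to g c) (to g d) ≡ false) ×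
      ((a ≢ c) × (a ≢ d) × (b ≢ c) × (b ≢ d))
    disj (g , a , b , c , d , ab , cd , k , r) with freshArc (a ∷ b ∷ c ∷ d ∷ [])
    ... | m , n , mn , f with bool-em (E (to g m) (to g n)) | f a (here refl) | f b (there (here refl)) | f c (there (there (here refl))) | f d (there (there (there (here refl))))
    ... | inj₁ t | _ | _ | mc , nc | md , nd = g , m , n , c , d , mn , cd , t , r , (mc , md , nc , nd)
    ... | inj₂ t | ma , na | mb , nb | _ | _ = g , a , b , m , n , ab , mn , k , t , ((λ e → ma (sym e)) , (λ e → na (sym e)) , (λ e → mb (sym e)) , (λ e → nb (sym e)))

    inj6 : ∀ (xs : List ℕ) → AllPairs _≢_ xs → ∀ i j → Data.List.lookup xs i ≡ Data.List.lookup xs j → i ≡ j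
    inj6 xs ap i j e with i ≟F j
    ... | yes q = q
    ... | no n with allpairs-lookup xs ap i j n
    ... | inj₁ k = ⊥-elim (k e)
    ... | inj₂ k = ⊥-elim (k (sym e))

  opaque
    rigid-or-star : Rigid ⊎ StarFlip
    rigid-or-star with em {Mixed}
    ... | no n = inj₁ (mixed n)
    ... | yes mx with disj mx
    ... | g , a , b , c , d , ab , cd , k , r , (ac , ad , bc , bd) with freshArc (a ∷ b ∷ c ∷ d ∷ [])
    ... | m , n , mn , f = inj₂ (star-flip sc')
      where
      xs : List ℕ
      xs = a ∷ b ∷ c ∷ d ∷ m ∷ n ∷ []
      ap : AllPairs _≢_ xs
      ap = (arc≢ ab ∷ ac ∷ ad ∷ no' (proj₁ (f a (here refl))) ∷ no' (proj₂ (f a (here refl))) ∷ []) ∷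
           (bc ∷ bd ∷ no' (proj₁ (f b (there (here refl)))) ∷ no' (proj₂ (f b (there (here refl)))) ∷ []) ∷
           (arc≢ cd ∷ no' (proj₁ (f c (there (there (here refl))))) ∷ no' (proj₂ (f c (there (there (here refl))))) ∷ []) ∷
           (no' (proj₁ (f d (there (there (there (here refl)))))) ∷ no' (proj₂ (f d (there (there (there (here refl)))))) ∷ []) ∷
           (arc≢ mn ∷ []) ∷ [] ∷ []
        where no' : ∀ {x y : ℕ} → x ≢ y → y ≢ x
              no' n e = n (sym e)
      dv : Fin 6 → ℕ
      dv = Data.List.lookup xs
      module Cf = Config g dv (λ {i} {j} → inj6 xs ap i j)
      sc' : Cf.SC
      sc' with em {Cf.SC}
      ... | yes s = s
      ... | no ns = Cf.NoStar.Single.sc ns ab cd k r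

-- Triads, and the case of a rigid automorphism group.

triad : (ℕ → ℕ → Bool) → ℕ → ℕ → ℕ → Bool
triad E a b c = E a b xor (E b c xor E c a)

module Triads (w : CoreClone) where
  open CoreCloneProps w

  C3w : (ℕ → ℕ → ℕ → ℕ) → Set
  C3w s = C {3} (λ v → s (v zero) (v (suc zero)) (v (suc (suc zero))))

  -- Reversing all arcs at a point changes two arcs of each triple through it. Triads survive
  -- switching while single arcs do not.
  FollowsTriads : ∀ {k} → Op k → Fin k → Set
  FollowsTriads f j = Σ Bool λ σ → ∀ {x y z} → x # y → y # z → z # x → triad E (f x) (f y) (f z) ≡ (σ xor triad E (x j) (y j) (z j))

  FollowsArcs : ∀ {k} → Op k → Fin k → Set
  FollowsArcs f j = Σ Bool λ σ → ∀ {x y} → x # y → E (f x) (f y) ≡ (σ xor E (x j) (y j))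

  arcs-triads : ∀ {k} {f : Op k} {j} → FollowsArcs f j → FollowsTriads f j
  arcs-triads {j = j} (σ , h) = σ , λ {x} {y} {z} xy yz zx → trans (cong₂ _xor_ (h xy) (cong₂ _xor_ (h yz) (h zx))) (cube σ (E (x j) (y j)) (E (y j) (z j)) (E (z j) (x j)))
    where
    nots : ∀ a b c → (not a xor (not b xor not c)) ≡ not (a xor (b xor c))
    nots true true true = refl
    nots true true false = refl
    nots true false true = refl
    nots true false false = refl
    nots false true true = refl
    nots false true false = refl
    nots false false true = refl
    nots false false false = refl
    cube : ∀ σ a b c → ((σ xor a) xor ((σ xor b) xor (σ xor c))) ≡ (σ xor (a xor (b xor c)))
    cube true = nots
    cube false a b c = refl

  Essential : Set
  Essential = Separation.Essential opClone

  module RigidCase (rigid : Rigid) where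

    Up Dn : ∀ {k} → Op k → Set
    Up f = ∀ {x y} → (∀ j → E (x j) (y j) ≡ true) → E (f x) (f y) ≡ true
    Dn f = ∀ {x y} → (∀ j → E (x j) (y j) ≡ true) → E (f x) (f y) ≡ false

    private
      keeps : ∀ g {a b c d} → E a b ≡ true → E c d ≡ true → E (to g a) (to g b) ≡ E (to g c) (to g d)
      keeps g {a} {b} {c} {d} e e' with rigid g
      ... | inj₁ p = trans (p a b) (trans e (sym (trans (p c d) e')))
      ... | inj₂ p = trans (p (arc≢ e)) (trans (cong not (trans e (sym e'))) (sym (p (arc≢ e'))))

      Gen : ∀ {k} → ℕ → (Fin k → ℕ) → Set
      Gen r x = ∀ j → (r ≢ x j) × (E r (x j) ≡ true)

      -- Group elements carry the first coordinate pair to the others and fix `r` and `s`. Along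
      -- them `f` is unary, hence a group element on these four points, and a rigid one treats both
      -- arcs alike.
      via : ∀ {k} {f : Op (suc k)} → C f → ∀ {x y} → (∀ j → E (x j) (y j) ≡ true) → ∀ {r s} → E r s ≡ true → Gen r x → Gen r y → Gen s x → Gen s y →
        E (f x) (f y) ≡ E (f (λ _ → r)) (f (λ _ → s))
      via {k} {f} cf {x} {y} xy {r} {s} rs rx ry sx sy = fin (core {λ u → f (λ j → to (m j) u)} (Ccomp {g = λ j v → to (m j) (v zero)} cf (λ j → CG (m j))) (x zero ∷ y zero ∷ r ∷ s ∷ []))
        where
        gse : ∀ {r} {x : Fin (suc k) → ℕ} → Gen r x → ∀ j → SE (x zero) r (x j) r
        gse g j = sw-se (se (proj₁ (g zero)) (proj₁ (g j)) (trans (proj₂ (g zero)) (sym (proj₂ (g j)))))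
        H : ∀ j → Σ G λ g → All (λ p → to g (proj₁ p) ≡ proj₂ p) ((x zero , x j) ∷ (y zero , y j) ∷ (r , r) ∷ (s , s) ∷ [])
        H j = homGL _ ((se (arc≢ (xy zero)) (arc≢ (xy j)) (trans (xy zero) (sym (xy j))) ∷ gse rx j ∷ gse sx j ∷ []) ∷ (gse ry j ∷ gse sy j ∷ []) ∷ ((refl , refl) ∷ []) ∷ [] ∷ [])
        m : Fin (suc k) → G
        m j = proj₁ (H j)
        fin : _ → _
        fin (g , h) = trans (sym (cong₂ E (trans (h (x zero) (here refl)) (Cext cf (λ j → All.lookup (proj₂ (H j)) (here refl)))) (trans (h (y zero) (there (here refl))) (Cext cf (λ j → All.lookup (proj₂ (H j)) (there (here refl)))))))
          (trans (keeps g (xy zero) rs) (cong₂ E (trans (h r (there (there (here refl)))) (Cext cf (λ j → All.lookup (proj₂ (H j)) (there (there (here refl)))))) (trans (h s (there (there (there (here refl))))) (Cext cf (λ j → All.lookup (proj₂ (H j)) (there (there (there (here refl)))))))))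

      same : ∀ {k} {f : Op (suc k)} → C f → ∀ {x y x' y'} → (∀ j → E (x j) (y j) ≡ true) → (∀ j → E (x' j) (y' j) ≡ true) → E (f x) (f y) ≡ E (f x') (f y')
      same cf {x} {y} {x'} {y'} e e' with ext (tabulate x ++ tabulate y ++ tabulate x' ++ tabulate y') (λ _ → true)
      ... | s , hs with ext (s ∷ tabulate x ++ tabulate y ++ tabulate x' ++ tabulate y') (λ _ → true)
      ... | r , hr = trans (via cf e (proj₂ (hr s (here refl))) (λ j → hr _ (there (i1 j))) (λ j → hr _ (there (i2 j))) (λ j → hs _ (i1 j)) (λ j → hs _ (i2 j)))
          (sym (via cf e' (proj₂ (hr s (here refl))) (λ j → hr _ (there (i3 j))) (λ j → hr _ (there (i4 j))) (λ j → hs _ (i3 j)) (λ j → hs _ (i4 j))))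
        where
        i1 : ∀ j → x j ∈ tabulate x ++ tabulate y ++ tabulate x' ++ tabulate y'
        i1 j = ∈-++⁺ˡ (∈-tabulate⁺ {f = x} j)
        i2 : ∀ j → y j ∈ tabulate x ++ tabulate y ++ tabulate x' ++ tabulate y'
        i2 j = ∈-++⁺ʳ (tabulate x) (∈-++⁺ˡ (∈-tabulate⁺ {f = y} j))
        i3 : ∀ j → x' j ∈ tabulate x ++ tabulate y ++ tabulate x' ++ tabulate y'
        i3 j = ∈-++⁺ʳ (tabulate x) (∈-++⁺ʳ (tabulate y) (∈-++⁺ˡ (∈-tabulate⁺ {f = x'} j)))
        i4 : ∀ j → y' j ∈ tabulate x ++ tabulate y ++ tabulate x' ++ tabulate y'
        i4 j = ∈-++⁺ʳ (tabulate x) (∈-++⁺ʳ (tabulate y) (∈-++⁺ʳ (tabulate x') (∈-tabulate⁺ {f = y'} j)))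

    no-nullary : ∀ {f : Op 0} → C f → ⊥
    no-nullary cf = strictW cf {λ ()} {λ ()} (λ ()) refl

    updn : ∀ {k} {f : Op k} → C f → Up f ⊎ Dn f
    updn {zero} cf = ⊥-elim (no-nullary cf)
    updn {suc k} {f} cf with ext (0 ∷ []) (λ _ → true)
    ... | a , h with bool-em (E (f (λ _ → a)) (f (λ _ → 0)))
    ... | inj₁ t = inj₁ (λ {x} {y} e → trans (same cf {x} {y} {λ _ → a} {λ _ → 0} e (λ _ → proj₂ (h 0 (here refl)))) t)
    ... | inj₂ t = inj₂ (λ {x} {y} e → trans (same cf {x} {y} {λ _ → a} {λ _ → 0} e (λ _ → proj₂ (h 0 (here refl)))) t)

    private
      -- Adding two dominating points gives even the shortest tuple an arc. A group element that
      -- extends the enlarged map keeps this arc, and by rigidity all arcs.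
      tall : ∀ {n} (a : Fin n → ℕ) → Inj a → Σ (Fin (suc (suc n)) → ℕ) λ a' → Inj a' × (∀ i → a' (suc (suc i)) ≡ a i) × (E (a' zero) (a' (suc zero)) ≡ true) × (∀ i → E (a' zero) (a i) ≡ true) × (∀ i → E (a' (suc zero)) (a i) ≡ true)
      tall {n} a ia with ext (tabulate a) (λ _ → true)
      ... | z , hz with ext (z ∷ tabulate a) (λ _ → true)
      ... | y , hy = cons y (cons z a) , (λ {i} {j} → ij i j) , (λ _ → refl) , proj₂ (hy z (here refl)) , (λ i → proj₂ (hy _ (there (∈-tabulate⁺ i)))) , (λ i → proj₂ (hz _ (∈-tabulate⁺ i)))
        where
        ya : ∀ j → y ≢ a j
        ya j = proj₁ (hy _ (there (∈-tabulate⁺ j)))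
        za : ∀ j → z ≢ a j
        za j = proj₁ (hz _ (∈-tabulate⁺ j))
        yz : y ≢ z
        yz = proj₁ (hy z (here refl))
        ij : ∀ i j → cons y (cons z a) i ≡ cons y (cons z a) j → i ≡ j
        ij zero zero e = refl
        ij zero (suc zero) e = ⊥-elim (yz e)
        ij zero (suc (suc j)) e = ⊥-elim (ya j e)
        ij (suc zero) zero e = ⊥-elim (yz (sym e))
        ij (suc zero) (suc zero) e = refl
        ij (suc zero) (suc (suc j)) e = ⊥-elim (za j e)
        ij (suc (suc i)) zero e = ⊥-elim (ya i (sym e))
        ij (suc (suc i)) (suc zero) e = ⊥-elim (za i (sym e))
        ij (suc (suc i)) (suc (suc j)) e = cong (λ k → suc (suc k)) (ia e)

      upG : ∀ g {a b} → E a b ≡ true → E (to g a) (to g b) ≡ true → ∀ x y → E (to g x) (to g y) ≡ E x y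
      upG g e e' with rigid g
      ... | inj₁ p = p
      ... | inj₂ p = ⊥-elim (t≢f e' (trans (p (arc≢ e)) (cong not e)))

      hom0 : ∀ {n} (a b : Fin n → ℕ) → Inj a → Inj b → (∀ i j → E (a i) (a j) ≡ E (b i) (b j)) →
        Σ (ℕ → ℕ) λ u → (C {1} (λ v → u (v zero)) × Up {1} (λ v → u (v zero))) × (∀ i → u (a i) ≡ b i)
      hom0 a b ia ib s with tall a ia | tall b ib
      ... | a' , ia' , ea , a01 , a0 , a1 | b' , ib' , eb , b01 , b0 , b1 with homG a' b' ia' ib' sm
        where
        fl : ∀ {x y x' y'} → E x y ≡ true → E x' y' ≡ true → E y x ≡ E y' x'
        fl e e' = trans (asym _ _ e) (sym (asym _ _ e'))
        sm : ∀ i j → E (a' i) (a' j) ≡ E (b' i) (b' j)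
        sm zero zero = trans (irrefl _) (sym (irrefl _))
        sm zero (suc zero) = trans a01 (sym b01)
        sm zero (suc (suc j)) = trans (cong (E (a' zero)) (ea j)) (trans (trans (a0 j) (sym (b0 j))) (cong (E (b' zero)) (sym (eb j))))
        sm (suc zero) zero = fl a01 b01
        sm (suc zero) (suc zero) = trans (irrefl _) (sym (irrefl _))
        sm (suc zero) (suc (suc j)) = trans (cong (E (a' (suc zero))) (ea j)) (trans (trans (a1 j) (sym (b1 j))) (cong (E (b' (suc zero))) (sym (eb j))))
        sm (suc (suc i)) zero = trans (cong (λ u → E u (a' zero)) (ea i)) (trans (fl (a0 i) (b0 i)) (cong (λ u → E u (b' zero)) (sym (eb i))))
        sm (suc (suc i)) (suc zero) = trans (cong (λ u → E u (a' (suc zero))) (ea i)) (trans (fl (a1 i) (b1 i)) (cong (λ u → E u (b' (suc zero))) (sym (eb i))))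
        sm (suc (suc i)) (suc (suc j)) = trans (cong₂ E (ea i) (ea j)) (trans (s i j) (cong₂ E (sym (eb i)) (sym (eb j))))
      ... | g , h = to g , (CG g , λ {x} {y} e → trans (upG g a01 (trans (cong₂ E (h zero) (h (suc zero))) b01) _ _) (e zero)) , λ i → trans (cong (to g) (sym (ea i))) (trans (h (suc (suc i))) (eb i))

    cl₀ : OpClone
    cl₀ = record { em = em ; E = E ; tour = tour ; ext = ext ; C = λ f → C f × Up f ; Cext = λ c → Cext (proj₁ c)
      ; Cproj = λ j → Cproj j , λ e → e j
      ; Ccomp = λ { (cf , uf) h → Ccomp cf (λ j → proj₁ (h j)) , λ e → uf (λ j → proj₂ (h j) e) }
      ; hom = hom0 ; strict = λ c → strictW (proj₁ c) }

    pres₀ : ∀ {k} {f : Op k} → OpClone.C cl₀ f → ∀ {x y} → (∀ j → E (x j) (y j) ≡ true) → E (f x) (f y) ≡ true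
    pres₀ (_ , u) = u

    closed₀ : ∀ (h : ℕ → ℕ → ℕ) → (∀ (L : List (ℕ × ℕ)) → Σ (ℕ → ℕ → ℕ) λ g → OpCloneProps.C2 cl₀ g × (∀ x y → (x , y) ∈ L → g x y ≡ h x y)) → OpCloneProps.C2 cl₀ h
    closed₀ h loc = OpCloneProps.mk2 (closed f (λ e → cong₂ h (e zero) (e (suc zero))) (λ L → let (g , cg , q) = loc (map pr L) in
          (λ v → g (v zero) (v (suc zero))) , proj₁ (OpCloneProps.un2 cg) , λ x m → q _ _ (∈-map⁺ pr m)) , up)
      where
      f : Op 2
      f v = h (v zero) (v (suc zero))
      pr : (Fin 2 → ℕ) → ℕ × ℕ
      pr v = v zero , v (suc zero)
      up : Up f
      up {x} {y} e with loc (pr x ∷ pr y ∷ [])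
      ... | g , cg , q = subst₂ (λ u v → E u v ≡ true) (q _ _ (here refl)) (q _ _ (there (here refl))) (proj₂ (OpCloneProps.un2 cg) {x} {y} e)

    -- An arc-reversing operation followed by its own diagonal, which also reverses arcs, preserves
    -- them. This puts an essential operation into the arc-preserving clone and reads off the
    -- coordinate of a reversing operation.
    rigid-cases : Essential → (∀ {k} {f : Op k} → C f → Σ (Fin k) (FollowsArcs f)) ⊎ LocalCyclic E C3w
    rigid-cases ess with ArcDichotomy.local-cases cl₀ pres₀ closed₀ ess₀
      where
      open Separation.Essential ess
      up-ess : ∀ {e : ℕ → ℕ} → (∀ {x y} → x ≢ y → e x ≢ e y) → C {2} (λ v → e (h (v zero) (v (suc zero)))) → Up {2} (λ v → e (h (v zero) (v (suc zero)))) → Separation.Essential cl₀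
      up-ess {e} ie c u = record { h = λ x y → e (h x y) ; ch = OpCloneProps.mk2 (c , u) ; a = a ; b = b ; c = Separation.Essential.c ess ; d1 = ie d1 ; a' = a' ; c' = c' ; d' = d' ; d2 = ie d2 }
      ess₀ : Separation.Essential cl₀
      ess₀ with updn (OpCloneProps.un2 ch)
      ... | inj₁ u = up-ess {λ x → x} (λ n → n) (OpCloneProps.un2 ch) u
      ... | inj₂ dn = up-ess {λ x → h x x} (λ {x} {y} n → strictW (OpCloneProps.un2 ch) {two x x} {two y y} (λ { zero → n ; (suc zero) → n }))
            (Ccomp {g = λ _ v → h (v zero) (v (suc zero))} (Ccomp {g = λ _ v → v zero} (OpCloneProps.un2 ch) (λ _ → Cproj zero)) (λ (_ : Fin 1) → OpCloneProps.un2 ch))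
            (λ {x} {y} e → let r = dn {x} {y} e ; n = strictW (OpCloneProps.un2 ch) (λ j → arc≢ (e j)) ; r' = farc n r in
              farc (λ q → strictW (OpCloneProps.un2 ch) {two (h (y zero) (y (suc zero))) (h (y zero) (y (suc zero)))} {two (h (x zero) (x (suc zero))) (h (x zero) (x (suc zero)))} (λ { zero → λ k → n (sym k) ; (suc zero) → λ k → n (sym k) }) q)
                (dn {two (h (y zero) (y (suc zero))) (h (y zero) (y (suc zero)))} {two (h (x zero) (x (suc zero))) (h (x zero) (x (suc zero)))} (λ { zero → r' ; (suc zero) → r' })))
    ... | inj₂ (β , cy , loc) = inj₂ (β , cy , λ F → let (s , cs , h) = loc F in s , proj₁ (OpCloneProps.un3 cs) , λ {x} {y} {z} → h {x} {y} {z})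
    ... | inj₁ fol = inj₁ go
      where
      go : ∀ {k} {f : Op k} → C f → Σ (Fin k) (FollowsArcs f)
      go {zero} cf = ⊥-elim (no-nullary cf)
      go {suc k} {f} cf with updn cf
      ... | inj₁ u = let (j , h) = fol (cf , u) in j , false , h
      ... | inj₂ dn = let (j , h) = fol (cef , uef) in j , true , λ n → reversed (h n) n
        where
        e : ℕ → ℕ
        e x = f (λ _ → x)
        ce : C {1} (λ v → e (v zero))
        ce = Ccomp {g = λ _ v → v zero} cf (λ _ → Cproj zero)
        ei : ∀ {x y} → x ≢ y → e x ≢ e y
        ei n = strictW cf (λ _ → n)
        er : ∀ {x y} → x ≢ y → E (e x) (e y) ≡ not (E x y)
        er {x} {y} n with bool-em (E x y)
        ... | inj₁ t = trans (dn (λ _ → t)) (cong not (sym t))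
        ... | inj₂ t = trans (farc (ei (λ q → n (sym q))) (dn (λ _ → farc n t))) (cong not (sym t))
        cef : C (λ v → e (f v))
        cef = Ccomp {g = λ (_ : Fin 1) → f} ce (λ _ → cf)
        uef : Up (λ v → e (f v))
        uef h = trans (er (strictW cf (λ j → arc≢ (h j)))) (cong not (dn h))
        reversed : ∀ {x y b} → E (e (f x)) (e (f y)) ≡ b → x # y → E (f x) (f y) ≡ not b
        reversed p n = trans (sym (not-involutive _)) (cong not (trans (sym (er (strictW cf n))) p))

-- Switching at the point 0.

suc-pred : ∀ {n} → n ≢ 0 → suc (pred n) ≡ n
suc-pred {zero} n = ⊥-elim (n refl)
suc-pred {suc m} n = refl

xor-not : ∀ a b → (not a xor b) ≡ not (a xor b)
xor-not true true = refl
xor-not true false = refl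
xor-not false true = refl
xor-not false false = refl

xor-cancel : ∀ a b → ((a xor b) xor b) ≡ a
xor-cancel true true = refl
xor-cancel true false = refl
xor-cancel false true = refl
xor-cancel false false = refl

delta : ∀ {n} → Fin n → Fin n → Bool
delta i j with j ≟F i
... | yes _ = true
... | no _ = false

delta-at : ∀ {n} (i : Fin n) → delta i i ≡ true
delta-at i with i ≟F i
... | yes _ = refl
... | no k = ⊥-elim (k refl)

delta-off : ∀ {n} {i j : Fin n} → j ≢ i → delta i j ≡ false
delta-off {i = i} {j} k with j ≟F i
... | yes e = ⊥-elim (k e)
... | no _ = refl

module Switching (w : CoreClone) (star : CoreCloneProps.StarFlip w) where
  open CoreCloneProps w

  realizeF : ∀ {n} (M : Fin n → Fin n → Bool) → Odd M → Σ (Fin n → ℕ) λ a → Inj a × (∀ i j → i ≢ j → E (a i) (a j) ≡ M i j)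
  realizeF M o with stars M o (λ _ → true) 0
  ... | a , S = a , Star.inj S , Star.mat S

  -- The points where `K` is true are switched one after the other; `L` contains those still to be
  -- treated.
  cut-eqv : ∀ {n} (L : List (Fin n)) (a b : Fin n → ℕ) → Inj a → Inj b → (K : Fin n → Bool) → (∀ i → ¬ (i ∈ L) → K i ≡ false) →
    (∀ i j → E (b i) (b j) ≡ (E (a i) (a j) xor (K i xor K j))) → Eqv a b
  cut-eqv [] a b ia ib K kf h = homG a b ia ib (λ i j → sym (trans (h i j) (trans (cong₂ (λ u v → E (a i) (a j) xor (u xor v)) (kf i (λ ())) (kf j (λ ()))) (xor-identityʳ _))))
  cut-eqv {n} (i₀ ∷ L) a b ia ib K kf h with bool-em (K i₀)
  ... | inj₂ f = cut-eqv L a b ia ib K kf' h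
    where
    kf' : ∀ i → ¬ (i ∈ L) → K i ≡ false
    kf' i k with i ≟F i₀
    ... | yes refl = f
    ... | no q = kf i (λ { (here e) → q e ; (there m) → k m })
  ... | inj₁ t = eqv-trans (star a a' ia ia' i₀ off on) (cut-eqv L a' b ia' ib K' kf' h')
    where
    M : Fin n → Fin n → Bool
    M j k = E (a j) (a k) xor (delta i₀ j xor delta i₀ k)
    Modd : Odd M
    Modd j k q = trans (cong₂ _xor_ (flip (λ e → q (ia e))) (xor-comm (delta i₀ k) (delta i₀ j))) (xor-not (E (a j) (a k)) _)
    R = realizeF M Modd
    a' = proj₁ R
    ia' : Inj a'
    ia' = proj₁ (proj₂ R)
    full : ∀ j k → E (a' j) (a' k) ≡ M j k
    full j k with j ≟F k
    ... | no q = proj₂ (proj₂ R) j k q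
    ... | yes refl = trans (irrefl _) (sym (trans (cong₂ _xor_ (irrefl (a j)) (xor-same (delta i₀ j))) refl))
    off : ∀ j k → j ≢ i₀ → k ≢ i₀ → E (a j) (a k) ≡ E (a' j) (a' k)
    off j k p q = sym (trans (full j k) (trans (cong₂ (λ u v → E (a j) (a k) xor (u xor v)) (delta-off p) (delta-off q)) (xor-identityʳ _)))
    on : ∀ j → j ≢ i₀ → E (a i₀) (a j) ≡ not (E (a' i₀) (a' j))
    on j p = sym (trans (cong not (trans (full i₀ j) (trans (cong₂ (λ u v → E (a i₀) (a j) xor (u xor v)) (delta-at i₀) (delta-off p)) (xor-comm _ true)))) (not-involutive _))
    K' : Fin n → Bool
    K' j = delta i₀ j xor K j
    kf' : ∀ i → ¬ (i ∈ L) → K' i ≡ false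
    kf' i k with i ≟F i₀
    ... | yes refl = cong not t
    ... | no q = kf i (λ { (here e) → q e ; (there m) → k m })
    h' : ∀ j k → E (b j) (b k) ≡ (E (a' j) (a' k) xor (K' j xor K' k))
    h' j k = trans (h j k) (sym (trans (cong (_xor (K' j xor K' k)) (full j k)) (alg (E (a j) (a k)) (delta i₀ j) (delta i₀ k) (K j) (K k))))
      where
      alg : ∀ e p q x y → ((e xor (p xor q)) xor ((p xor x) xor (q xor y))) ≡ (e xor (x xor y))
      alg = solve 5 (λ e p q x y → (e :+ (p :+ q)) :+ ((p :+ x) :+ (q :+ y)) := e :+ (x :+ y)) refl
        where open xor-∧-Solver

  -- Switching so that 0 dominates every other point and then removing 0 leaves the
  -- tournament E'; arcs of E' are the signs of the triples through 0.
  E' : ℕ → ℕ → Bool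
  E' x y = E (suc x) (suc y) xor (E 0 (suc x) xor E 0 (suc y))

  private
    irr' : ∀ x → E' x x ≡ false
    irr' x = cong₂ _xor_ (irrefl (suc x)) (xor-same (E 0 (suc x)))

    flip0 : ∀ {x y} → x ≢ y → E' y x ≡ not (E' x y)
    flip0 {x} {y} n = trans (cong₂ _xor_ (flip {suc x} {suc y} (λ e → n (cong pred e))) (xor-comm (E 0 (suc y)) (E 0 (suc x)))) (xor-not (E (suc x) (suc y)) _)

  tour' : IsTournament E'
  tour' = record { irrefl = irr' ; total = tot ; asym = as }
    where
    tot : ∀ x y → x ≢ y → (E' x y ≡ true) ⊎ (E' y x ≡ true)
    tot x y n with bool-em (E' x y)
    ... | inj₁ t = inj₁ t
    ... | inj₂ f = inj₂ (trans (flip0 n) (cong not f))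
    as : ∀ x y → E' x y ≡ true → E' y x ≡ false
    as x y t with x ≟ y
    ... | yes refl = irr' x
    ... | no n = trans (flip0 n) (cong not t)

  -- New points are always chosen among the successors of 0.
  ext⁺ : (L : List ℕ) (p : ℕ → Bool) → Σ ℕ λ z → (E 0 (suc z) ≡ true) × (∀ x → x ∈ L → (z ≢ x) × (E' z x ≡ p x))
  ext⁺ L p with ext (0 ∷ map suc L) q
    where
    q : ℕ → Bool
    q zero = false
    q (suc x) = p x xor (true xor E 0 (suc x))
  ... | zero , h = ⊥-elim (proj₁ (h 0 (here refl)) refl)
  ... | suc z , h = z , σz , λ x m → let (n , e) = h (suc x) (there (∈-map⁺ suc m)) in
        (λ k → n (cong suc k)) , trans (cong₂ _xor_ e (cong (_xor E 0 (suc x)) σz)) (xor-cancel (p x) (true xor E 0 (suc x)))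
    where
    σz : E 0 (suc z) ≡ true
    σz = farc (λ ()) (proj₂ (h 0 (here refl)))

  G' : Set
  G' = Σ G λ g → to g 0 ≡ 0

  to' from' : G' → ℕ → ℕ
  to' (g , _) x = pred (to g (suc x))
  from' (g , _) x = pred (from g (suc x))

  suc-to : ∀ g x → suc (to' g x) ≡ to (proj₁ g) (suc x)
  suc-to (g , e) x = suc-pred (λ q → h (toinj g (trans q (sym e))))
    where h : suc x ≢ 0
          h ()

  private
    from0 : ∀ (g : G') → from (proj₁ g) 0 ≡ 0
    from0 (g , e) = trans (cong (from g) (sym e)) (from-to g 0)

    suc-from : ∀ g x → suc (from' g x) ≡ from (proj₁ g) (suc x)
    suc-from (g , e) x = suc-pred (λ q → h (trans (sym (to-from g (suc x))) (trans (cong (to g) q) e)))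
      where h : suc x ≢ 0
            h ()

    -- Local membership makes the clone closed under limits.
    C' : ∀ {k} → Op k → Set
    C' {k} f = (∀ {x y} → x ≗' y → f x ≡ f y) ×
      (∀ (L : List (Fin k → ℕ)) → Σ (Op k) λ F → C F × (F (λ _ → 0) ≡ 0) × (∀ x → x ∈ L → F (λ j → suc (x j)) ≡ suc (f x)))

    -- An isomorphism for `E'`, extended by fixing 0, is one for `E` up to switching at the points
    -- whose arc from 0 changes; these form `K`.
    homG' : ∀ {n} (a b : Fin n → ℕ) → Inj a → Inj b → (∀ i j → E' (a i) (a j) ≡ E' (b i) (b j)) → Σ G' λ g → ∀ i → to' g (a i) ≡ b i
    homG' {n} a b ia ib s = (g , h zero) , λ i → cong pred (h (suc i))
      where
      A B : Fin (suc n) → ℕ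
      A = cons 0 (λ i → suc (a i))
      B = cons 0 (λ i → suc (b i))
      ci : ∀ {c : Fin n → ℕ} → Inj c → Inj (cons 0 (λ i → suc (c i)))
      ci ic {zero} {zero} e = refl
      ci ic {suc i} {suc j} e = cong suc (ic (cong pred e))
      K : Fin (suc n) → Bool
      K zero = false
      K (suc i) = E 0 (suc (a i)) xor E 0 (suc (b i))
      alg : ∀ {ea eb p p' q q'} → (ea xor (p xor p')) ≡ (eb xor (q xor q')) → eb ≡ (ea xor ((p xor q) xor (p' xor q')))
      alg {ea} {eb} {p} {p'} {q} {q'} e = trans (sym (xor-cancel eb (q xor q'))) (trans (cong (_xor (q xor q')) (sym e)) (rea ea p p' q q'))
        where
        rea : ∀ e p p' q q' → ((e xor (p xor p')) xor (q xor q')) ≡ (e xor ((p xor q) xor (p' xor q')))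
        rea = solve 5 (λ e p p' q q' → (e :+ (p :+ p')) :+ (q :+ q') := e :+ ((p :+ q) :+ (p' :+ q'))) refl
          where open xor-∧-Solver
      cut : ∀ i j → E (B i) (B j) ≡ (E (A i) (A j) xor (K i xor K j))
      cut zero zero = trans (irrefl 0) (sym (cong (_xor false) (irrefl 0)))
      cut zero (suc j) = sym (trans (cong (E 0 (suc (a j)) xor_) refl) (c (E 0 (suc (a j))) _))
        where c : ∀ p q → (p xor (p xor q)) ≡ q
              c true q = not-involutive q
              c false q = refl
      cut (suc i) zero = trans (flip {0} (λ ())) (sym (trans (cong₂ _xor_ (flip {0} {suc (a i)} (λ ())) (xor-identityʳ _)) (c (E 0 (suc (a i))) _)))
        where c : ∀ p q → (not p xor (p xor q)) ≡ not q
              c true q = refl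
              c false q = refl
      cut (suc i) (suc j) = alg {E (suc (a i)) (suc (a j))} {E (suc (b i)) (suc (b j))} {E 0 (suc (a i))} {E 0 (suc (a j))} {E 0 (suc (b i))} {E 0 (suc (b j))} (s i j)
      R = cut-eqv (allFin (suc n)) A B (ci ia) (ci ib) K (λ i k → ⊥-elim (k (∈-allFin i))) cut
      g = proj₁ R
      h = proj₂ R

  world' : CoreClone
  world' = record
    { em = em ; E = E' ; tour = tour' ; ext = λ L p → let (z , _ , h) = ext⁺ L p in z , h
    ; G = G' ; to = to' ; from = from'
    ; to-from = λ g x → cong pred (trans (cong (to (proj₁ g)) (suc-from g x)) (to-from (proj₁ g) (suc x)))
    ; from-to = λ g x → cong pred (trans (cong (from (proj₁ g)) (suc-to g x)) (from-to (proj₁ g) (suc x)))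
    ; mul = λ g h → let (k , e) = mul (proj₁ g) (proj₁ h) in (k , trans (e 0) (trans (cong (to (proj₁ g)) (proj₂ h)) (proj₂ g))) ,
              λ x → cong pred (trans (e (suc x)) (cong (to (proj₁ g)) (sym (suc-to h x))))
    ; inv = λ g → let (k , e) = inv (proj₁ g) in (k , trans (e 0) (from0 g)) , λ x → cong pred (e (suc x))
    ; homG = homG'
    ; C = C' ; Cext = proj₁
    ; Cproj = λ j → (λ e → e j) , λ L → (λ v → v j) , Cproj j , refl , λ _ _ → refl
    ; Ccomp = λ { {n} {k} {f} {g} (fe , fl) h → (λ e → fe (λ j → proj₁ (h j) e)) , λ L →
        let (F , cF , F0 , FL) = fl (map (λ v j → g j v) L) in
        (λ v → F (λ j → proj₁ (proj₂ (h j) L) v)) , Ccomp cF (λ j → proj₁ (proj₂ (proj₂ (h j) L))) ,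
        trans (Cext cF (λ j → proj₁ (proj₂ (proj₂ (proj₂ (h j) L))))) F0 ,
        λ x m → trans (Cext cF (λ j → proj₂ (proj₂ (proj₂ (proj₂ (h j) L))) x m)) (FL (λ j → g j x) (∈-map⁺ (λ v j → g j v) m)) }
    ; CG = λ g → (λ e → cong (to' g) (e zero)) , λ L → (λ v → to (proj₁ g) (v zero)) , CG (proj₁ g) , proj₂ g , λ x _ → sym (suc-to g (x zero))
    ; core = λ { {u} (ue , ul) Fs → let (F , cF , F0 , FL) = ul (map (λ x _ → x) Fs) ; (g , h) = core {λ n → F (λ _ → n)} (Ccomp {g = λ _ v → v zero} cF (λ _ → Cproj zero)) (0 ∷ map suc Fs) in
        (g , trans (h 0 (here refl)) F0) , λ x m → cong pred (trans (h (suc x) (there (∈-map⁺ suc m))) (FL (λ _ → x) (∈-map⁺ (λ x _ → x) m))) }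
    ; closed = λ f fe loc → fe , λ L → let (g , (_ , gl) , h) = loc L ; (F , cF , F0 , FL) = gl L in F , cF , F0 , λ x m → trans (FL x m) (cong suc (h x m)) }

-- If every candidate failed some test, these finitely many tests together would refute all
-- candidates.
compactness : ExcludedMiddle 0ℓ → ∀ {A T : Set} (cs : List A) (Q : A → T → Set) → (∀ (L : List T) → Σ A λ c → (c ∈ cs) × (∀ t → t ∈ L → Q c t)) → Σ A λ c → ∀ t → Q c t
compactness em {A} {T} cs Q fin with search cs
  where
  search : ∀ ds → (Σ A λ c → ∀ t → Q c t) ⊎ (Σ (List T) λ L → ∀ c → c ∈ ds → ¬ (∀ t → t ∈ L → Q c t))
  search [] = inj₂ ([] , λ _ ())
  search (d ∷ ds) with search ds
  ... | inj₁ r = inj₁ r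
  ... | inj₂ (L , h) with em {Σ T λ t → ¬ Q d t}
  ... | yes (t , n) = inj₂ (t ∷ L , λ { c (here refl) q → n (q t (here refl)) ; c (there m) q → h c m (λ s k → q s (there k)) })
  ... | no n = inj₁ (d , all)
    where
    all : ∀ t → Q d t
    all t with em {Q d t}
    ... | yes q = q
    ... | no k = ⊥-elim (n (t , k))
... | inj₁ r = r
... | inj₂ (L , h) = let (c , m , q) = fin L in ⊥-elim (h c m q)

-- Passing between the tournament and its switched form.

module Transport (w : CoreClone) where
  open CoreCloneProps w

  spread : ∀ p q (L : List ℕ) → Σ (List (ℕ × ℕ)) λ ps → (∀ {a b} → a ∈ ps → b ∈ ps → SEp a b) × ((p , q) ∈ ps) × (∀ x → x ∈ L → Σ ℕ λ y → (x , y) ∈ ps)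
  spread p q [] = (p , q) ∷ [] , (λ { (here refl) (here refl) → rf-se }) , here refl , λ _ ()
  spread p q (x ∷ L) with spread p q L
  ... | ps , ap , pq , cov with em {Σ ℕ λ y → (x , y) ∈ ps}
  ... | yes (y , m) = ps , ap , pq , λ { v (here refl) → y , m ; v (there k) → cov v k }
  ... | no new with extL (map (λ (v , v') → v' , E x v) ps) (AP-map (allpairs-∈ ps (λ a b e → cong (E x) (se-≡ (sym-se (ap a b)) e)))) []
  ... | y , hits , _ = (x , y) ∷ ps , ap' , there pq , λ { v (here refl) → y , here refl ; v (there k) → let (u , m) = cov v k in u , there m }
    where
    S : ∀ {v} → v ∈ ps → SEp (x , y) v
    S {v} m = let (n , e) = All.lookup (All-map⁻ hits) m in se (λ q → new (proj₂ v , subst (λ s → (s , proj₂ v) ∈ ps) (sym q) m)) n (sym e)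
    ap' : ∀ {a b} → a ∈ (x , y) ∷ ps → b ∈ (x , y) ∷ ps → SEp a b
    ap' (here refl) (here refl) = rf-se
    ap' (here refl) (there m) = S m
    ap' (there m) (here refl) = sw-se (S m)
    ap' (there m) (there k) = ap m k

  opaque
    transport : ∀ p q (L : List ℕ) → Σ G λ g → (to g p ≡ q) × (∀ {x y} → x ∈ p ∷ L → y ∈ p ∷ L → E (to g x) (to g y) ≡ E x y)
    transport p q L with spread p q (p ∷ L)
    ... | ps , ap , pq , cov with homGL ps (allpairs-∈ ps ap)
    ... | g , h = g , All.lookup h pq , λ {x} {y} a b → let (x' , m) = cov x a ; (y' , k) = cov y b in
          trans (cong₂ E (All.lookup h m) (All.lookup h k)) (sym (proj₁ (ap m k)))

module Pointed (w : CoreClone) (star : CoreCloneProps.StarFlip w) where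
  open CoreCloneProps w
  open Triads w
  open Switching w star
  open Transport w
  private
    module W' = CoreCloneProps world'
    module T' = Triads world'

  -- Successor arguments differ from 0 in every coordinate, so by strictness their values differ
  -- from 0 and have a predecessor.
  restrict : ∀ {k} {F : Op k} → C F → F (λ _ → 0) ≡ 0 → W'.C (λ v → pred (F (λ j → suc (v j)))) × (∀ v → suc (pred (F (λ j → suc (v j)))) ≡ F (λ j → suc (v j)))
  restrict {k} {F} cF F0 = ((λ e → cong pred (Cext cF (λ j → cong suc (e j)))) , λ L → F , cF , F0 , λ x _ → sym (sp x)) , sp
    where
    sp : ∀ v → suc (pred (F (λ j → suc (v j)))) ≡ F (λ j → suc (v j))
    sp v = suc-pred (λ e → strictW cF {λ j → suc (v j)} {λ _ → 0} (λ j ()) (trans e (sym F0)))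

  essential' : Essential → T'.Essential
  -- Both dependences are sought at nonzero arguments because 0 is removed; `g` then makes the
  -- operation fix 0.
  essential' ess with Separation.separate opClone ess {ℕ × ℕ} proj₁ proj₂ (((1 , 1) , (2 , 1)) ∷ ((1 , 1) , (1 , 2)) ∷ []) (inj₁ (λ ()) ∷ inj₂ (λ ()) ∷ [])
  ... | h , ch , n1 ∷ n2 ∷ [] with transport (h 0 0) 0 []
  ... | g , g0 , _ with restrict {2} {λ v → to g (h (v zero) (v (suc zero)))} (Ccomp {g = λ (_ : Fin 1) v → h (v zero) (v (suc zero))} (CG g) (λ _ → OpCloneProps.un2 ch)) g0
  ... | c' , sp = record { h = λ x y → pred (to g (h (suc x) (suc y))) ; ch = OpCloneProps.mk2 c' ; a = 0 ; b = 1 ; c = 0 ; d1 = λ e → n1 (toinj g (trans (sym (sp (two 0 0))) (trans (cong suc e) (sp (two 1 0)))))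
        ; a' = 0 ; c' = 0 ; d' = 1 ; d2 = λ e → n2 (toinj g (trans (sym (sp (two 0 0))) (trans (cong suc e) (sp (two 0 1))))) }

  -- The arc of E' between u and v when p is moved to 0.
  private
    TT : ℕ → ℕ → ℕ → Bool
    TT p u v = E u v xor (E p u xor E p v)

    twisted-triad : ∀ p u v s → triad E u v s ≡ (TT p u v xor (TT p v s xor TT p s u))
    twisted-triad p u v s = sym (solve 6 (λ a b c x y z → (a :+ (x :+ y)) :+ ((b :+ (y :+ z)) :+ (c :+ (z :+ x))) := a :+ (b :+ c)) refl (E u v) (E v s) (E s u) (E p u) (E p v) (E p s))
      where open xor-∧-Solver

    sigma3 : ∀ σ a b c → ((σ xor a) xor ((σ xor b) xor (σ xor c))) ≡ (σ xor (a xor (b xor c)))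
    sigma3 = solve 4 (λ σ a b c → (σ :+ a) :+ ((σ :+ b) :+ (σ :+ c)) := σ :+ (a :+ (b :+ c))) refl
      where open xor-∧-Solver

    e'-twisted : ∀ g {p u v} → to g p ≡ 0 → E (to g u) (to g v) ≡ E u v → E (to g p) (to g u) ≡ E p u → E (to g p) (to g v) ≡ E p v →
      ∀ {x y} → suc x ≡ to g u → suc y ≡ to g v → E' x y ≡ TT p u v
    e'-twisted g {p} {u} {v} g0 e1 e2 e3 {x} {y} x≡ ey = cong₂ _xor_ (trans (cong₂ E x≡ ey) e1) (cong₂ _xor_ (trans (cong₂ E (sym g0) x≡) e2) (trans (cong₂ E (sym g0) ey) e3))

  -- For finitely many triples, dominating points `b i` and the value `f b` are moved to 0. The
  -- operation so obtained fixes 0 and follows the switched arcs of a coordinate; in a triad the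
  -- arcs from the base point cancel. Compactness makes coordinate and sign independent of the
  -- triples.
  triads : (∀ {k} {f : Op k} → W'.C f → Σ (Fin k) (T'.FollowsArcs f)) → ∀ {k} {f : Op k} → C f → Σ (Fin k) (FollowsTriads f)
  triads fol {k} {f} cf with compactness em {Fin k × Bool} {Tr} (cartesianProduct (allFin k) (true ∷ false ∷ [])) Q finite
    where
    Tr : Set
    Tr = (Fin k → ℕ) × (Fin k → ℕ) × (Fin k → ℕ)
    Q : Fin k × Bool → Tr → Set
    Q (j , σ) (x , y , z) = x # y → y # z → z # x → triad E (f x) (f y) (f z) ≡ (σ xor triad E (x j) (y j) (z j))
    finite : ∀ (L : List Tr) → Σ (Fin k × Bool) λ c → (c ∈ cartesianProduct (allFin k) (true ∷ false ∷ [])) × (∀ t → t ∈ L → Q c t)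
    finite L = (j , σ) , ∈-cartesianProduct⁺ (∈-allFin j) (bm σ) , λ { (x , y , z) m xy yz zx →
        trans (twisted-triad (f b) (f x) (f y) (f z)) (trans (cong₂ _xor_ (twisted (P1' m) (P2' m) xy) (cong₂ _xor_ (twisted (P2' m) (P3' m) yz) (twisted (P3' m) (P1' m) zx)))
          (trans (sigma3 σ (TT (b j) (x j) (y j)) (TT (b j) (y j) (z j)) (TT (b j) (z j) (x j))) (cong (σ xor_) (sym (twisted-triad (b j) (x j) (y j) (z j)))))) }
      where
      pts : List Tr → List (Fin k → ℕ)
      pts [] = []
      pts ((x , y , z) ∷ L) = x ∷ y ∷ z ∷ pts L
      P = pts L
      p1∈ : ∀ {L x y z} → (x , y , z) ∈ L → x ∈ pts L
      p1∈ (here refl) = here refl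
      p1∈ (there m) = there (there (there (p1∈ m)))
      p2∈ : ∀ {L x y z} → (x , y , z) ∈ L → y ∈ pts L
      p2∈ (here refl) = there (here refl)
      p2∈ (there m) = there (there (there (p2∈ m)))
      p3∈ : ∀ {L x y z} → (x , y , z) ∈ L → z ∈ pts L
      p3∈ (here refl) = there (there (here refl))
      p3∈ (there m) = there (there (there (p3∈ m)))
      P1' : ∀ {x y z} → (x , y , z) ∈ L → x ∈ P
      P1' = p1∈
      P2' : ∀ {x y z} → (x , y , z) ∈ L → y ∈ P
      P2' = p2∈
      P3' : ∀ {x y z} → (x , y , z) ∈ L → z ∈ P
      P3' = p3∈
      B : ∀ i → Σ ℕ λ z → ∀ x → x ∈ map (λ v → v i) P → (z ≢ x) × (E z x ≡ true)
      B i = ext (map (λ v → v i) P) (λ _ → true)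
      b : Fin k → ℕ
      b i = proj₁ (B i)
      bx : ∀ {x} → x ∈ P → ∀ i → b i ≢ x i
      bx m i = proj₁ (proj₂ (B i) _ (∈-map⁺ (λ v → v i) m))
      g : ∀ i → Σ G λ g → (to g (b i) ≡ 0) × (∀ {x y} → x ∈ b i ∷ map (λ v → v i) P → y ∈ b i ∷ map (λ v → v i) P → E (to g x) (to g y) ≡ E x y)
      g i = transport (b i) 0 (map (λ v → v i) P)
      γ : Σ G λ g → (to g (f b) ≡ 0) × (∀ {x y} → x ∈ f b ∷ map f P → y ∈ f b ∷ map f P → E (to g x) (to g y) ≡ E x y)
      γ = transport (f b) 0 (map f P)
      F : Op k
      F v = to (proj₁ γ) (f (λ i → to (proj₁ (inv (proj₁ (g i)))) (v i)))
      cF : C F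
      cF = Ccomp {g = λ (_ : Fin 1) v → f (λ i → to (proj₁ (inv (proj₁ (g i)))) (v i))} (CG (proj₁ γ)) (λ _ → Ccomp {g = λ i v → to (proj₁ (inv (proj₁ (g i)))) (v i)} cf (λ i → Ccomp {g = λ (_ : Fin 1) v → v i} (CG (proj₁ (inv (proj₁ (g i))))) (λ _ → Cproj i)))
      undo : ∀ i x → to (proj₁ (inv (proj₁ (g i)))) (to (proj₁ (g i)) x) ≡ x
      undo i x = trans (proj₂ (inv (proj₁ (g i))) _) (from-to (proj₁ (g i)) x)
      F0 : F (λ _ → 0) ≡ 0
      F0 = trans (cong (to (proj₁ γ)) (Cext cf (λ i → trans (cong (to (proj₁ (inv (proj₁ (g i))))) (sym (proj₁ (proj₂ (g i))))) (undo i (b i))))) (proj₁ (proj₂ γ))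
      R = restrict cF F0
      f' : Op k
      f' v = pred (F (λ i → suc (v i)))
      jσ = fol (proj₁ R)
      j = proj₁ jσ
      σ = proj₁ (proj₂ jσ)
      bm : ∀ σ → σ ∈ true ∷ false ∷ []
      bm true = here refl
      bm false = there (here refl)
      wt : (Fin k → ℕ) → Fin k → ℕ
      wt x i = pred (to (proj₁ (g i)) (x i))
      swt : ∀ {x} → x ∈ P → ∀ i → suc (wt x i) ≡ to (proj₁ (g i)) (x i)
      swt m i = suc-pred (λ e → bx m i (toinj (proj₁ (g i)) (trans (proj₁ (proj₂ (g i))) (sym e))))
      sf' : ∀ {x} → x ∈ P → suc (f' (wt x)) ≡ to (proj₁ γ) (f x)
      sf' {x} m = trans (proj₂ R (wt x)) (cong (to (proj₁ γ)) (Cext cf (λ i → trans (cong (to (proj₁ (inv (proj₁ (g i))))) (swt m i)) (undo i (x i)))))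
      twisted : ∀ {x y} → x ∈ P → y ∈ P → x # y → TT (f b) (f x) (f y) ≡ (σ xor TT (b j) (x j) (y j))
      twisted {x} {y} mx my n = trans (sym (e'-twisted (proj₁ γ) (proj₁ (proj₂ γ)) (proj₂ (proj₂ γ) (there (∈-map⁺ f mx)) (there (∈-map⁺ f my))) (proj₂ (proj₂ γ) (here refl) (there (∈-map⁺ f mx))) (proj₂ (proj₂ γ) (here refl) (there (∈-map⁺ f my))) (sf' mx) (sf' my)))
        (trans (proj₂ (proj₂ jσ) {wt x} {wt y} (λ i e → n i (toinj (proj₁ (g i)) (trans (sym (swt mx i)) (trans (cong suc e) (swt my i))))))
          (cong (σ xor_) (e'-twisted (proj₁ (g j)) (proj₁ (proj₂ (g j))) (proj₂ (proj₂ (g j)) (there (∈-map⁺ (λ v → v j) mx)) (there (∈-map⁺ (λ v → v j) my))) (proj₂ (proj₂ (g j)) (here refl) (there (∈-map⁺ (λ v → v j) mx))) (proj₂ (proj₂ (g j)) (here refl) (there (∈-map⁺ (λ v → v j) my))) (swt mx j) (swt my j))))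
  ... | (j , σ) , h = j , σ , λ {x} {y} {z} → h (x , y , z)

  private
    -- The new points are dominated by 0, where `E` and `E'` coincide.
    lift : ∀ (Os : List ℕ) → Σ (List (ℕ × ℕ)) λ ps → (∀ {a b} → a ∈ ps → b ∈ ps → W'.SEp a b) × (∀ a → a ∈ ps → E 0 (suc (proj₂ a)) ≡ true) × (∀ x → x ∈ Os → Σ ℕ λ y → (x , y) ∈ ps)
    lift [] = [] , (λ ()) , (λ _ ()) , λ _ ()
    lift (x ∷ Os) with lift Os
    ... | ps , ap , z0 , cov with em {Σ ℕ λ y → (x , y) ∈ ps}
    ... | yes (y , m) = ps , ap , z0 , λ { v (here refl) → y , m ; v (there k) → cov v k }
    ... | no new with ext⁺ (map proj₂ ps) (λ v' → decide (Σ ℕ λ v → ((v , v') ∈ ps) × (E' x v ≡ true)))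
    ... | y , y0 , hits = (x , y) ∷ ps , ap' , (λ { a (here refl) → y0 ; a (there m) → z0 a m }) , λ { v (here refl) → y , here refl ; v (there k) → let (u , m) = cov v k in u , there m }
      where
      S : ∀ {v} → v ∈ ps → W'.SEp (x , y) v
      S {v , v'} m = let (n , e) = hits v' (∈-map⁺ proj₂ m) in W'.se (λ q → new (v' , subst (λ s → (s , v') ∈ ps) (sym q) m)) n (sym (trans e val))
        where
        val : decide (Σ ℕ λ u → ((u , v') ∈ ps) × (E' x u ≡ true)) ≡ E' x v
        val with bool-em (E' x v)
        ... | inj₁ t = trans (decide-yes (v , m , t)) (sym t)
        ... | inj₂ f = trans (decide-no (λ (u , k , t) → t≢f (trans (cong (E' x) (sym (W'.se-≡ (W'.sym-se (ap k m)) refl))) t) f)) (sym f)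
      ap' : ∀ {a b} → a ∈ (x , y) ∷ ps → b ∈ (x , y) ∷ ps → W'.SEp a b
      ap' (here refl) (here refl) = W'.rf-se
      ap' (here refl) (there m) = S m
      ap' (there m) (here refl) = W'.sw-se (S m)
      ap' (there m) (there k) = ap m k

  -- A point dominating `F` is moved to 0, so that `E'` on the moved arguments is `E` on `F`. On the
  -- side of the values, the stabiliser of 0 moves them to points dominated by 0, which turns their
  -- `E'`-arcs into `E`-arcs.
  local-cyclic : LocalCyclic E' T'.C3w → LocalCyclic E C3w
  local-cyclic (β , cy , loc) = β , cy , go
    where
    go : Local E C3w β
    go F = s , cs , λ {x} {y} {z} {x'} {y'} {z'} a b d a' b' d' n → fin a b d a' b' d' n
      where
      c = proj₁ (ext F (λ _ → true))
      cx : ∀ x → x ∈ F → (c ≢ x) × (E c x ≡ true)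
      cx = proj₂ (ext F (λ _ → true))
      T = transport c 0 F
      g = proj₁ T
      pr : ℕ → ℕ
      pr x = pred (to g x)
      spr : ∀ {x} → x ∈ F → suc (pr x) ≡ to g x
      spr {x} m = suc-pred (λ e → proj₁ (cx x m) (toinj g (trans (proj₁ (proj₂ T)) (sym e))))
      F' = map pr F
      L = loc F'
      s' = proj₁ L
      trp : ℕ × ℕ × ℕ → Fin 3 → ℕ
      trp (x , y , z) = three x y z
      F3 : List (ℕ × ℕ × ℕ)
      F3 = cartesianProduct F' (cartesianProduct F' F')
      in3 : ∀ {x y z} → x ∈ F → y ∈ F → z ∈ F → (pr x , pr y , pr z) ∈ F3
      in3 a b d = ∈-cartesianProduct⁺ (∈-map⁺ pr a) (∈-cartesianProduct⁺ (∈-map⁺ pr b) (∈-map⁺ pr d))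
      big = proj₂ (proj₁ (proj₂ L)) (map trp F3)
      S = proj₁ big
      cS : C S
      cS = proj₁ (proj₂ big)
      out' : ℕ × ℕ × ℕ → ℕ
      out' (x , y , z) = s' x y z
      Q = lift (map out' F3)
      ps = proj₁ Q
      γ = W'.homGL ps (allpairs-∈ ps (proj₁ (proj₂ Q)))
      γ₀ = proj₁ (proj₁ γ)
      s : ℕ → ℕ → ℕ → ℕ
      s x y z = to γ₀ (S (three (to g x) (to g y) (to g z)))
      cs : C3w s
      cs = Ccomp {g = λ (_ : Fin 1) v → S (three (to g (v zero)) (to g (v (suc zero))) (to g (v (suc (suc zero)))))} (CG γ₀)
        (λ _ → Ccomp {g = λ i v → three (to g (v zero)) (to g (v (suc zero))) (to g (v (suc (suc zero)))) i} cS (λ { zero → pc zero ; (suc zero) → pc (suc zero) ; (suc (suc zero)) → pc (suc (suc zero)) }))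
        where pc : ∀ i → C {3} (λ v → to g (v i))
              pc i = Ccomp {g = λ (_ : Fin 1) v → v i} (CG g) (λ _ → Cproj i)
      hat : ∀ {x y z} → x ∈ F → y ∈ F → z ∈ F → Σ ℕ λ o → (s' (pr x) (pr y) (pr z) , o) ∈ ps
      hat a b d = proj₂ (proj₂ (proj₂ Q)) _ (∈-map⁺ out' (in3 a b d))
      val : ∀ {x y z} (a : x ∈ F) (b : y ∈ F) (d : z ∈ F) → s x y z ≡ suc (proj₁ (hat a b d))
      val {x} {y} {z} a b d = trans (cong (to γ₀) (trans (Cext cS (λ { zero → sym (spr a) ; (suc zero) → sym (spr b) ; (suc (suc zero)) → sym (spr d) }))
          (proj₂ (proj₂ (proj₂ big)) (trp (pr x , pr y , pr z)) (∈-map⁺ trp (in3 a b d)))))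
          (trans (sym (suc-to (proj₁ γ) _)) (cong suc (All.lookup (proj₂ γ) (proj₂ (hat a b d)))))
      ty : ∀ {x x'} → x ∈ F → x' ∈ F → tyOf E' (pr x) (pr x') ≡ tyOf E x x'
      ty {x} {x'} a b with x ≟ x'
      ... | yes refl = tyOf-eq E' {pr x} refl
      ... | no n = tyOf-ne E' (λ e → n (toinj g (trans (sym (spr a)) (trans (cong suc e) (spr b)))))
            (trans (e'-twisted g (proj₁ (proj₂ T)) (proj₂ (proj₂ T) (there a) (there b)) (proj₂ (proj₂ T) (here refl) (there a)) (proj₂ (proj₂ T) (here refl) (there b)) (spr a) (spr b))
              (trans (cong₂ (λ u v → E x x' xor (u xor v)) (proj₂ (cx x a)) (proj₂ (cx x' b))) (xor-identityʳ (E x x'))))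
      fin : ∀ {x y z x' y' z'} → x ∈ F → y ∈ F → z ∈ F → x' ∈ F → y' ∈ F → z' ∈ F → (x , y , z) ≢ (x' , y' , z') →
        (s x y z ≢ s x' y' z') × (E (s x y z) (s x' y' z') ≡ β (tyOf E x x') (tyOf E y y') (tyOf E z z'))
      fin {x} {y} {z} {x'} {y'} {z'} a b d a' b' d' n = (λ e → on (cong pred (trans (sym (val a b d)) (trans e (val a' b' d'))))) ,
          trans (cong₂ E (val a b d) (val a' b' d')) (trans (sym e1) (trans e2 (trans (proj₂ h) (cong₂ (λ (u , v) r → β u v r) (cong₂ _,_ (ty a a') (ty b b')) (ty d d')))))
        where
        h = proj₂ (proj₂ L) (∈-map⁺ pr a) (∈-map⁺ pr b) (∈-map⁺ pr d) (∈-map⁺ pr a') (∈-map⁺ pr b') (∈-map⁺ pr d')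
              (λ e → n (cong₂ _,_ (pi a a' (cong proj₁ e)) (cong₂ _,_ (pi b b' (cong (λ t → proj₁ (proj₂ t)) e)) (pi d d' (cong (λ t → proj₂ (proj₂ t)) e)))))
          where
          pi : ∀ {u v} → u ∈ F → v ∈ F → pr u ≡ pr v → u ≡ v
          pi m k e = toinj g (trans (sym (spr m)) (trans (cong suc e) (spr k)))
        o = proj₁ (hat a b d)
        o' = proj₁ (hat a' b' d')
        se' : W'.SE (s' (pr x) (pr y) (pr z)) (s' (pr x') (pr y') (pr z')) o o'
        se' = proj₁ (proj₂ Q) (proj₂ (hat a b d)) (proj₂ (hat a' b' d'))
        on : o ≢ o'
        on = W'.se-≢ se' (proj₁ h)
        e1 : E' o o' ≡ E (suc o) (suc o')
        e1 = trans (cong₂ (λ u v → E (suc o) (suc o') xor (u xor v)) (proj₁ (proj₂ (proj₂ Q)) _ (proj₂ (hat a b d))) (proj₁ (proj₂ (proj₂ Q)) _ (proj₂ (hat a' b' d')))) (xor-identityʳ _)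
        e2 : E' o o' ≡ E' (s' (pr x) (pr y) (pr z)) (s' (pr x') (pr y') (pr z'))
        e2 = sym (proj₁ se')

-- Realising a behaviour on all triples.

negTy : Ty → Ty
negTy eq = eq
negTy (ne b) = ne (not b)

-- Exchanging two triples negates all three types, so this makes `β` a tournament on triples; three
-- equalities mean that the triples coincide.
OddTy : (Ty → Ty → Ty → Bool) → Set
OddTy β = ∀ a b c → ¬ ((a ≡ eq) × (b ≡ eq) × (c ≡ eq)) → β (negTy a) (negTy b) (negTy c) ≡ not (β a b c)

cyc-maj-odd : OddTy (cyc maj3 false)
cyc-maj-odd eq eq eq n = ⊥-elim (n (refl , refl , refl))
cyc-maj-odd eq eq (ne true) n = refl
cyc-maj-odd eq eq (ne false) n = refl
cyc-maj-odd eq (ne true) eq n = refl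
cyc-maj-odd eq (ne false) eq n = refl
cyc-maj-odd eq (ne true) (ne true) n = refl
cyc-maj-odd eq (ne true) (ne false) n = refl
cyc-maj-odd eq (ne false) (ne true) n = refl
cyc-maj-odd eq (ne false) (ne false) n = refl
cyc-maj-odd (ne true) eq eq n = refl
cyc-maj-odd (ne false) eq eq n = refl
cyc-maj-odd (ne true) eq (ne true) n = refl
cyc-maj-odd (ne true) eq (ne false) n = refl
cyc-maj-odd (ne false) eq (ne true) n = refl
cyc-maj-odd (ne false) eq (ne false) n = refl
cyc-maj-odd (ne true) (ne true) eq n = refl
cyc-maj-odd (ne true) (ne false) eq n = refl
cyc-maj-odd (ne false) (ne true) eq n = refl
cyc-maj-odd (ne false) (ne false) eq n = refl
cyc-maj-odd (ne true) (ne true) (ne c) n = refl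
cyc-maj-odd (ne true) (ne false) (ne true) n = refl
cyc-maj-odd (ne true) (ne false) (ne false) n = refl
cyc-maj-odd (ne false) (ne true) (ne true) n = refl
cyc-maj-odd (ne false) (ne true) (ne false) n = refl
cyc-maj-odd (ne false) (ne false) (ne c) n = refl

module Behaviour (em : ExcludedMiddle 0ℓ) {E : ℕ → ℕ → Bool} (tour : IsTournament E)
  (ext : Extension E) where
  open TournamentProps tour
  open Dense em tour ext

  Tri : Set
  Tri = ℕ × ℕ × ℕ

  ty-negTy : ∀ x y → tyOf E y x ≡ negTy (tyOf E x y)
  ty-negTy x y with x ≟ y
  ... | yes e = tyOf-eq E (sym e)
  ... | no n = tyOf-ne E (λ e → n (sym e)) (flip n)

  ty-eq : ∀ x y → tyOf E x y ≡ eq → x ≡ y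
  ty-eq x y e with x ≟ y
  ... | yes q = q

  types : (Ty → Ty → Ty → Bool) → Tri → Tri → Bool
  types β (x , y , z) (x' , y' , z') = β (tyOf E x x') (tyOf E y y') (tyOf E z z')

  types-odd : ∀ {β} → OddTy β → ∀ t t' → t ≢ t' → types β t' t ≡ not (types β t t')
  types-odd {β} odd (x , y , z) (x' , y' , z') n = trans (cong₂ (λ (u , v) r → β u v r) (cong₂ _,_ (ty-negTy x x') (ty-negTy y y')) (ty-negTy z z'))
    (odd _ _ _ (λ (a , b , c) → n (cong₂ _,_ (ty-eq _ _ a) (cong₂ _,_ (ty-eq _ _ b) (ty-eq _ _ c)))))

  opaque
    behaviour : ∀ β → OddTy β → Σ (Tri → ℕ) λ φ → ∀ t t' → t ≢ t' → (φ t ≢ φ t') × (E (φ t) (φ t') ≡ types β t t')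
    behaviour β odd = φ , λ t t' n → dist t t' n , trans (val t t') (MM-ne n)
      where
      dec : ℕ → Tri
      dec n = proj₁ (pairs n) , pairs (proj₂ (pairs n))
      enc : Tri → ℕ
      enc (x , p) = code (x , code p)
      dec-enc : ∀ t → dec (enc t) ≡ t
      dec-enc (x , p) = cong₂ _,_ (cong proj₁ (pairs-code (x , code p))) (trans (cong (λ q → pairs (proj₂ q)) (pairs-code (x , code p))) (pairs-code p))
      MM : Tri → Tri → Bool
      MM t t' with em {t ≡ t'}
      ... | yes _ = false
      ... | no _ = types β t t'
      MM-eq : ∀ t → MM t t ≡ false
      MM-eq t with em {t ≡ t}
      ... | yes _ = refl
      ... | no n = ⊥-elim (n refl)
      MM-ne : ∀ {t t'} → t ≢ t' → MM t t' ≡ types β t t'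
      MM-ne {t} {t'} n with em {t ≡ t'}
      ... | yes e = ⊥-elim (n e)
      ... | no _ = refl
      MM-flip : ∀ t t' → t ≢ t' → MM t' t ≡ not (MM t t')
      MM-flip t t' n = trans (MM-ne (λ e → n (sym e))) (trans (types-odd odd t t' n) (cong not (sym (MM-ne n))))
      pre : PreTournament (λ i j → MM (dec i) (dec j))
      pre = record { pirr = λ i → MM-eq (dec i) ; pasym = λ i j → as (dec i) (dec j) ; pcong = λ i j k → cg (dec i) (dec j) (dec k) }
        where
        as : ∀ t t' → MM t t' ≡ true → MM t' t ≡ false
        as t t' e with em {t ≡ t'}
        as t .t e | yes refl = MM-eq t
        ... | no n = trans (MM-flip t t' n) (cong not (trans (MM-ne n) e))
        cg : ∀ t t' u → MM t t' ≡ false → MM t' t ≡ false → (MM t u ≡ MM t' u) × (MM u t ≡ MM u t')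
        cg t t' u p q with em {t ≡ t'}
        cg t .t u p q | yes refl = refl , refl
        ... | no n = ⊥-elim (t≢f (trans (MM-flip t t' n) (cong not (trans (MM-ne n) p))) q)
      R : Σ (ℕ → ℕ) λ ψ → (ψ 0 ≡ 0) × (∀ i j → E (ψ i) (ψ j) ≡ MM (dec i) (dec j))
      R = realize (λ i j → MM (dec i) (dec j)) pre 0
      φ : Tri → ℕ
      φ t = proj₁ R (enc t)
      val : ∀ t t' → E (φ t) (φ t') ≡ MM t t'
      val t t' = trans (proj₂ (proj₂ R) (enc t) (enc t')) (cong₂ MM (dec-enc t) (dec-enc t'))
      dist : ∀ t t' → t ≢ t' → φ t ≢ φ t'
      dist t t' n e = b≢not (trans (trans (sym (val t t')) (trans (cong₂ E e (sym e)) (val t' t))) (MM-flip t t' n))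

-- The case in which all injective tuples are equivalent.

module AllEquivalent (w : CoreClone) (star : CoreCloneProps.StarFlip w) (star' : CoreCloneProps.StarFlip (Switching.world' w star)) where
  open CoreCloneProps w
  open Triads w
  open Switching w star
  open Behaviour em tour ext
  private
    module W' = CoreCloneProps world'

    -- For a star centred at 0 the `E'`-arc between two leaves is the arc of `M` plus both arms.
    -- Changing arm `j` is therefore switching at `j` in `E'`, done by a group element fixing 0.
    rel-flip : ∀ {n} (M : Fin n → Fin n → Bool) → Odd M → ∀ τ j → Rel M τ (λ k → delta j k xor τ k)
    rel-flip {n} M o τ j = 0 , 0 , A , B , SA , SB , (g , mv)
      where
      τ' : Fin n → Bool
      τ' k = delta j k xor τ k
      RA = stars M o τ 0
      RB = stars M o τ' 0
      A = proj₁ RA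
      B = proj₁ RB
      SA = proj₂ RA
      SB = proj₂ RB
      module _ {A θ} (S : Star {n} 0 A θ M) where
        sp : ∀ s → suc (pred (A s)) ≡ A s
        sp s = suc-pred (λ e → Star.off S s (sym e))
        pi : Inj (λ s → pred (A s))
        pi {s} {s'} e = Star.inj S (trans (sym (sp s)) (trans (cong suc e) (sp s')))
        pe : ∀ k l → k ≢ l → E' (pred (A k)) (pred (A l)) ≡ (M k l xor (θ k xor θ l))
        pe k l q = cong₂ _xor_ (trans (cong₂ E (sp k) (sp l)) (Star.mat S k l q)) (cong₂ _xor_ (trans (cong (E 0) (sp k)) (Star.arm S k)) (trans (cong (E 0) (sp l)) (Star.arm S l)))
      off : ∀ k l → k ≢ j → l ≢ j → E' (pred (A k)) (pred (A l)) ≡ E' (pred (B k)) (pred (B l))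
      off k l p q with k ≟F l
      ... | yes refl = trans (W'.irrefl (pred (A k))) (sym (W'.irrefl (pred (B k))))
      ... | no kl = trans (pe SA k l kl) (sym (trans (pe SB k l kl) (cong₂ (λ u v → M k l xor ((u xor τ k) xor (v xor τ l))) (delta-off p) (delta-off q))))
      on : ∀ k → k ≢ j → E' (pred (A j)) (pred (A k)) ≡ not (E' (pred (B j)) (pred (B k)))
      on k q = trans (pe SA j k (λ e → q (sym e))) (sym (trans (cong not (trans (pe SB j k (λ e → q (sym e))) (cong₂ (λ u v → M j k xor ((u xor τ j) xor (v xor τ k))) (delta-at j) (delta-off q)))) (alg (M j k) (τ j) (τ k))))
        where
        alg : ∀ m a b → not (m xor (not a xor b)) ≡ (m xor (a xor b))
        alg true true true = refl
        alg true true false = refl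
        alg true false true = refl
        alg true false false = refl
        alg false true true = refl
        alg false true false = refl
        alg false false true = refl
        alg false false false = refl
      R = star' (λ s → pred (A s)) (λ s → pred (B s)) (pi SA) (pi SB) j off on
      g = proj₁ (proj₁ R)
      mv : ∀ i → to g (cons 0 A i) ≡ cons 0 B i
      mv zero = proj₂ (proj₁ R)
      mv (suc s) = trans (cong (to g) (sym (sp SA s))) (trans (sym (suc-to (proj₁ R) (pred (A s)))) (trans (cong suc (proj₂ R s)) (sp SB s)))

    single : ∀ {n} (a b : Fin n → ℕ) → Inj a → Inj b → ∀ i j → i ≢ j → (∀ k l → k ≢ l → ¬ ((k ≡ i) × (l ≡ j)) → ¬ ((k ≡ j) × (l ≡ i)) → E (a k) (a l) ≡ E (b k) (b l)) →
      E (b i) (b j) ≡ not (E (a i) (a j)) → Eqv a b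
    single a b ia ib i j ij same d = rel-eqv a b ia ib i sm (λ k → delta j k xor E (a i) (a k)) opp (λ M o → rel-flip M o _ j)
      where
      sm : ∀ k l → k ≢ i → l ≢ i → E (a k) (a l) ≡ E (b k) (b l)
      sm k l p q with k ≟F l
      ... | yes refl = trans (irrefl _) (sym (irrefl _))
      ... | no kl = same k l kl (λ (e , _) → p e) (λ (_ , e) → q e)
      opp : ∀ k → k ≢ i → E (b i) (b k) ≡ (delta j k xor E (a i) (a k))
      opp k q with k ≟F j
      ... | yes refl = d
      ... | no kj = sym (same i k (λ e → q (sym e)) (λ (_ , e) → kj e) (λ (e , _) → ij e))

  -- `L` lists the pairs whose arcs may still differ; one of them is corrected at a time.
  all-eqv : ∀ {n} (L : List (Fin n × Fin n)) (a b : Fin n → ℕ) → Inj a → Inj b →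
    (∀ i j → i ≢ j → ¬ ((i , j) ∈ L) → ¬ ((j , i) ∈ L) → E (a i) (a j) ≡ E (b i) (b j)) → Eqv a b
  all-eqv [] a b ia ib h = homG a b ia ib sm
    where
    sm : ∀ i j → E (a i) (a j) ≡ E (b i) (b j)
    sm i j with i ≟F j
    ... | yes refl = trans (irrefl _) (sym (irrefl _))
    ... | no n = h i j n (λ ()) (λ ())
  all-eqv {n} ((i , j) ∷ L) a b ia ib h with i ≟F j | E (b i) (b j) ≟B E (a i) (a j)
  ... | yes refl | _ = all-eqv L a b ia ib (λ k l q m m' → h k l q (λ { (here refl) → q refl ; (there x) → m x }) (λ { (here refl) → q refl ; (there x) → m' x }))
  ... | no ij | yes e = all-eqv L a b ia ib h'
    where
    h' : ∀ k l → k ≢ l → ¬ ((k , l) ∈ L) → ¬ ((l , k) ∈ L) → E (a k) (a l) ≡ E (b k) (b l)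
    h' k l q m m' with em {(k , l) ≡ (i , j)} | em {(l , k) ≡ (i , j)}
    ... | yes refl | _ = sym e
    ... | no _ | yes refl = trans (flip (λ x → ij (ia x))) (trans (cong not (sym e)) (sym (flip (λ x → ij (ib x)))))
    ... | no x | no y = h k l q (λ { (here z) → x z ; (there z) → m z }) (λ { (here z) → y z ; (there z) → m' z })
  ... | no ij | no d = eqv-trans (single a a' ia ia' i j ij sm (trans (mat i j ij) (M-ij))) (all-eqv L a' b ia' ib h')
    where
    M : Fin n → Fin n → Bool
    M k l = ((delta i k ∧' delta j l) xor (delta j k ∧' delta i l)) xor E (a k) (a l)
      where
      _∧'_ : Bool → Bool → Bool
      true ∧' b = b
      false ∧' b = false
    Mother : ∀ k l → ¬ ((k ≡ i) × (l ≡ j)) → ¬ ((k ≡ j) × (l ≡ i)) → M k l ≡ E (a k) (a l)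
    Mother k l p q with k ≟F i | l ≟F j | k ≟F j | l ≟F i
    ... | yes x | yes y | _ | _ = ⊥-elim (p (x , y))
    ... | _ | _ | yes x | yes y = ⊥-elim (q (x , y))
    ... | no _ | _ | no _ | _ = refl
    ... | no _ | _ | yes _ | no _ = refl
    ... | yes _ | no _ | no _ | _ = refl
    ... | yes _ | no _ | yes _ | no _ = refl
    M-ij : M i j ≡ not (E (a i) (a j))
    M-ij with i ≟F i | j ≟F j | i ≟F j | j ≟F i
    ... | no x | _ | _ | _ = ⊥-elim (x refl)
    ... | _ | no x | _ | _ = ⊥-elim (x refl)
    ... | yes _ | yes _ | yes x | _ = ⊥-elim (ij x)
    ... | yes _ | yes _ | no _ | _ = refl
    M-ji : M j i ≡ not (E (a j) (a i))
    M-ji with j ≟F i | i ≟F j | j ≟F j | i ≟F i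
    ... | yes x | _ | _ | _ = ⊥-elim (ij (sym x))
    ... | no _ | _ | no x | _ = ⊥-elim (x refl)
    ... | no _ | _ | yes _ | no x = ⊥-elim (x refl)
    ... | no _ | _ | yes _ | yes _ = refl
    odd : Odd M
    odd k l q with em {(k ≡ i) × (l ≡ j)} | em {(k ≡ j) × (l ≡ i)}
    ... | yes (refl , refl) | _ = trans M-ji (trans (cong not (flip (λ e → q (ia e)))) (cong not (sym M-ij)))
    ... | no _ | yes (refl , refl) = trans M-ij (trans (cong not (flip (λ e → q (ia e)))) (cong not (sym M-ji)))
    ... | no x | no y = trans (Mother l k (λ (u , v) → y (v , u)) (λ (u , v) → x (v , u))) (trans (flip (λ e → q (ia e))) (cong not (sym (Mother k l x y))))
    R = realizeF M odd
    a' = proj₁ R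
    ia' : Inj a'
    ia' = proj₁ (proj₂ R)
    mat = proj₂ (proj₂ R)
    sm : ∀ k l → k ≢ l → ¬ ((k ≡ i) × (l ≡ j)) → ¬ ((k ≡ j) × (l ≡ i)) → E (a k) (a l) ≡ E (a' k) (a' l)
    sm k l q x y = sym (trans (mat k l q) (Mother k l x y))
    bij : E (a' i) (a' j) ≡ E (b i) (b j)
    bij = trans (mat i j ij) (trans M-ij (sym (≢→not d)))
    h' : ∀ k l → k ≢ l → ¬ ((k , l) ∈ L) → ¬ ((l , k) ∈ L) → E (a' k) (a' l) ≡ E (b k) (b l)
    h' k l q m m' with em {(k ≡ i) × (l ≡ j)} | em {(k ≡ j) × (l ≡ i)}
    ... | yes (refl , refl) | _ = bij
    ... | no _ | yes (refl , refl) = trans (flip (λ x → ij (ia' x))) (trans (cong not bij) (sym (flip (λ x → ij (ib x)))))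
    ... | no x | no y = trans (sym (sm k l q x y)) (h k l q (λ { (here refl) → x (refl , refl) ; (there z) → m z }) (λ { (here refl) → y (refl , refl) ; (there z) → m' z }))

  local : Essential → LocalCyclic E C3w
  -- Any odd behaviour invariant under rotation can be imposed here; majority with copied ties is
  -- one.
  local ess = cyc maj3 false , cyc-cyc maj3 false maj-cyc , go
    where
    open Injections opClone
    β = cyc maj3 false
    φ = behaviour β cyc-maj-odd
    _≟T_ : (t t' : Tri) → Dec (t ≡ t')
    t ≟T t' = em
    go : Local E C3w β
    go F = s , cs , λ {x} {y} {z} {x'} {y'} {z'} a b c a' b' c' n → fin (in3 a b c) (in3 a' b' c') n
      where
      H1 = inject ess (cartesianProduct F F) proj₁ proj₂ jp
        where
        jp : JInj (cartesianProduct F F) proj₁ proj₂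
        jp {x , y} {x' , y'} _ _ n with x ≟ x'
        ... | no m = inj₁ m
        ... | yes refl = inj₂ (λ e → n (cong (x ,_) e))
      h1 = proj₁ H1
      F3 : List Tri
      F3 = cartesianProduct F (cartesianProduct F F)
      H2 = inject ess F3 proj₁ (λ (x , y , z) → h1 y z) jp
        where
        jp : JInj F3 proj₁ (λ (x , y , z) → h1 y z)
        jp {x , p} {x' , p'} a b n with x ≟ x'
        ... | no m = inj₁ m
        ... | yes refl = inj₂ (proj₂ (proj₂ H1) (proj₂ (∈-cartesianProduct⁻ F (cartesianProduct F F) a)) (proj₂ (∈-cartesianProduct⁻ F (cartesianProduct F F) b)) (λ e → n (cong (x ,_) e)))
      h2 = proj₁ H2
      s₀ : Tri → ℕ
      s₀ (x , y , z) = h2 x (h1 y z)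
      in3 : ∀ {x y z} → x ∈ F → y ∈ F → z ∈ F → (x , y , z) ∈ F3
      in3 a b c = ∈-cartesianProduct⁺ a (∈-cartesianProduct⁺ b c)
      ts : List Tri
      ts = deduplicate _≟T_ F3
      uniq : AllPairs _≢_ ts
      uniq = deduplicate-! _≟T_ F3
      ne' : ∀ i j → i ≢ j → lookup ts i ≢ lookup ts j
      ne' i j n with allpairs-lookup ts uniq i j n
      ... | inj₁ k = k
      ... | inj₂ k = λ e → k (sym e)
      A B : Fin (length ts) → ℕ
      A i = s₀ (lookup ts i)
      B i = proj₁ φ (lookup ts i)
      iA : Inj A
      iA {i} {j} e with i ≟F j
      ... | yes q = q
      ... | no n = ⊥-elim (proj₂ (proj₂ H2) (∈-deduplicate⁻ _≟T_ F3 (∈-lookup {xs = ts} i)) (∈-deduplicate⁻ _≟T_ F3 (∈-lookup {xs = ts} j)) (ne' i j n) e)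
      iB : Inj B
      iB {i} {j} e with i ≟F j
      ... | yes q = q
      ... | no n = ⊥-elim (proj₁ (proj₂ φ _ _ (ne' i j n)) e)
      g = all-eqv (cartesianProduct (allFin (length ts)) (allFin (length ts))) A B iA iB (λ i j _ k _ → ⊥-elim (k (∈-cartesianProduct⁺ (∈-allFin i) (∈-allFin j))))
      s : ℕ → ℕ → ℕ → ℕ
      s x y z = to (proj₁ g) (s₀ (x , y , z))
      cs : C3w s
      cs = Ccomp {g = λ (_ : Fin 1) v → h2 (v zero) (h1 (v (suc zero)) (v (suc (suc zero))))} (CG (proj₁ g)) (λ _ → OpCloneProps.un3 (OpCloneProps.c23 opClone (proj₁ (proj₂ H2)) (OpCloneProps.p1 opClone) (OpCloneProps.c23 opClone (proj₁ (proj₂ H1)) (OpCloneProps.p2 opClone) (OpCloneProps.p3 opClone))))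
      val : ∀ {t} → t ∈ F3 → to (proj₁ g) (s₀ t) ≡ proj₁ φ t
      val {t} m = trans (cong (λ u → to (proj₁ g) (s₀ u)) q) (trans (proj₂ g i) (cong (proj₁ φ) (sym q)))
        where
        m' = ∈-deduplicate⁺ _≟T_ m
        i = index m'
        q : t ≡ lookup ts i
        q = lookup-index m'
      fin : ∀ {t t'} → t ∈ F3 → t' ∈ F3 → t ≢ t' → (to (proj₁ g) (s₀ t) ≢ to (proj₁ g) (s₀ t')) × (E (to (proj₁ g) (s₀ t)) (to (proj₁ g) (s₀ t')) ≡ types β t t')
      fin m m' n = (λ e → proj₁ (proj₂ φ _ _ n) (trans (sym (val m)) (trans e (val m')))) , trans (cong₂ E (val m) (val m')) (proj₂ (proj₂ φ _ _ n))

module Cases (w : CoreClone) where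
  open CoreCloneProps w
  open Triads w

  world-cases : Essential → (∀ {k} {f : Op k} → C f → Σ (Fin k) (FollowsTriads f)) ⊎ LocalCyclic E C3w
  world-cases ess with AutomorphismCases.rigid-or-star w
  ... | inj₁ rig with RigidCase.rigid-cases rig ess
  ... | inj₁ f = inj₁ (λ cf → let (j , h) = f cf in j , arcs-triads h)
  ... | inj₂ l = inj₂ l
  world-cases ess | inj₂ star with AutomorphismCases.rigid-or-star (Switching.world' w star)
  ... | inj₂ star' = inj₂ (AllEquivalent.local w star star' ess)
  ... | inj₁ rig with Triads.RigidCase.rigid-cases (Switching.world' w star) rig (Pointed.essential' w star ess)
  ... | inj₁ f = inj₁ (Pointed.triads w star f)
  ... | inj₂ l = inj₂ (Pointed.local-cyclic w star l)

-- Reducts of the universal homogeneous tournament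

module _ (E : ℕ → ℕ → Bool) where

  Sat-ext : ∀ {n} (φ : Formula n) {v w : Fin n → ℕ} → (∀ i → v i ≡ w i) → Sat E φ v → Sat E φ w
  Sat-ext (edge i j) e s = subst₂ (λ x y → E x y ≡ true) (e i) (e j) s
  Sat-ext (eq i j) e s = trans (sym (e i)) (trans s (e j))
  Sat-ext (neg φ) e s t = s (Sat-ext φ (λ i → sym (e i)) t)
  Sat-ext (conj φ ψ) e (s , t) = Sat-ext φ e s , Sat-ext ψ e t
  Sat-ext (ex φ) e (x , s) = x , Sat-ext φ (λ { zero → refl ; (suc i) → e i }) s

  module _ (α : AutT E) where
    open AutT α

    Sat-aut : ∀ {n} (φ : Formula n) {v : Fin n → ℕ} → (Sat E φ v → Sat E φ (λ i → to (v i))) × (Sat E φ (λ i → to (v i)) → Sat E φ v)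
    Sat-aut (edge i j) = (λ s → trans (preserve _ _) s) , (λ s → trans (sym (preserve _ _)) s)
    Sat-aut (eq i j) = cong to , (λ s → trans (sym (from-to _)) (trans (cong from s) (from-to _)))
    Sat-aut (neg φ) = (λ s t → s (proj₂ (Sat-aut φ) t)) , (λ s t → s (proj₁ (Sat-aut φ) t))
    Sat-aut (conj φ ψ) = (λ (s , t) → proj₁ (Sat-aut φ) s , proj₁ (Sat-aut ψ) t) , (λ (s , t) → proj₂ (Sat-aut φ) s , proj₂ (Sat-aut ψ) t)
    Sat-aut (ex φ) {v} = (λ (x , s) → to x , Sat-ext φ (λ { zero → refl ; (suc i) → refl }) (proj₁ (Sat-aut φ) s)) ,
      (λ (x , s) → from x , proj₂ (Sat-aut φ) (Sat-ext φ (λ { zero → sym (to-from x) ; (suc i) → refl }) s))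

coords : ∀ {k} → List (Fin k → ℕ) → List ℕ
coords F = concatMap tabulate F

coords∈ : ∀ {k} {F : List (Fin k → ℕ)} {a} → a ∈ F → ∀ j → a j ∈ coords F
coords∈ {F = F} {a} m j = ∈-concatMap⁺ tabulate (Any.map (λ { refl → ∈-tabulate⁺ {f = a} j }) m)

module Structures (em : ExcludedMiddle 0ℓ) (E : ℕ → ℕ → Bool) (uht : IsUniversalHomogeneousTournament E)
  {I : Set} (ar : I → ℕ) (R : (i : I) → (Fin (ar i) → ℕ) → Set)
  (red : Structure.IsReduct ar R E) (mcc : Structure.ModelCompleteCore ar R) where
  open Structure ar R
  open IsUniversalHomogeneousTournament uht
  private module T = TournamentProps tournament

  -- Satisfaction depends only on the values of an assignment, and definability passes this on to
  -- the relations.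
  Rext : ∀ {i} {v w : Fin (ar i) → ℕ} → (∀ l → v l ≡ w l) → R i v → R i w
  Rext {i} e r = proj₂ (proj₂ (red i) _) (Sat-ext E (proj₁ (red i)) e (proj₁ (proj₂ (red i) _) r))

  autA : AutT E → AutA
  autA α = record { to = AutT.to α ; from = AutT.from α ; to-from = AutT.to-from α ; from-to = AutT.from-to α
    ; pres = λ i v r → proj₂ (proj₂ (red i) _) (proj₁ (Sat-aut E α (proj₁ (red i))) (proj₁ (proj₂ (red i) _) r))
    ; refl' = λ i v r → proj₂ (proj₂ (red i) _) (proj₂ (Sat-aut E α (proj₁ (red i))) (proj₁ (proj₂ (red i) _) r)) }

  opaque
    homT : (ps : List (ℕ × ℕ)) → AllPairs T.SEp ps → Σ (AutT E) λ α → ∀ p → p ∈ ps → AutT.to α (proj₁ p) ≡ proj₂ p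
    homT ps ap with T.tuple ps ap
    ... | t with homogeneous (T.Tuple.n t) (T.Tuple.a t) (T.Tuple.b t) (T.Tuple.ia t) (T.Tuple.ib t) (T.Tuple.same t)
    ... | α , h = α , λ p m → let (i , q , r) = T.Tuple.cover t p m in trans (cong (AutT.to α) (sym q)) (trans (h i) r)

    -- Universality provides a copy of `L` together with the wanted point, and homogeneity moves the
    -- copy of `L` back onto `L`.
    extension : Extension E
    extension L p = AutT.to α (f zero) , λ x m → let i = index (∈-deduplicate⁺ _≟_ m) ; q = lookup-index (∈-deduplicate⁺ _≟_ m) in
        (λ e → zs (fi (trans (sym (AutT.from-to α _)) (trans (cong (AutT.from α) (trans e (trans q (sym (h i))))) (AutT.from-to α _))))) ,
        trans (cong (E _) (trans q (sym (h i)))) (trans (AutT.preserve α _ _) (trans (fe zero (suc i)) (cong p (sym q))))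
      where
      ts : List ℕ
      ts = deduplicate _≟_ L
      t : Fin (length ts) → ℕ
      t = lookup ts
      ti : Inj t
      ti {i} {j} e with i ≟F j
      ... | yes q = q
      ... | no n with allpairs-lookup ts (deduplicate-! _≟_ L) i j n
      ... | inj₁ k = ⊥-elim (k e)
      ... | inj₂ k = ⊥-elim (k (sym e))
      e : Fin (suc (length ts)) → Fin (suc (length ts)) → Bool
      e zero zero = false
      e zero (suc j) = p (t j)
      e (suc i) zero = not (p (t i))
      e (suc i) (suc j) = E (t i) (t j)
      et : IsTournament e
      et = record { irrefl = λ { zero → refl ; (suc i) → T.irrefl (t i) } ; total = tot ; asym = as }
        where
        tot : ∀ x y → x ≢ y → (e x y ≡ true) ⊎ (e y x ≡ true)
        tot zero zero n = ⊥-elim (n refl)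
        tot zero (suc j) n with p (t j)
        ... | true = inj₁ refl
        ... | false = inj₂ refl
        tot (suc i) zero n with p (t i)
        ... | true = inj₂ refl
        ... | false = inj₁ refl
        tot (suc i) (suc j) n = T.total (t i) (t j) (λ q → n (cong suc (ti q)))
        as : ∀ x y → e x y ≡ true → e y x ≡ false
        as zero (suc j) q = cong not q
        as (suc i) zero q with p (t i)
        ... | false = refl
        as (suc i) (suc j) q = T.asym (t i) (t j) q
      U : Σ (Fin (suc (length ts)) → ℕ) λ f → Inj f × (∀ i j → E (f i) (f j) ≡ e i j)
      U = universal _ e et
      f : Fin (suc (length ts)) → ℕ
      f = proj₁ U
      fi : Inj f
      fi = proj₁ (proj₂ U)
      fe : ∀ i j → E (f i) (f j) ≡ e i j
      fe = proj₂ (proj₂ U)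
      A : Σ (AutT E) λ α → ∀ i → AutT.to α (f (suc i)) ≡ t i
      A = homogeneous _ (λ i → f (suc i)) t (λ q → sucinj (fi q)) ti (λ i j → fe (suc i) (suc j))
        where sucinj : ∀ {n} {i j : Fin n} → _≡_ {A = Fin (suc n)} (suc i) (suc j) → i ≡ j
              sucinj refl = refl
      α : AutT E
      α = proj₁ A
      h : ∀ i → AutT.to α (f (suc i)) ≡ t i
      h = proj₂ A
      zs : ∀ {n} {i : Fin n} → _≢_ {A = Fin (suc n)} zero (suc i)
      zs ()

  world : CoreClone
  world = record
    { em = em ; E = E ; tour = tournament ; ext = extension
    ; G = AutA ; to = AutA.to ; from = AutA.from ; to-from = AutA.to-from ; from-to = AutA.from-to
    ; mul = λ g h → record { to = λ x → AutA.to g (AutA.to h x) ; from = λ x → AutA.from h (AutA.from g x)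
        ; to-from = λ x → trans (cong (AutA.to g) (AutA.to-from h _)) (AutA.to-from g x) ; from-to = λ x → trans (cong (AutA.from h) (AutA.from-to g _)) (AutA.from-to h x)
        ; pres = λ i v r → AutA.pres g i _ (AutA.pres h i v r) ; refl' = λ i v r → AutA.refl' h i v (AutA.refl' g i _ r) } , λ _ → refl
    ; inv = λ g → record { to = AutA.from g ; from = AutA.to g ; to-from = AutA.from-to g ; from-to = AutA.to-from g
        ; pres = λ i v r → AutA.refl' g i _ (Rext (λ l → sym (AutA.to-from g (v l))) r)
        ; refl' = λ i v r → Rext (λ l → AutA.to-from g (v l)) (AutA.pres g i _ r) } , λ _ → refl
    ; homG = λ a b ia ib s → let (α , h) = homogeneous _ a b ia ib s in autA α , h
    -- Members respect pointwise equality of arguments, which a polymorphism as such need not do.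
    ; C = λ f → IsPol f × (∀ {x y} → x ≗' y → f x ≡ f y)
    ; Cext = proj₂
    ; Cproj = λ j → (λ i m h → h j) , λ e → e j
    ; Ccomp = λ (pf , ef) h → (λ i m r → pf i _ (λ j → proj₁ (h j) i m r)) , λ e → ef (λ j → proj₂ (h j) e)
    ; CG = λ g → (λ i m r → AutA.pres g i _ (r zero)) , λ e → cong (AutA.to g) (e zero)
    ; core = λ {u} (pu , _) F → mcc u (λ i v r → pu i (λ _ → v) (λ _ → r)) F
    ; closed = λ {k} f ef loc → (λ i m r → let (g , (pg , _) , q) = loc (tabulate (λ l j → m j l)) in Rext (λ l → q _ (∈-tabulate⁺ {f = λ l j → m j l} l)) (pg i m r)) , ef }

  open CoreCloneProps world hiding (em; E)

  -- Passing through a vector selects one representative from each class of pointwise equal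
  -- arguments.
  canon : ∀ {k} → (Fin k → ℕ) → Fin k → ℕ
  canon x = Vec.lookup (Vec.tabulate x)

  canon-≗ : ∀ {k} (x : Fin k → ℕ) → canon x ≗' x
  canon-≗ x j = lookup∘tabulate x j

  canon-ext : ∀ {k} {x y : Fin k → ℕ} → x ≗' y → canon x ≡ canon y
  canon-ext e = cong Vec.lookup (tabulate-cong e)

  -- f need not respect pointwise equality of its argument; a variant of f that
  -- does is obtained by choosing representatives.
  variant : ∀ {k n} (f : Op n) → IsPol f → {g : Fin n → Op k} → (∀ j → C (g j)) → (Y : (Fin k → ℕ) → Fin n → ℕ) → (∀ x → Y x ≗' (λ j → g j x)) →
    IsPol (λ x → f (Y x))
  variant f pf cg Y h i m r = pf i (λ j l → Y (λ j → m j l) j) (λ j → Rext (λ l → sym (h (λ j → m j l) j)) (proj₁ (cg j) i m r))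

  hat : ∀ {k} → Op k → Op k
  hat f x = f (canon x)

  C-hat : ∀ {k} (f : Op k) → IsPol f → C (hat f)
  C-hat f pf = variant f pf {λ j v → v j} Cproj canon canon-≗ , λ e → cong f (canon-ext e)

  -- Reading a coordinate off every operation, compatibly with composition and
  -- determined by finitely many values, is a uniformly continuous homomorphism.
  record Reading : Set₁ where
    field
      Fol : ∀ {k} → Op k → Fin k → Set
      exist : ∀ {k} {f : Op k} → C f → Σ (Fin k) (Fol f)
      local : ∀ k → Σ (List (Fin k → ℕ)) λ F → ∀ {f g : Op k} → C f → C g → (∀ a → a ∈ F → f a ≡ g a) → ∀ {i j} → Fol f i → Fol g j → i ≡ j
      on-proj : ∀ {k} (j : Fin k) → Fol (λ v → v j) j
      on-comp : ∀ {n k} {f : Op n} {g : Fin n → Op k} → C f → (∀ j → C (g j)) → ∀ {i j} → Fol f i → Fol (g i) j → Fol (λ v → f (λ j → g j v)) j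

  private
    away : (av L : List ℕ) → Σ (List (ℕ × ℕ)) λ ps → (∀ {a b} → a ∈ ps → b ∈ ps → SEp a b) × (∀ a → a ∈ ps → ∀ v → v ∈ av → proj₂ a ≢ v) × (∀ x → x ∈ L → Σ ℕ λ y → (x , y) ∈ ps)
    away av [] = [] , (λ ()) , (λ _ ()) , λ _ ()
    away av (x ∷ L) with away av L
    ... | ps , ap , aw , cov with em {Σ ℕ λ y → (x , y) ∈ ps}
    ... | yes (y , m) = ps , ap , aw , λ { v (here refl) → y , m ; v (there k) → cov v k }
    ... | no new with extL (map (λ (v , v') → v' , E x v) ps) (AP-map (allpairs-∈ ps (λ a b e → cong (E x) (se-≡ (sym-se (ap a b)) e)))) av
    ... | y , hits , yav = (x , y) ∷ ps , ap' , (λ { a (here refl) → yav ; a (there m) → aw a m }) , λ { v (here refl) → y , here refl ; v (there k) → let (u , m) = cov v k in u , there m }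
      where
      S : ∀ {v} → v ∈ ps → SEp (x , y) v
      S {v} m = let (n , e) = All.lookup (All-map⁻ hits) m in se (λ q → new (proj₂ v , subst (λ s → (s , proj₂ v) ∈ ps) (sym q) m)) n (sym e)
      ap' : ∀ {a b} → a ∈ (x , y) ∷ ps → b ∈ (x , y) ∷ ps → SEp a b
      ap' (here refl) (here refl) = rf-se
      ap' (here refl) (there m) = S m
      ap' (there m) (here refl) = sw-se (S m)
      ap' (there m) (there k) = ap m k

    avoiding : (L : List ℕ) → Σ G λ g → ∀ x → x ∈ L → ∀ v → v ∈ L → to g x ≢ v
    avoiding L with away L L
    ... | ps , ap , aw , cov with homGL ps (allpairs-∈ ps ap)
    ... | g , h = g , λ x m v k e → let (y , q) = cov x m in aw _ q v k (trans (sym (All.lookup h q)) e)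

  module _ (rd : Reading) where
    open Reading rd

    private
      ξ : Hom
      ξ k f pf = proj₁ (exist (C-hat f pf))

      fol-unary : ∀ g {k} (j : Fin k) → Fol (λ v → to g (v j)) j
      fol-unary g j with exist (CG g)
      ... | zero , h = on-comp {g = λ (_ : Fin 1) v → v j} (CG g) (λ _ → Cproj j) h (on-proj j)

      -- `H` belongs to the composite, `H0` to the composite of the variants, and they differ in the
      -- representatives passed to `f`. `H1` agrees with `H` on the test points and with `H0`
      -- elsewhere. The test points show that `H1` has the coordinate of `H`; precomposing with an
      -- automorphism that moves them off themselves shows that it has the coordinate of `H0`.
      ξ-comp : ∀ n k (f : Op n) (pf : IsPol f) (g : Fin n → Op k) (pg : ∀ j → IsPol (g j)) (pc : IsPol (compose f g)) →
        ξ k (compose f g) pc ≡ ξ k (g (ξ n f pf)) (pg (ξ n f pf))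
      ξ-comp n zero f pf g pg pc with ξ zero (compose f g) pc
      ... | ()
      ξ-comp n (suc k) f pf g pg pc = trans (sym e1) e2
        where
        F = proj₁ (local (suc k))
        loc = proj₂ (local (suc k))
        u = avoiding (coords F)
        H0 H H1 : Op (suc k)
        H0 x = hat f (λ j → hat (g j) x)
        H x = f (λ j → hat (g j) x)
        In : (Fin (suc k) → ℕ) → Set
        In x = Σ (Fin (suc k) → ℕ) λ a → (a ∈ F) × (x ≗' a)
        Y : (Fin (suc k) → ℕ) → Fin n → ℕ
        Y x with em {In x}
        ... | yes _ = λ j → hat (g j) x
        ... | no _ = canon (λ j → hat (g j) x)
        H1 x = f (Y x)
        Y-≗ : ∀ x → Y x ≗' (λ j → hat (g j) x)
        Y-≗ x with em {In x}
        ... | yes _ = λ j → refl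
        ... | no _ = canon-≗ _
        in-H : ∀ x → In x → H1 x ≡ H x
        in-H x i with em {In x}
        ... | yes _ = refl
        ... | no k = ⊥-elim (k i)
        out-H : ∀ x → ¬ In x → H1 x ≡ H0 x
        out-H x ni with em {In x}
        ... | yes i = ⊥-elim (ni i)
        ... | no _ = refl
        Hext : ∀ {x y} → x ≗' y → H x ≡ H y
        Hext e = cong (λ c → f (λ j → g j c)) (canon-ext e)
        cH0 : C H0
        cH0 = Ccomp {g = λ j → hat (g j)} (C-hat f pf) (λ j → C-hat (g j) (pg j))
        cH : C H
        cH = C-hat (compose f g) pc
        H1ext : ∀ {x y} → x ≗' y → H1 x ≡ H1 y
        H1ext {x} {y} e with em {In x}
        ... | yes (a , m , q) = trans (Hext e) (sym (in-H y (a , m , λ j → trans (sym (e j)) (q j))))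
        ... | no ni = trans (Cext cH0 e) (sym (out-H y (λ (a , m , q) → ni (a , m , λ j → trans (e j) (q j)))))
        cH1 : C H1
        cH1 = variant f pf {λ j → hat (g j)} (λ j → C-hat (g j) (pg j)) Y Y-≗ , H1ext
        f1 = exist cH1
        e1 : proj₁ f1 ≡ ξ (suc k) (compose f g) pc
        e1 = loc cH1 cH (λ a m → in-H a (a , m , λ _ → refl)) (proj₂ f1) (proj₂ (exist (C-hat (compose f g) pc)))
        cu : ∀ j → C {suc k} (λ v → to (proj₁ u) (v j))
        cu j = Ccomp {g = λ (_ : Fin 1) v → v j} (CG (proj₁ u)) (λ _ → Cproj j)
        e2 : proj₁ f1 ≡ ξ (suc k) (g (ξ n f pf)) (pg (ξ n f pf))
        e2 = loc {λ v → H1 (λ j → to (proj₁ u) (v j))} {λ v → H0 (λ j → to (proj₁ u) (v j))} (Ccomp {g = λ j v → to (proj₁ u) (v j)} cH1 cu) (Ccomp {g = λ j v → to (proj₁ u) (v j)} cH0 cu)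
          (λ a m → out-H _ (λ (b , m' , q) → proj₂ u (a zero) (coords∈ m zero) (b zero) (coords∈ m' zero) (q zero)))
          (on-comp {g = λ j v → to (proj₁ u) (v j)} cH1 cu (proj₂ f1) (fol-unary (proj₁ u) _))
          (on-comp {g = λ j v → to (proj₁ u) (v j)} cH0 cu (on-comp {g = λ j → hat (g j)} (C-hat f pf) (λ j → C-hat (g j) (pg j)) (proj₂ (exist (C-hat f pf))) (proj₂ (exist (C-hat (g (ξ n f pf)) (pg (ξ n f pf)))))) (fol-unary (proj₁ u) _))

    condition1 : Condition1
    condition1 = ξ , ((λ k j p → proj₂ (local k) (C-hat (proj j) p) (Cproj j) (λ a _ → canon-≗ a j) (proj₂ (exist (C-hat (proj j) p))) (on-proj j)) , ξ-comp) ,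
      λ n → map canon (proj₁ (local n)) , λ f pf g pg h → proj₂ (local n) (C-hat f pf) (C-hat g pg) (λ a m → h (canon a) (∈-map⁺ canon m)) (proj₂ (exist (C-hat f pf))) (proj₂ (exist (C-hat g pg)))

  private
    put : ∀ {k} → Fin k → ℕ → (Fin k → ℕ) → Fin k → ℕ
    put i a x j with j ≟F i
    ... | yes _ = a
    ... | no _ = x j

    put-at : ∀ {k} (i : Fin k) a x → put i a x i ≡ a
    put-at i a x with i ≟F i
    ... | yes _ = refl
    ... | no n = ⊥-elim (n refl)

    put-off : ∀ {k} {i j : Fin k} a x → j ≢ i → put i a x j ≡ x j
    put-off {i = i} {j} a x n with j ≟F i
    ... | yes e = ⊥-elim (n e)
    ... | no _ = refl

  triad-reading : (∀ {k} {f : Op k} → C f → Σ (Fin k) (Triads.FollowsTriads world f)) → Reading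
  triad-reading fol = record
    { Fol = FollowsTriads ; exist = fol ; on-proj = λ j → false , λ _ _ _ → refl
    ; on-comp = λ { {f = f} {g} cf cg {i} {j} (σ , h) (σ' , h') → (σ xor σ') , λ {x} {y} {z} xy yz zx →
        trans (h (λ j → strictW (cg j) xy) (λ j → strictW (cg j) yz) (λ j → strictW (cg j) zx)) (trans (cong (σ xor_) (h' xy yz zx)) (sym (xor-assoc σ σ' _))) }
    ; local = loc }
    where
    open Triads world
    b₀ a₀ : ℕ
    b₀ = 0
    a₀ = proj₁ (ext (b₀ ∷ []) (λ _ → true))
    ab : E a₀ b₀ ≡ true
    ab = proj₂ (proj₂ (ext (b₀ ∷ []) (λ _ → true)) b₀ (here refl))
    pt : ∀ β → Σ ℕ λ c → (c ≢ a₀) × (c ≢ b₀) × (triad E a₀ b₀ c ≡ β)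
    pt β with extL ((a₀ , true) ∷ (b₀ , not β) ∷ []) ((ag (arc≢ ab) ∷ []) ∷ [] ∷ []) []
    ... | c , (n1 , e1) ∷ (n2 , e2) ∷ [] , _ = c , n1 , n2 , trans (cong₂ _xor_ ab (cong₂ _xor_ (flip' n2 e2) e1)) (v β)
      where v : ∀ β → (true xor (not (not β) xor true)) ≡ β
            v true = refl
            v false = refl
    c : Bool → ℕ
    c β = proj₁ (pt β)
    loc : ∀ k → Σ (List (Fin k → ℕ)) λ F → ∀ {f g : Op k} → C f → C g → (∀ a → a ∈ F → f a ≡ g a) → ∀ {i j} → FollowsTriads f i → FollowsTriads g j → i ≡ j
    -- The triad of `a₀`, `b₀`, `c β` is `β`. Changing `c true` to `c false` at coordinate `i`
    -- alters the triad of the values for an operation following `i` and for no other, whatever the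
    -- signs.
    loc k = (λ _ → a₀) ∷ (λ _ → b₀) ∷ (λ _ → c true) ∷ map (λ i → put i (c false) (λ _ → c true)) (allFin k) , same
      where
      same : ∀ {f g : Op k} → C f → C g → (∀ a → a ∈ (λ _ → a₀) ∷ (λ _ → b₀) ∷ (λ _ → c true) ∷ map (λ i → put i (c false) (λ _ → c true)) (allFin k) → f a ≡ g a) → ∀ {i j} → FollowsTriads f i → FollowsTriads g j → i ≡ j
      same {f} {g} cf cg ag' {i} {j} (σ , h) (σ' , h') with i ≟F j
      ... | yes e = e
      ... | no n = ⊥-elim (xf σ (trans (sym (trans fz fz')) (trans feq (trans (trans gz (sym gz')) (trans (sym geq) fc)))))
        where
        A B Z Zi : Fin k → ℕ
        A _ = a₀
        B _ = b₀
        Z _ = c true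
        Zi = put i (c false) (λ _ → c true)
        AB : A # B
        AB _ = arc≢ ab
        BZ : B # Z
        BZ _ e = proj₁ (proj₂ (proj₂ (pt true))) (sym e)
        ZA : Z # A
        ZA _ = proj₁ (proj₂ (pt true))
        ci : ∀ l → (Zi l ≢ a₀) × (Zi l ≢ b₀)
        ci l with l ≟F i
        ... | yes _ = proj₁ (proj₂ (pt false)) , proj₁ (proj₂ (proj₂ (pt false)))
        ... | no _ = proj₁ (proj₂ (pt true)) , proj₁ (proj₂ (proj₂ (pt true)))
        BZi : B # Zi
        BZi l e = proj₂ (ci l) (sym e)
        ZiA : Zi # A
        ZiA l = proj₁ (ci l)
        fz : triad E (f A) (f B) (f Zi) ≡ (σ xor triad E a₀ b₀ (Zi i))
        fz = h AB BZi ZiA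
        fz' : (σ xor triad E a₀ b₀ (Zi i)) ≡ (σ xor false)
        fz' = cong (σ xor_) (trans (cong (triad E a₀ b₀) (put-at i _ _)) (proj₂ (proj₂ (proj₂ (pt false)))))
        fc : triad E (f A) (f B) (f Z) ≡ (σ xor true)
        fc = trans (h AB BZ ZA) (cong (σ xor_) (proj₂ (proj₂ (proj₂ (pt true)))))
        xf : ∀ σ → (σ xor false) ≢ (σ xor true)
        xf true ()
        xf false ()
        gz : triad E (g A) (g B) (g Zi) ≡ (σ' xor triad E a₀ b₀ (c true))
        gz = trans (h' AB BZi ZiA) (cong (λ u → σ' xor triad E a₀ b₀ u) (put-off _ _ (λ e → n (sym e))))
        gz' : triad E (g A) (g B) (g Z) ≡ (σ' xor triad E a₀ b₀ (c true))
        gz' = h' AB BZ ZA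
        feq : triad E (f A) (f B) (f Zi) ≡ triad E (g A) (g B) (g Zi)
        feq = trans (cong₂ (λ u v → triad E u v (f Zi)) (ag' A (here refl)) (ag' B (there (here refl)))) (cong (triad E (g A) (g B)) (ag' Zi (there (there (there (∈-map⁺ _ (∈-allFin i)))))))
        geq : triad E (f A) (f B) (f Z) ≡ triad E (g A) (g B) (g Z)
        geq = trans (cong₂ (λ u v → triad E u v (f Z)) (ag' A (here refl)) (ag' B (there (here refl)))) (cong (triad E (g A) (g B)) (ag' Z (there (there (here refl)))))

  unary-reading : ¬ Triads.Essential world → Reading
  unary-reading ness = record
    { Fol = Fol ; exist = λ {k} cf → ex' k cf ; on-proj = λ j e → e ; on-comp = λ cf cg {i} {j} hf hg e → hf (hg e) ; local = loc }
    where
    Fol : ∀ {k} → Op k → Fin k → Set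
    Fol f j = ∀ {x y} → x j ≡ y j → f x ≡ f y
    loc : ∀ k → Σ (List (Fin k → ℕ)) λ F → ∀ {f g : Op k} → C f → C g → (∀ a → a ∈ F → f a ≡ g a) → ∀ {i j} → Fol f i → Fol g j → i ≡ j
    loc k = (λ _ → 0) ∷ map (λ i → put i 1 (λ _ → 0)) (allFin k) , same
      where
      same : ∀ {f g : Op k} → C f → C g → (∀ a → a ∈ (λ _ → 0) ∷ map (λ i → put i 1 (λ _ → 0)) (allFin k) → f a ≡ g a) → ∀ {i j} → Fol f i → Fol g j → i ≡ j
      same {f} {g} cf cg ag' {i} {j} h h' with i ≟F j
      ... | yes e = e
      ... | no n = ⊥-elim (strictW cf {λ _ → 1} {λ _ → 0} (λ _ ()) (trans (h {λ _ → 1} {put i 1 (λ _ → 0)} (sym (put-at i 1 _)))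
            (trans (ag' _ (there (∈-map⁺ _ (∈-allFin i)))) (trans (h' {put i 1 (λ _ → 0)} {λ _ → 0} (put-off 1 _ (λ e → n (sym e)))) (sym (ag' _ (here refl)))))))
    no2 : ∀ {h} → C {2} (λ v → h (v zero) (v (suc zero))) → ∀ {a b c} → h a c ≢ h b c → ∀ s c d → h s c ≡ h s d
    no2 {h} ch {a} {b} {c₀} d s c d' with h s c ≟ h s d'
    ... | yes e = e
    ... | no n = ⊥-elim (ness (record { h = h ; ch = OpCloneProps.mk2 ch ; a = a ; b = b ; c = c₀ ; d1 = d ; a' = s ; c' = c ; d' = d' ; d2 = n }))
    ex' : ∀ k {f : Op k} → C f → Σ (Fin k) (Fol f)
    ex' k {f} cf with em {Σ (Fin k) λ i → Σ (Fin k → ℕ) λ r → Σ ℕ λ a → Σ ℕ λ b → f (put i a r) ≢ f (put i b r)}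
    ... | no none = ⊥-elim (strictW cf {λ _ → 0} {λ _ → 1} (λ _ ()) (const (allFin k) (λ _ → 0) (λ _ → 1) (λ j m → ⊥-elim (m (∈-allFin j)))))
      where
      inv' : ∀ i r a b → f (put i a r) ≡ f (put i b r)
      inv' i r a b with f (put i a r) ≟ f (put i b r)
      ... | yes e = e
      ... | no n = ⊥-elim (none (i , r , a , b , n))
      const : ∀ L x y → (∀ j → ¬ (j ∈ L) → x j ≡ y j) → f x ≡ f y
      const [] x y h = Cext cf (λ j → h j (λ ()))
      const (i ∷ L) x y h = trans (trans (Cext cf (λ j → own j)) (inv' i x (x i) (y i))) (const L (put i (y i) x) y h')
        where
        own : ∀ j → x j ≡ put i (x i) x j
        own j with j ≟F i
        ... | yes refl = refl
        ... | no _ = refl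
        h' : ∀ j → ¬ (j ∈ L) → put i (y i) x j ≡ y j
        h' j m with j ≟F i
        ... | yes refl = refl
        ... | no n = h j (λ { (here e) → n e ; (there q) → m q })
    ... | yes (i , r , a , b , d) = i , λ {x} {y} e → trans (to-r x) (trans (cong (λ u → f (put i u r)) e) (sym (to-r y)))
      where
      arc : Σ ℕ λ c → E c 0 ≡ true
      arc = let (c , h) = ext (0 ∷ []) (λ _ → true) in c , proj₂ (h 0 (here refl))
      c = proj₁ arc
      -- The coordinates other than `i` are made functions of one variable that passes through `x`
      -- and `y`. The resulting binary `h` depends on its first argument, so, not being essential,
      -- it ignores the second.
      step : ∀ x y → (∀ j → E (x j) (y j) ≡ true) → (f (put i a x) ≢ f (put i b x) ⊎ f (put i a y) ≢ f (put i b y)) → ∀ s → f (put i s x) ≡ f (put i s y)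
      step x y xy dep s = trans (sym (hc s)) (trans (no2 {h} ch (proj₂ (split dep)) s c 0) (h0 s))
        where
        g : ∀ j → Σ G λ g → All (λ p → to g (proj₁ p) ≡ proj₂ p) ((c , x j) ∷ (0 , y j) ∷ [])
        g j = homGL _ ((se (arc≢ (proj₂ arc)) (arc≢ (xy j)) (trans (proj₂ arc) (sym (xy j))) ∷ []) ∷ [] ∷ [])
        h : ℕ → ℕ → ℕ
        h s t = f (put i s (λ j → to (proj₁ (g j)) t))
        ch : C {2} (λ v → h (v zero) (v (suc zero)))
        ch = Ccomp {g = λ j v → put i (v zero) (λ j → to (proj₁ (g j)) (v (suc zero))) j} cf cj
          where
          cj : ∀ j → C {2} (λ v → put i (v zero) (λ j → to (proj₁ (g j)) (v (suc zero))) j)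
          cj j with j ≟F i
          ... | yes _ = Cproj zero
          ... | no _ = Ccomp {g = λ (_ : Fin 1) v → v (suc zero)} (CG (proj₁ (g j))) (λ _ → Cproj (suc zero))
        pc : ∀ {t z} → (∀ j → to (proj₁ (g j)) t ≡ z j) → ∀ s → h s t ≡ f (put i s z)
        pc {t} {z} q s = Cext cf pw
          where
          pw : ∀ j → put i s (λ j → to (proj₁ (g j)) t) j ≡ put i s z j
          pw j with j ≟F i
          ... | yes _ = refl
          ... | no _ = q j
        hc : ∀ s → h s c ≡ f (put i s x)
        hc = pc (λ j → All.lookup (proj₂ (g j)) (here refl))
        h0 : ∀ s → h s 0 ≡ f (put i s y)
        h0 = pc (λ j → All.lookup (proj₂ (g j)) (there (here refl)))
        split : (f (put i a x) ≢ f (put i b x) ⊎ f (put i a y) ≢ f (put i b y)) → Σ ℕ λ t → h a t ≢ h b t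
        split (inj₁ q) = c , λ e → q (trans (sym (hc a)) (trans e (hc b)))
        split (inj₂ q) = 0 , λ e → q (trans (sym (h0 a)) (trans e (h0 b)))
      to-r : ∀ x → f x ≡ f (put i (x i) r)
      to-r x = trans (Cext cf (λ j → own j)) (trans (step x z (λ j → proj₂ (proj₂ (Z j))) (inj₂ (λ e → d (trans (rz a) (trans e (sym (rz b)))))) (x i)) (sym (rz (x i))))
        where
        own : ∀ j → x j ≡ put i (x i) x j
        own j with j ≟F i
        ... | yes refl = refl
        ... | no _ = refl
        -- A common out-neighbour in each coordinate joins `x` to `r` by two applications of `step`.
        Z : ∀ j → Σ ℕ λ z → (E (r j) z ≡ true) × (E (x j) z ≡ true)
        Z j with extL ((r j , false) ∷ (x j , false) ∷ []) (((λ _ → refl) ∷ []) ∷ [] ∷ []) []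
        ... | z , (n1 , e1) ∷ (n2 , e2) ∷ [] , _ = z , farc n1 e1 , farc n2 e2
        z : Fin k → ℕ
        z j = proj₁ (Z j)
        rz : ∀ s → f (put i s r) ≡ f (put i s z)
        rz = step r z (λ j → proj₁ (proj₂ (Z j))) (inj₁ d)

-- Amalgamation, the cyclic operation and the dichotomy.

module Amalgam (em : ExcludedMiddle 0ℓ) {E : ℕ → ℕ → Bool} (tour : IsTournament E)
  (ext : Extension E) where
  open TournamentProps tour
  open Dense em tour ext

  -- Two copies of the tournament are glued along the identification of p t with q t:
  -- rep moves a point q t of the second copy to the point p t of the first.
  opaque
    amalgam : ∀ {T : Set} (p q : T → ℕ) → (∀ t t' → E (p t) (p t') ≡ E (q t) (q t')) →
      Σ (ℕ → ℕ) λ e → Σ (ℕ → ℕ) λ f → (∀ x y → E (e x) (e y) ≡ E x y) × (∀ x y → E (f x) (f y) ≡ E x y) × (∀ t → e (p t) ≡ f (q t))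
    amalgam {T} p q pq = (λ x → ψ (enc (inj₁ x))) , (λ x → ψ (enc (inj₂ x))) , (λ x y → val (inj₁ x) (inj₁ y)) , (λ x y → trans (val (inj₂ x) (inj₂ y)) (right x y)) ,
        λ t → eqT (trans (val (inj₁ (p t)) (inj₂ (q t))) (trans (cong (N (inj₁ (p t))) (rep-q t)) (N-irr (inj₁ (p t)))))
                  (trans (val (inj₂ (q t)) (inj₁ (p t))) (trans (cong (λ u → N u (inj₁ (p t))) (rep-q t)) (N-irr (inj₁ (p t)))))
      where
      J : Set
      J = ℕ ⊎ ℕ
      q→p : ∀ {t t'} → q t ≡ q t' → p t ≡ p t'
      q→p {t} {t'} e = eqT (trans (pq t t') (trans (cong (λ u → E u (q t')) e) (irrefl _))) (trans (pq t' t) (trans (cong (E (q t')) e) (irrefl _)))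
      p→q : ∀ {t t'} → p t ≡ p t' → q t ≡ q t'
      p→q {t} {t'} e = eqT (trans (sym (pq t t')) (trans (cong (λ u → E u (p t')) e) (irrefl _))) (trans (sym (pq t' t)) (trans (cong (E (p t')) e) (irrefl _)))
      rep : J → J
      rep (inj₁ m) = inj₁ m
      rep (inj₂ n) with em {Σ T λ t → q t ≡ n}
      ... | yes (t , _) = inj₁ (p t)
      ... | no _ = inj₂ n
      rep-q : ∀ t → rep (inj₂ (q t)) ≡ inj₁ (p t)
      rep-q t with em {Σ T λ t' → q t' ≡ q t}
      ... | yes (t' , e) = cong inj₁ (q→p e)
      ... | no n = ⊥-elim (n (t , refl))
      cross : ℕ → ℕ → Bool
      cross m n with em {Σ T λ t → p t ≡ m}
      ... | yes (t , _) = E (q t) n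
      -- An arbitrary direction between points outside the common part: `rep` has already replaced
      -- the identified points of the second copy.
      ... | no _ = true
      cross-p : ∀ t n → cross (p t) n ≡ E (q t) n
      cross-p t n with em {Σ T λ t' → p t' ≡ p t}
      ... | yes (t' , e) = cong (λ u → E u n) (p→q e)
      ... | no k = ⊥-elim (k (t , refl))
      N : J → J → Bool
      N (inj₁ m) (inj₁ m') = E m m'
      N (inj₂ n) (inj₂ n') = E n n'
      N (inj₁ m) (inj₂ n) = cross m n
      N (inj₂ n) (inj₁ m) = not (cross m n)
      N-irr : ∀ i → N i i ≡ false
      N-irr (inj₁ m) = irrefl m
      N-irr (inj₂ n) = irrefl n
      N-flip : ∀ i j → i ≢ j → N j i ≡ not (N i j)
      N-flip (inj₁ m) (inj₁ m') n = flip (λ e → n (cong inj₁ e))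
      N-flip (inj₂ m) (inj₂ m') n = flip (λ e → n (cong inj₂ e))
      N-flip (inj₁ m) (inj₂ n) _ = refl
      N-flip (inj₂ n) (inj₁ m) _ = sym (not-involutive _)
      dec : ℕ → J
      dec c with pairs c
      ... | zero , k = inj₁ k
      ... | suc _ , k = inj₂ k
      enc : J → ℕ
      enc (inj₁ m) = code (0 , m)
      enc (inj₂ n) = code (1 , n)
      dec-enc : ∀ i → dec (enc i) ≡ i
      dec-enc (inj₁ m) with pairs (code (0 , m)) | pairs-code (0 , m)
      ... | _ | refl = refl
      dec-enc (inj₂ n) with pairs (code (1 , n)) | pairs-code (1 , n)
      ... | _ | refl = refl
      as : ∀ i j → N i j ≡ true → N j i ≡ false
      as i j e with em {i ≡ j}
      ... | yes refl = N-irr i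
      ... | no n = trans (N-flip i j n) (cong not e)
      cg : ∀ i j k → N i j ≡ false → N j i ≡ false → (N i k ≡ N j k) × (N k i ≡ N k j)
      cg i j k a b with em {i ≡ j}
      ... | yes refl = refl , refl
      ... | no n = ⊥-elim (t≢f (trans (N-flip i j n) (cong not a)) b)
      M : ℕ → ℕ → Bool
      M c d = N (rep (dec c)) (rep (dec d))
      pre : PreTournament M
      pre = record { pirr = λ i → N-irr (rep (dec i)) ; pasym = λ i j → as (rep (dec i)) (rep (dec j)) ; pcong = λ i j k → cg (rep (dec i)) (rep (dec j)) (rep (dec k)) }
      R : Σ (ℕ → ℕ) λ ψ → (ψ 0 ≡ 0) × (∀ i j → E (ψ i) (ψ j) ≡ M i j)
      R = realize M pre 0
      ψ : ℕ → ℕ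
      ψ = proj₁ R
      val : ∀ i j → E (ψ (enc i)) (ψ (enc j)) ≡ N (rep i) (rep j)
      val i j = trans (proj₂ (proj₂ R) (enc i) (enc j)) (cong₂ (λ u v → N (rep u) (rep v)) (dec-enc i) (dec-enc j))
      right : ∀ x y → N (rep (inj₂ x)) (rep (inj₂ y)) ≡ E x y
      right x y with em {Σ T λ t → q t ≡ x} | em {Σ T λ t → q t ≡ y}
      ... | yes (t , refl) | yes (t' , refl) = pq t t'
      ... | yes (t , refl) | no k = cross-p t y
      ... | no k | yes (t' , refl) = trans (cong not (cross-p t' x)) (sym (flip (λ e → k (t' , e))))
      ... | no _ | no _ = refl

module Dichotomy (em : ExcludedMiddle 0ℓ) (E : ℕ → ℕ → Bool) (uht : IsUniversalHomogeneousTournament E)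
  {I : Set} (ar : I → ℕ) (R : (i : I) → (Fin (ar i) → ℕ) → Set)
  (red : Structure.IsReduct ar R E) (mcc : Structure.ModelCompleteCore ar R) where
  open Structure ar R
  open IsUniversalHomogeneousTournament uht
  open Structures em E uht ar R red mcc
  open CoreCloneProps world hiding (em; E)
  open Behaviour em tournament extension
  open Amalgam em tournament extension

  private
    embedding-closure : ∀ e → (∀ x y → E (e x) (e y) ≡ E x y) → InClosureAut E e
    embedding-closure e h F = let (α , k) = homT (map (λ x → x , e x) F) (AP-map (allpairs-∈ F (λ {x} {y} _ _ → sym (h x y) , sym (h y x)))) in
      α , λ x m → k (x , e x) (∈-map⁺ (λ x → x , e x) m)

    tri : (Fin 3 → ℕ) → Tri
    tri v = v zero , v (suc zero) , v (suc (suc zero))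

    tri-cong : ∀ {v w} → v ≗' w → tri v ≡ tri w
    tri-cong e = cong₂ _,_ (e zero) (cong₂ _,_ (e (suc zero)) (e (suc (suc zero))))

    tri-inj : ∀ {v w} → tri v ≡ tri w → v ≗' w
    tri-inj e zero = cong proj₁ e
    tri-inj e (suc zero) = cong (λ t → proj₁ (proj₂ t)) e
    tri-inj e (suc (suc zero)) = cong (λ t → proj₂ (proj₂ t)) e

    ty-aut : (α : AutT E) → ∀ {x y x' y'} → AutT.to α x ≡ x' → AutT.to α y ≡ y' → tyOf E x y ≡ tyOf E x' y'
    ty-aut α {x} {y} refl refl with x ≟ y
    ... | yes e = sym (tyOf-eq E (cong (AutT.to α) e))
    ... | no n = sym (tyOf-ne E (λ e → n (trans (sym (AutT.from-to α x)) (trans (cong (AutT.from α) e) (AutT.from-to α y)))) (AutT.preserve α x y))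

    realize-ty : ∀ a → Σ ℕ λ x → Σ ℕ λ x' → tyOf E x x' ≡ a
    realize-ty eq = 0 , 0 , tyOf-eq E {0} refl
    realize-ty (ne b) = let (z , h) = extension (0 ∷ []) (λ _ → b) in z , 0 , tyOf-ne E (proj₁ (h 0 (here refl))) (proj₂ (h 0 (here refl)))

    -- Every triple of types other than three equalities occurs between two distinct triples of
    -- points, and a local operation evaluated on both of them sees the arc from either side.
    local-odd : ∀ {P β} → Local E P β → OddTy β
    local-odd {β = β} loc a b c n with realize-ty a | realize-ty b | realize-ty c
    ... | x , x' , refl | y , y' , refl | z , z' , refl = go (loc (x ∷ y ∷ z ∷ x' ∷ y' ∷ z' ∷ []))
      where
      tt' : (x , y , z) ≢ (x' , y' , z')
      tt' e = n (tyOf-eq E (cong proj₁ e) , tyOf-eq E (cong (λ t → proj₁ (proj₂ t)) e) , tyOf-eq E (cong (λ t → proj₂ (proj₂ t)) e))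
      ∈0 = here refl
      ∈1 = there (here refl)
      ∈2 = there (there (here refl))
      ∈3 = there (there (there (here refl)))
      ∈4 = there (there (there (there (here refl))))
      ∈5 = there (there (there (there (there (here refl)))))
      go : _ → β (negTy (tyOf E x x')) (negTy (tyOf E y y')) (negTy (tyOf E z z')) ≡ not (β (tyOf E x x') (tyOf E y y') (tyOf E z z'))
      go (s , _ , h) with h ∈0 ∈1 ∈2 ∈3 ∈4 ∈5 tt' | h ∈3 ∈4 ∈5 ∈0 ∈1 ∈2 (λ e → tt' (sym e))
      ... | d , e | _ , e' = trans (cong₂ (λ (u , v) r → β u v r) (cong₂ _,_ (sym (ty-negTy x x')) (sym (ty-negTy y y'))) (sym (ty-negTy z z')))
              (trans (sym e') (flip' d e))

  condition2 : LocalCyclic E (Triads.C3w world) → Condition2 ar R E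
  condition2 (β , cyclic , loc) = s , proj₁ cs , canonical , pseudo
    where
    odd : OddTy β
    odd = local-odd loc
    φ : Tri → ℕ
    φ = proj₁ (behaviour β odd)
    φ-spec : ∀ t t' → t ≢ t' → (φ t ≢ φ t') × (E (φ t) (φ t') ≡ types β t t')
    φ-spec = proj₂ (behaviour β odd)
    φ-se : ∀ {t t'} (u u' : Tri) → (t ≡ t' → u ≡ u') → (u ≡ u' → t ≡ t') → types β t t' ≡ types β u u' → SE (φ t) (φ t') (φ u) (φ u')
    φ-se {t} {t'} u u' f g e with em {t ≡ t'}
    ... | yes refl = subst (λ r → SE (φ t) (φ t) (φ u) (φ r)) (f refl) rf-se
    ... | no n = se (proj₁ (φ-spec t t' n)) (proj₁ (φ-spec u u' (λ q → n (g q)))) (trans (proj₂ (φ-spec t t' n)) (trans e (sym (proj₂ (φ-spec u u' (λ q → n (g q)))))))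
    s : Op 3
    s v = φ (tri v)

    -- On a finite set the local operation and `φ` have values with the same types of pairs, so a
    -- group element carries one to the other, and `C` is closed under such limits.
    cs : C s
    cs = closed s (λ e → cong φ (tri-cong e)) near
      where
      near : ∀ L → Σ (Op 3) λ g → C g × (∀ x → x ∈ L → g x ≡ s x)
      near L = (λ v → to (proj₁ g) (s' v)) , Ccomp {g = λ (_ : Fin 1) → s'} (CG (proj₁ g)) (λ _ → proj₁ (proj₂ Q)) , λ v m → All.lookup (All-map⁻ (proj₂ g)) m
        where
        Q = loc (coords L)
        s' : Op 3
        s' v = proj₁ Q (v zero) (v (suc zero)) (v (suc (suc zero)))
        agree : ∀ {v w} → v ∈ L → w ∈ L → SEp (s' v , s v) (s' w , s w)
        agree {v} {w} m k with em {tri v ≡ tri w}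
        ... | yes e = subst₂ (λ a b → SE (s' v) a (φ (tri v)) b) (Cext (proj₁ (proj₂ Q)) {v} {w} (tri-inj e)) (cong φ e) rf-se
        ... | no n = let (d , h) = proj₂ (proj₂ Q) (coords∈ m zero) (coords∈ m (suc zero)) (coords∈ m (suc (suc zero))) (coords∈ k zero) (coords∈ k (suc zero)) (coords∈ k (suc (suc zero))) n
                         (d' , h') = φ-spec (tri v) (tri w) n in se d d' (trans h (sym h'))
        g = homGL (map (λ v → s' v , s v) L) (AP-map (allpairs-∈ L agree))

    canonical : Canonical E s
    canonical m a b h = let (α , k) = homT (tabulate (λ l → A l , B l)) (AP-tab (λ {l} {l'} _ → same l l')) in
      α , λ l → k (A l , B l) (∈-tabulate⁺ {f = λ l → A l , B l} l)
      where
      ta tb : Fin m → Tri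
      ta l = tri (λ i → a i l)
      tb l = tri (λ i → b i l)
      A B : Fin m → ℕ
      A l = φ (ta l)
      B l = φ (tb l)
      α = λ i → proj₁ (h i)
      e = λ i l → proj₂ (h i) l
      same : ∀ l l' → SEp (A l , B l) (A l' , B l')
      same l l' = φ-se (tb l) (tb l')
        (λ q → tri-cong (λ i → trans (sym (e i l)) (trans (cong (AutT.to (α i)) (tri-inj {λ i → a i l} {λ i → a i l'} q i)) (e i l'))))
        (λ q → tri-cong (λ i → trans (sym (AutT.from-to (α i) _)) (trans (cong (AutT.from (α i)) (trans (e i l) (trans (tri-inj {λ i → b i l} {λ i → b i l'} q i) (sym (e i l'))))) (AutT.from-to (α i) _))))
        (cong₂ (λ (u , v) r → β u v r) (cong₂ _,_ (ty i₀) (ty i₁)) (ty i₂))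
        where
        i₀ i₁ i₂ : Fin 3
        i₀ = zero
        i₁ = suc zero
        i₂ = suc (suc zero)
        ty : ∀ i → tyOf E (a i l) (a i l') ≡ tyOf E (b i l) (b i l')
        ty i = ty-aut (α i) (e i l) (e i l')

    rot : Tri → Tri
    rot (x , y , z) = y , z , x

    pseudo : PseudoCyclicModClosureAut E s
    -- Rotation invariance of `β` gives `φ` and `φ` after `rot` the same arcs, so their images can
    -- be identified in an amalgam.
    pseudo = let (e , f , pe , pf , h) = amalgam φ (λ t → φ (rot t)) (λ t t' → proj₁ (φ-se (rot t) (rot t') (cong rot) (cong (λ t → rot (rot t))) (cyclic _ _ _))) in
      e , f , embedding-closure e pe , embedding-closure f pf , λ x y z → h (x , y , z)

  -- An outer unary operation leaves the coordinate assigned to `s` unchanged, while rotating the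
  -- arguments shifts it; the pseudo-cyclic identity equates the two.
  exclusive : ¬ (Condition1 × Condition2 ar R E)
  exclusive ((ξ , (ξ-proj , ξ-comp) , uc) , (s , ps , can , (e , f , ce , cf , h))) = next-≢ j (sym (trans (sym ξe) (trans same ξf)))
    where
    next : Fin 3 → Fin 3
    next zero = suc zero
    next (suc zero) = suc (suc zero)
    next (suc (suc zero)) = zero
    next-≢ : ∀ i → next i ≢ i
    next-≢ zero ()
    next-≢ (suc zero) ()
    next-≢ (suc (suc zero)) ()
    unary : ∀ {u} → InClosureAut E u → IsPol {1} (λ v → u (v zero))
    unary cu i m r = let (α , k) = cu (tabulate (m zero)) in Rext (λ l → k _ (∈-tabulate⁺ l)) (AutA.pres (autA α) i (m zero) (r zero))
    idT : AutT E
    idT = record { to = λ x → x ; from = λ x → x ; to-from = λ _ → refl ; from-to = λ _ → refl ; preserve = λ _ _ → refl }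
    -- Canonicity makes s respect pointwise equality: the pair (s x , s y) lies in the orbit of (s x , s x).
    s-ext : ∀ {x y} → x ≗' y → s x ≡ s y
    s-ext {x} {y} q = let (α , k) = can 2 (λ i → two (x i) (y i)) (λ i _ → x i) (λ i → idT , λ { zero → refl ; (suc zero) → sym (q i) }) in
      trans (sym (AutT.from-to α _)) (trans (cong (AutT.from α) (trans (k zero) (sym (k (suc zero))))) (AutT.from-to α _))
    S S' : Fin 1 → Op 3
    S _ = s
    S' _ = compose s (λ i → proj (next i))
    p-next : ∀ i → IsPol (proj {3} (next i))
    p-next i _ _ r = r (next i)
    pS' : ∀ i → IsPol (S' i)
    pS' _ i m r = ps i (λ j → m (next j)) (λ j → r (next j))
    eS fS : Op 3
    eS = compose (λ v → e (v zero)) S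
    fS = compose (λ v → f (v zero)) S'
    peS : IsPol eS
    peS i m r = unary ce i (λ _ l → s (λ j → m j l)) (λ _ → ps i m r)
    pfS : IsPol fS
    pfS i m r = unary cf i (λ _ l → S' zero (λ j → m j l)) (λ _ → pS' zero i m r)
    j : Fin 3
    j = ξ 3 s ps
    ξe : ξ 3 eS peS ≡ j
    ξe = ξ-comp 1 3 (λ v → e (v zero)) (unary ce) S (λ _ → ps) peS
    ξf : ξ 3 fS pfS ≡ next j
    ξf = trans (ξ-comp 1 3 (λ v → f (v zero)) (unary cf) S' pS' pfS)
      (trans (ξ-comp 3 3 s ps (λ i → proj (next i)) p-next (pS' zero)) (ξ-proj 3 (next j) (p-next j)))
    same : ξ 3 eS peS ≡ ξ 3 fS pfS
    same = proj₂ (uc 3) eS peS fS pfS (λ v _ → trans (cong e (s-ext (λ { zero → refl ; (suc zero) → refl ; (suc (suc zero)) → refl })))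
      (trans (h (v zero) (v (suc zero)) (v (suc (suc zero)))) (cong f (s-ext (λ { zero → refl ; (suc zero) → refl ; (suc (suc zero)) → refl })))))

  dichotomy : Condition1 ⊎ Condition2 ar R E
  dichotomy with em {Triads.Essential world}
  ... | no n = inj₁ (condition1 (unary-reading n))
  ... | yes ess with Cases.world-cases world ess
  ... | inj₁ f = inj₁ (condition1 (triad-reading f))
  ... | inj₂ l = inj₂ (condition2 l)

theorem4p1 : ExcludedMiddle 0ℓ →
    (E : ℕ → ℕ → Bool) → IsUniversalHomogeneousTournament E →
    (I : Set) (ar : I → ℕ) (R : (i : I) → (Fin (ar i) → ℕ) → Set) →
    Structure.IsReduct ar R E → Structure.ModelCompleteCore ar R →
    ExactlyOne (Structure.Condition1 ar R) (Condition2 ar R E)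
theorem4p1 em E uht I ar R red mcc = dichotomy , exclusive
  where
  open Dichotomy em E uht ar R red mcc
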